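{- If a set $\{\pi_1,\pi_2,\pi_3,\pi_4\}$ of four (distinct) $4$-point permutations is quasirandom-forcing, then either the matrix $A_{\pi_1}+A_{\pi_2}+A_{\pi_3}+A_{\pi_4}$ is the $4\times4$ all-one matrix or, possibly after relabeling the four permutations, the matrix $A_{\pi_1}+A_{\pi_2}-A_{\pi_3}-A_{\pi_4}$ is the zero matrix.
   Context: For a $k$-point permutation $\pi$ (a bijection of $[k]=\{1,\dots,k\}$), the permutation matrix $A_\pi$ is the $k\times k$ matrix whose entry in row $i$ and column $\pi(i)$ is $1$ for each $i\in[k]$, all other entries being $0$. Pattern density: for a $k$-point permutation $\sigma$ and an $n$-point permutation $\pi$, $d(\sigma,\pi)$ is the probability that a uniformly random $k$-subset $\{a_1<\dots<a_k\}$ of $[n]$ induces $\sigma$, i.e. $\pi(a_i)<\pi(a_j)\iff\sigma(i)<\sigma(j)$. A set $S$ of permutations is quasirandom-forcing if every sequence $(\pi_n)$ of permutations with sizes tending to infinity with $d(\sigma,\pi_n)\to1/|\sigma|!$ for all $\sigma\in S$ satisfies $d(\sigma,\pi_n)\to1/|\sigma|!$ for every permutation $\sigma$. -}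

module Defs where

open import Data.Nat using (ℕ; zero; suc; _≤_; _<ᵇ_; _!)
open import Data.Nat.Combinatorics using (_C_)
open import Data.Fin using (Fin; toℕ; _≟_)
open import Relation.Nullary using (yes; no)
open import Data.Fin.Permutation using (Permutation′; _⟨$⟩ʳ_; _≈_)
open import Data.Bool using (Bool; true; false; if_then_else_; _xor_; not)
open import Data.List using (List; []; _∷_; map; _++_; allFin)
open import Data.Bool.ListAction using (all)
open import Data.Nat.ListAction using (sum)
open import Data.List.Relation.Unary.All using (All)
open import Data.Vec using (Vec; lookup) renaming ([] to []ᵥ; _∷_ to _∷ᵥ_)
open import Data.Integer as ℤ using (ℤ)
open import Data.Rational as ℚ using (ℚ; 0ℚ; 1ℚ; _/_; ∣_∣; _-_)
open import Data.Product using (Σ; ∃; _,_; _×_)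
open import Relation.Binary.PropositionalEquality using (_≡_)

choose : {A : Set} → (k : ℕ) → List A → List (Vec A k)
choose zero    xs       = []ᵥ ∷ []
choose (suc k) []       = []
choose (suc k) (x ∷ xs) = map (x ∷ᵥ_) (choose k xs) ++ choose (suc k) xs

-- Increasing k-tuples a₁ < … < a_k of [n], i.e. the k-subsets of [n].
kSubsets : (n k : ℕ) → List (Vec (Fin n) k)
kSubsets n k = choose k (allFin n)

_⇔ᵇ_ : Bool → Bool → Bool
x ⇔ᵇ y = not (x xor y)

induces : {k n : ℕ} → Permutation′ k → Permutation′ n → Vec (Fin n) k → Bool
induces {k} σ π a =
  all (λ i → all (λ j →
      (toℕ (π ⟨$⟩ʳ lookup a i) <ᵇ toℕ (π ⟨$⟩ʳ lookup a j))
        ⇔ᵇ (toℕ (σ ⟨$⟩ʳ i) <ᵇ toℕ (σ ⟨$⟩ʳ j)))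
    (allFin k)) (allFin k)

count : {k n : ℕ} → Permutation′ k → Permutation′ n → ℕ
count {k} {n} σ π = sum (map (λ a → if induces σ π a then 1 else 0) (kSubsets n k))

-- Pattern density d(σ,π) (set to 0 when n < k, where there are no k-subsets).
density : {k n : ℕ} → Permutation′ k → Permutation′ n → ℚ
density {k} {n} σ π with n C k
... | zero  = 0ℚ
... | suc m = ℤ.+ (count σ π) / suc m

-- 1 / k!  (k! is never 0; the zero case is unreachable)
uniform : ℕ → ℚ
uniform k with (k !)
... | zero  = 0ℚ
... | suc m = ℤ.+ 1 / suc m

_⟶_ : (ℕ → ℚ) → ℚ → Set
f ⟶ q = (ε : ℚ) → 0ℚ ℚ.< ε → ∃ λ N → (m : ℕ) → N ≤ m → ∣ f m - q ∣ ℚ.< ε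

TendsToInfinity : (ℕ → ℕ) → Set
TendsToInfinity n = (M : ℕ) → ∃ λ N → (m : ℕ) → N ≤ m → M ≤ n m

Perm : Set
Perm = Σ ℕ Permutation′

QRFor : (n : ℕ → ℕ) → ((m : ℕ) → Permutation′ (n m)) → Perm → Set
QRFor n π (k , σ) = (λ m → density σ (π m)) ⟶ uniform k

QuasirandomForcing : List Perm → Set
QuasirandomForcing S =
  (n : ℕ → ℕ) (π : (m : ℕ) → Permutation′ (n m)) →
  TendsToInfinity n → All (QRFor n π) S → (τ : Perm) → QRFor n π τ

A : {k : ℕ} → Permutation′ k → Fin k → Fin k → ℤ
A π i j with π ⟨$⟩ʳ i ≟ j
... | yes _ = ℤ.+ 1
... | no  _ = ℤ.+ 0

{-# OPTIONS --safe #-}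

-- The uniform permuton is perturbed to a density 1 + h on an N × N grid, with
-- h(x,y) = Σ M_pq f_p(x) f_q(y) for cubic polynomials f_p dual to the order statistics of
-- four random points.  The density of a 4-point pattern σ is then (1 + ⟨A_σ , M⟩ + R_σ(M))/24,
-- up to O(1/N), with R_σ of second order.  If the projections of A_π₁, …, A_π₄ to the matrices
-- with zero row and column sums are linearly independent, then so are those of A_π₁, …, A_π₄, A_τ
-- for some τ, and a contraction argument finds M for which the four given densities are 1/24
-- while that of τ is (1 + t)/24 with a fixed t > 0.  The projections have inner products a − 1,
-- where a is the number of points at which two permutations agree.  Their Gram matrix has
-- diagonal 3 and off-diagonal entries in {−1, 0, 1}, so it is singular only if the latter are
-- −sᵢsⱼ for signs sᵢ.  Equal signs mean that the four matrices sum to the all-one matrix, two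
-- against two that A₁ + A₂ = A₃ + A₄, and one against three is impossible.
module Submission where

open import Defs
open import Data.Nat as ℕ using (ℕ; zero; suc)
import Data.Nat.Properties as ℕₚ
open import Data.Fin as Fin using (Fin; zero; suc; toℕ; #_)
open import Data.Fin.Permutation as Perm using (Permutation′; _⟨$⟩ʳ_; _⟨$⟩ˡ_; _≈_; permutation; inverseˡ; inverseʳ; transpose)
open import Data.List as List using (List; []; _∷_; map; _++_; concatMap; length; allFin; downFrom; replicate; tabulate; foldr)
open import Data.List.Relation.Unary.All as All using (All; []; _∷_)
open import Data.List.Relation.Unary.Any as Any using (Any; here; there)
open import Data.Vec as Vec using (Vec; lookup) renaming ([] to []ᵥ; _∷_ to _∷ᵥ_)
open import Data.Empty using (⊥; ⊥-elim)
open import Data.Product using (∃; _,_; _×_; proj₁; proj₂)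
open import Data.Sum using (_⊎_; inj₁; inj₂)
open import Relation.Nullary using (Dec; yes; no; ¬_; does; ¬?; _⊎-dec_; _×-dec_; _→-dec_)
open import Relation.Binary.PropositionalEquality

-- Why cubics: the polynomials of degree at most 3 form a space of dimension four, one dimension for
-- each order statistic of four points, so a dual basis exists. Normalised suitably, it is bounded
-- uniformly in N. Hence the radius of the contraction, and with it t, is fixed before the grid and
-- the accuracy are chosen. The obstacle is that everything takes place in ℚ and with finite
-- permutations: no limit permuton is available, and the nonlinear system for M need not have a
-- rational solution. It is therefore solved only up to an error ε. The resulting rational density
-- is cleared of denominators and read as a multiset of grid points, and sorting that multiset, with
-- ties broken by position, gives a permutation. Letting ε tend to 0 along the sequence turns the
-- approximate densities into limits. Why τ exists: the projections of the 24 permutation matrices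
-- form a tight frame of the 9-dimensional space of matrices with zero row and column sums, so their
-- squared distances to the span of four of them have a positive average. No choice of τ adapted to
-- the given permutations is needed.

module _ where

  open import Data.Nat using (_<ᵇ_; _≡ᵇ_)
  open import Data.Nat.Combinatorics using (nCk+nC[k+1]≡[n+1]C[k+1]; k>n⇒nCk≡0; nC1≡n; nCn≡1; nCk≡nC[n∸k]) renaming (_C_ to infixl 8 _C_)
  open import Data.Nat.ListAction using (sum)
  open import Data.Nat.Tactic.RingSolver using () renaming (solve-∀ to ℕ-solve-∀)
  open import Data.Fin using (punchIn; punchOut; fromℕ<)
  open import Data.Fin.Properties using (all?; any?; toℕ<n; toℕ-injective; toℕ-fromℕ<; punchOut-injective; injective⇒≤)
  open import Data.Bool using (Bool; T; true; false; if_then_else_; not; _∧_)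
  open import Data.Bool.ListAction using (all)
  open import Data.Integer as ℤ using (ℤ)
  import Data.Integer.Properties as ℤₚ
  open import Data.List.Properties using (length-++; length-map; length-downFrom; map-tabulate; tabulate-lookup; map-∘; map-++)
  open import Data.List.Membership.Propositional using (_∈_; find)
  open import Data.List.Membership.Propositional.Properties using (∈-++⁻; ∈-map⁻; ∈-concatMap⁻)
  open import Data.Vec.Properties using (lookup-map; lookup-zipWith; lookup∘tabulate; tabulate-∘; map-lookup-allFin; ≡-dec)
  open import Data.Rational
  open import Data.Rational.Properties
  open import Data.Rational.Unnormalised as ℚᵘ using (mkℚᵘ; *≡*)
  import Data.Rational.Unnormalised.Properties as ℚᵘₚ
  open import Function using (_∘_)
  open import Relation.Binary using (tri<; tri≈; tri>)
  open import Relation.Nullary.Decidable using (dec⇒maybe; decidable-stable; from-yes)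
  open import Tactic.RingSolver using (solve-∀)
  open import Tactic.RingSolver.Core.AlmostCommutativeRing using (AlmostCommutativeRing; fromCommutativeRing)

  -- Rational arithmetic

  ℚ-ring : AlmostCommutativeRing _ _
  ℚ-ring = fromCommutativeRing +-*-commutativeRing (λ x → dec⇒maybe (0ℚ ≟ x))

  ι : ℕ → ℚ
  ι n = ℤ.+ n / 1

  private
    toℚᵘ-ι : ∀ n → toℚᵘ (ι n) ℚᵘ.≃ mkℚᵘ (ℤ.+ n) 0
    toℚᵘ-ι n = toℚᵘ-fromℚᵘ (mkℚᵘ (ℤ.+ n) 0)

  ι-+ : ∀ m n → ι (m ℕ.+ n) ≡ ι m + ι n
  ι-+ m n = toℚᵘ-injective (begin
    toℚᵘ (ι (m ℕ.+ n))                         ≈⟨ toℚᵘ-ι (m ℕ.+ n) ⟩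
    mkℚᵘ (ℤ.+ (m ℕ.+ n)) 0                     ≈⟨ *≡* (cong (ℤ._* ℤ.+ 1) (trans (ℤₚ.pos-+ m n) (sym (cong₂ ℤ._+_ (ℤₚ.*-identityʳ (ℤ.+ m)) (ℤₚ.*-identityʳ (ℤ.+ n)))))) ⟩
    mkℚᵘ (ℤ.+ m) 0 ℚᵘ.+ mkℚᵘ (ℤ.+ n) 0         ≈⟨ ℚᵘₚ.+-cong (toℚᵘ-ι m) (toℚᵘ-ι n) ⟨
    toℚᵘ (ι m) ℚᵘ.+ toℚᵘ (ι n)                 ≈⟨ toℚᵘ-homo-+ (ι m) (ι n) ⟨
    toℚᵘ (ι m + ι n)                           ∎)
    where open ℚᵘₚ.≃-Reasoning

  ι-* : ∀ m n → ι (m ℕ.* n) ≡ ι m * ι n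
  ι-* m n = toℚᵘ-injective (begin
    toℚᵘ (ι (m ℕ.* n))                         ≈⟨ toℚᵘ-ι (m ℕ.* n) ⟩
    mkℚᵘ (ℤ.+ (m ℕ.* n)) 0                     ≈⟨ *≡* (cong (ℤ._* ℤ.+ 1) (ℤₚ.pos-* m n)) ⟩
    mkℚᵘ (ℤ.+ m) 0 ℚᵘ.* mkℚᵘ (ℤ.+ n) 0         ≈⟨ ℚᵘₚ.*-cong (toℚᵘ-ι m) (toℚᵘ-ι n) ⟨
    toℚᵘ (ι m) ℚᵘ.* toℚᵘ (ι n)                 ≈⟨ toℚᵘ-homo-* (ι m) (ι n) ⟨
    toℚᵘ (ι m * ι n)                           ∎)
    where open ℚᵘₚ.≃-Reasoning

  /-*-cancel : ∀ i n → (i / suc n) * ι (suc n) ≡ i / 1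
  /-*-cancel i n = toℚᵘ-injective (begin
    toℚᵘ ((i / suc n) * ι (suc n))             ≈⟨ toℚᵘ-homo-* (i / suc n) (ι (suc n)) ⟩
    toℚᵘ (i / suc n) ℚᵘ.* toℚᵘ (ι (suc n))     ≈⟨ ℚᵘₚ.*-cong (toℚᵘ-fromℚᵘ (mkℚᵘ i n)) (toℚᵘ-ι (suc n)) ⟩
    mkℚᵘ i n ℚᵘ.* mkℚᵘ (ℤ.+ suc n) 0           ≈⟨ *≡* (trans (ℤₚ.*-identityʳ (i ℤ.* ℤ.+ suc n)) (cong (i ℤ.*_) (sym (cong (ℤ.+_) (ℕₚ.*-identityʳ (suc n)))))) ⟩
    mkℚᵘ i 0                                   ≈⟨ toℚᵘ-fromℚᵘ (mkℚᵘ i 0) ⟨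
    toℚᵘ (i / 1)                               ∎)
    where open ℚᵘₚ.≃-Reasoning

  ι≥0 : ∀ n → 0ℚ ≤ ι n
  ι≥0 n = nonNegative⁻¹ (ι n) {{normalize-nonNeg n 1}}

  ι-mono : ∀ {m n} → m ℕ.≤ n → ι m ≤ ι n
  ι-mono {m} {n} m≤n = subst₂ _≤_ (+-identityʳ (ι m)) (trans (sym (ι-+ m (n ℕ.∸ m))) (cong ι (ℕₚ.m+[n∸m]≡n m≤n)))
    (+-monoʳ-≤ (ι m) (ι≥0 (n ℕ.∸ m)))

  ι-suc>0 : ∀ n → 0ℚ < ι (suc n)
  ι-suc>0 n = positive⁻¹ (ι (suc n)) {{normalize-pos (suc n) 1}}

  ι>0 : ∀ {n} → 0 ℕ.< n → 0ℚ < ι n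
  ι>0 {suc n} _ = ι-suc>0 n

  *-monoˡ : ∀ {p q r} → 0ℚ ≤ r → p ≤ q → r * p ≤ r * q
  *-monoˡ {r = r} 0≤r p≤q = *-monoˡ-≤-nonNeg r {{nonNegative 0≤r}} p≤q

  *-monoʳ : ∀ {p q r} → 0ℚ ≤ r → p ≤ q → p * r ≤ q * r
  *-monoʳ {r = r} 0≤r p≤q = *-monoʳ-≤-nonNeg r {{nonNegative 0≤r}} p≤q

  *-mono : ∀ {p q r s} → 0ℚ ≤ p → 0ℚ ≤ s → p ≤ q → r ≤ s → p * r ≤ q * s
  *-mono 0≤p 0≤s p≤q r≤s = ≤-trans (*-monoˡ 0≤p r≤s) (*-monoʳ 0≤s p≤q)

  *-nonNeg : ∀ {p q} → 0ℚ ≤ p → 0ℚ ≤ q → 0ℚ ≤ p * q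
  *-nonNeg {p} {q} 0≤p 0≤q = subst (_≤ p * q) (*-zeroʳ p) (*-monoˡ 0≤p 0≤q)

  +-nonNeg : ∀ {p q} → 0ℚ ≤ p → 0ℚ ≤ q → 0ℚ ≤ p + q
  +-nonNeg {p} {q} 0≤p 0≤q = subst (_≤ p + q) (+-identityʳ 0ℚ) (+-mono-≤ 0≤p 0≤q)

  *-pos : ∀ {p q} → 0ℚ < p → 0ℚ < q → 0ℚ < p * q
  *-pos {p} {q} 0<p 0<q = positive⁻¹ (p * q) {{pos*pos⇒pos p {{positive 0<p}} q {{positive 0<q}}}}

  p≤q⇒0≤q-p : ∀ {p q} → p ≤ q → 0ℚ ≤ q - p
  p≤q⇒0≤q-p {p} {q} p≤q = subst (_≤ q - p) (+-inverseʳ p) (+-monoˡ-≤ (- p) p≤q)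

  0≤q-p⇒p≤q : ∀ {p q} → 0ℚ ≤ q - p → p ≤ q
  0≤q-p⇒p≤q {p} {q} 0≤ = subst₂ _≤_ (+-identityˡ p) (lemma q p) (+-monoˡ-≤ p 0≤)
    where
    lemma : ∀ a b → (a - b) + b ≡ a
    lemma = solve-∀ ℚ-ring

  -- An inequality is certified by writing its slack as a visibly nonnegative expression.
  by-slack : ∀ {p q r} → q - p ≡ r → 0ℚ ≤ r → p ≤ q
  by-slack eq 0≤r = 0≤q-p⇒p≤q (subst (0ℚ ≤_) (sym eq) 0≤r)

  p≤∣p∣ : ∀ p → p ≤ ∣ p ∣
  p≤∣p∣ p with ≤-total 0ℚ p
  ... | inj₁ 0≤p = ≤-reflexive (sym (0≤p⇒∣p∣≡p 0≤p))
  ... | inj₂ p≤0 = ≤-trans p≤0 (0≤∣p∣ p)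

  -p≤∣p∣ : ∀ p → - p ≤ ∣ p ∣
  -p≤∣p∣ p = subst (- p ≤_) (∣-p∣≡∣p∣ p) (p≤∣p∣ (- p))

  ∣p∣≤ : ∀ {p q} → p ≤ q → - p ≤ q → ∣ p ∣ ≤ q
  ∣p∣≤ {p} p≤q -p≤q with ∣p∣≡p∨∣p∣≡-p p
  ... | inj₁ eq = subst (_≤ _) (sym eq) p≤q
  ... | inj₂ eq = subst (_≤ _) (sym eq) -p≤q

  ∣+∣≤ : ∀ {p q r s} → ∣ p ∣ ≤ r → ∣ q ∣ ≤ s → ∣ p + q ∣ ≤ r + s
  ∣+∣≤ {p} {q} a b = ≤-trans (∣p+q∣≤∣p∣+∣q∣ p q) (+-mono-≤ a b)

  ∣*∣≤ : ∀ {p q r s} → ∣ p ∣ ≤ r → ∣ q ∣ ≤ s → ∣ p * q ∣ ≤ r * s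
  ∣*∣≤ {p} {q} a b = subst (_≤ _) (sym (∣p*q∣≡∣p∣*∣q∣ p q))
    (*-mono (0≤∣p∣ p) (≤-trans (0≤∣p∣ q) b) a b)

  *-cancelʳ-≤ : ∀ {p q r} → 0ℚ < r → p * r ≤ q * r → p ≤ q
  *-cancelʳ-≤ {r = r} 0<r = *-cancelʳ-≤-pos r {{positive 0<r}}

  reciprocal : ∀ {p} → 0ℚ < p → ∃ λ q → p * q ≡ 1ℚ × 0ℚ < q
  reciprocal {p} 0<p = 1/_ p {{nz}} , *-inverseʳ p {{nz}} , positive⁻¹ (1/_ p {{nz}}) {{1/pos⇒pos p {{positive 0<p}}}}
    where
    nz = pos⇒nonZero p {{positive 0<p}}

  archimedean : ∀ p → ∃ λ n → p ≤ ι n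
  archimedean p@(mkℚ (ℤ.+ a) d _) = a , *-cancelʳ-≤ (ι-suc>0 d)
    (subst₂ _≤_ (trans (sym (/-*-cancel (ℤ.+ a) d)) (cong (_* ι (suc d)) (↥p/↧p≡p p))) (ι-* a (suc d))
      (ι-mono (ℕₚ.≤-trans (ℕₚ.≤-reflexive (sym (ℕₚ.*-identityʳ a))) (ℕₚ.*-monoʳ-≤ a (ℕ.s≤s ℕ.z≤n)))))
  archimedean (mkℚ ℤ.-[1+ a ] d _) = 0 , *≤* ℤ.-≤+

  -- Finite sums

  ∑ : {I : Set} → List I → (I → ℚ) → ℚ
  ∑ []       f = 0ℚ
  ∑ (x ∷ xs) f = f x + ∑ xs f

  module _ {I : Set} where

    ∑-cong∈ : ∀ (xs : List I) {f g : I → ℚ} → (∀ x → x ∈ xs → f x ≡ g x) → ∑ xs f ≡ ∑ xs g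
    ∑-cong∈ []       eq = refl
    ∑-cong∈ (x ∷ xs) eq = cong₂ _+_ (eq x (here refl)) (∑-cong∈ xs (λ y y∈ → eq y (there y∈)))

    ∑-cong : ∀ (xs : List I) {f g : I → ℚ} → (∀ x → f x ≡ g x) → ∑ xs f ≡ ∑ xs g
    ∑-cong xs eq = ∑-cong∈ xs (λ x _ → eq x)

    ∑-mono : ∀ (xs : List I) {f g : I → ℚ} → (∀ x → x ∈ xs → f x ≤ g x) → ∑ xs f ≤ ∑ xs g
    ∑-mono []       le = ≤-refl
    ∑-mono (x ∷ xs) le = +-mono-≤ (le x (here refl)) (∑-mono xs (λ y y∈ → le y (there y∈)))

    ∑-nonNeg : ∀ (xs : List I) {f : I → ℚ} → (∀ x → 0ℚ ≤ f x) → 0ℚ ≤ ∑ xs f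
    ∑-nonNeg []       0≤f = ≤-refl
    ∑-nonNeg (x ∷ xs) 0≤f = +-nonNeg (0≤f x) (∑-nonNeg xs 0≤f)

    ∑-+ : ∀ (xs : List I) (f g : I → ℚ) → ∑ xs (λ x → f x + g x) ≡ ∑ xs f + ∑ xs g
    ∑-+ []       f g = refl
    ∑-+ (x ∷ xs) f g = trans (cong (f x + g x +_) (∑-+ xs f g)) (lemma (f x) (g x) (∑ xs f) (∑ xs g))
      where
      lemma : ∀ a b c d → a + b + (c + d) ≡ a + c + (b + d)
      lemma = solve-∀ ℚ-ring

    ∑-*ˡ : ∀ (xs : List I) c (f : I → ℚ) → ∑ xs (λ x → c * f x) ≡ c * ∑ xs f
    ∑-*ˡ []       c f = sym (*-zeroʳ c)
    ∑-*ˡ (x ∷ xs) c f = trans (cong (c * f x +_) (∑-*ˡ xs c f)) (sym (*-distribˡ-+ c (f x) (∑ xs f)))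

    ∑-*ʳ : ∀ (xs : List I) c (f : I → ℚ) → ∑ xs (λ x → f x * c) ≡ ∑ xs f * c
    ∑-*ʳ xs c f = trans (∑-cong xs (λ x → *-comm (f x) c)) (trans (∑-*ˡ xs c f) (*-comm c (∑ xs f)))

    ∑-- : ∀ (xs : List I) (f g : I → ℚ) → ∑ xs (λ x → f x - g x) ≡ ∑ xs f - ∑ xs g
    ∑-- []       f g = refl
    ∑-- (x ∷ xs) f g = trans (cong (f x - g x +_) (∑-- xs f g)) (lemma (f x) (g x) (∑ xs f) (∑ xs g))
      where
      lemma : ∀ a b c d → a - b + (c - d) ≡ a + c - (b + d)
      lemma = solve-∀ ℚ-ring

    ∑-const : ∀ (xs : List I) c → ∑ xs (λ _ → c) ≡ ι (length xs) * c
    ∑-const []       c = sym (*-zeroˡ c)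
    ∑-const (x ∷ xs) c = begin
      c + ∑ xs (λ _ → c)          ≡⟨ cong (c +_) (∑-const xs c) ⟩
      c + ι (length xs) * c       ≡⟨ lemma c (ι (length xs)) ⟩
      (1ℚ + ι (length xs)) * c    ≡⟨ cong (_* c) (ι-+ 1 (length xs)) ⟨
      ι (suc (length xs)) * c     ∎
      where
      open ≡-Reasoning
      lemma : ∀ a b → a + b * a ≡ (1ℚ + b) * a
      lemma = solve-∀ ℚ-ring

    ∑-∣∣ : ∀ (xs : List I) (f : I → ℚ) → ∣ ∑ xs f ∣ ≤ ∑ xs (λ x → ∣ f x ∣)
    ∑-∣∣ []       f = ≤-refl
    ∑-∣∣ (x ∷ xs) f = ∣+∣≤ {f x} {∑ xs f} ≤-refl (∑-∣∣ xs f)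

    ∑-++ : ∀ (xs ys : List I) (f : I → ℚ) → ∑ (xs ++ ys) f ≡ ∑ xs f + ∑ ys f
    ∑-++ []       ys f = sym (+-identityˡ (∑ ys f))
    ∑-++ (x ∷ xs) ys f = trans (cong (f x +_) (∑-++ xs ys f)) (sym (+-assoc (f x) (∑ xs f) (∑ ys f)))

  module _ {I J : Set} where

    ∑-map : ∀ (g : I → J) (xs : List I) (f : J → ℚ) → ∑ (map g xs) f ≡ ∑ xs (λ x → f (g x))
    ∑-map g []       f = refl
    ∑-map g (x ∷ xs) f = cong (f (g x) +_) (∑-map g xs f)

    ∑-concatMap : ∀ (g : I → List J) (xs : List I) (f : J → ℚ) → ∑ (concatMap g xs) f ≡ ∑ xs (λ x → ∑ (g x) f)
    ∑-concatMap g []       f = refl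
    ∑-concatMap g (x ∷ xs) f = trans (∑-++ (g x) (concatMap g xs) f) (cong (∑ (g x) f +_) (∑-concatMap g xs f))

    ∑-swap : ∀ (xs : List I) (ys : List J) (f : I → J → ℚ) →
             ∑ xs (λ x → ∑ ys (f x)) ≡ ∑ ys (λ y → ∑ xs (λ x → f x y))
    ∑-swap []       ys f = sym (trans (∑-const ys 0ℚ) (*-zeroʳ (ι (length ys))))
    ∑-swap (x ∷ xs) ys f = trans (cong (∑ ys (f x) +_) (∑-swap xs ys f)) (sym (∑-+ ys (f x) (λ y → ∑ xs (λ x′ → f x′ y))))

    ∑-product : ∀ (xs : List I) (ys : List J) (f : I → ℚ) (g : J → ℚ) →
                ∑ xs (λ x → ∑ ys (λ y → f x * g y)) ≡ ∑ xs f * ∑ ys g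
    ∑-product xs ys f g = trans (∑-cong xs (λ x → ∑-*ˡ ys (f x) g)) (∑-*ʳ xs (∑ ys g) f)

  module _ {I : Set} where

    ∑-choose : ∀ k (x : I) xs (G : Vec I (suc k) → ℚ) →
               ∑ (choose (suc k) (x ∷ xs)) G ≡ ∑ (choose k xs) (λ v → G (x ∷ᵥ v)) + ∑ (choose (suc k) xs) G
    ∑-choose k x xs G = trans (∑-++ (map (x ∷ᵥ_) (choose k xs)) (choose (suc k) xs) G)
      (cong (_+ ∑ (choose (suc k) xs) G) (∑-map (x ∷ᵥ_) (choose k xs) G))

    length-choose : ∀ k (xs : List I) → length (choose k xs) ≡ length xs C k
    length-choose zero    xs       = refl
    length-choose (suc k) []       = sym (k>n⇒nCk≡0 {0} {suc k} (ℕ.s≤s ℕ.z≤n))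
    length-choose (suc k) (x ∷ xs) = begin
      length (map (x ∷ᵥ_) (choose k xs) ++ choose (suc k) xs)              ≡⟨ length-++ (map (x ∷ᵥ_) (choose k xs)) ⟩
      length (map (x ∷ᵥ_) (choose k xs)) ℕ.+ length (choose (suc k) xs)    ≡⟨ cong₂ ℕ._+_ (trans (length-map (x ∷ᵥ_) (choose k xs)) (length-choose k xs)) (length-choose (suc k) xs) ⟩
      length xs C k ℕ.+ length xs C suc k                                  ≡⟨ nCk+nC[k+1]≡[n+1]C[k+1] (length xs) k ⟩
      suc (length xs) C suc k                                              ∎
      where open ≡-Reasoning

    ∈-choose : ∀ k (xs : List I) {v} → v ∈ choose k xs → ∀ i → lookup v i ∈ xs
    ∈-choose (suc k) (x ∷ xs) v∈ i with ∈-++⁻ (map (x ∷ᵥ_) (choose k xs)) v∈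
    ... | inj₂ v∈′ = there (∈-choose (suc k) xs v∈′ i)
    ... | inj₁ v∈′ with ∈-map⁻ (x ∷ᵥ_) v∈′
    ∈-choose (suc k) (x ∷ xs) v∈ zero    | inj₁ v∈′ | w , w∈ , refl = here refl
    ∈-choose (suc k) (x ∷ xs) v∈ (suc i) | inj₁ v∈′ | w , w∈ , refl = there (∈-choose k xs w∈ i)

    tuples : (k : ℕ) → List I → List (Vec I k)
    tuples zero    xs = []ᵥ ∷ []
    tuples (suc k) xs = concatMap (λ x → map (x ∷ᵥ_) (tuples k xs)) xs

    ∑-tuples : ∀ k (xs : List I) (G : Vec I (suc k) → ℚ) →
               ∑ (tuples (suc k) xs) G ≡ ∑ xs (λ x → ∑ (tuples k xs) (λ v → G (x ∷ᵥ v)))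
    ∑-tuples k xs G = trans (∑-concatMap (λ x → map (x ∷ᵥ_) (tuples k xs)) xs G)
      (∑-cong xs (λ x → ∑-map (x ∷ᵥ_) (tuples k xs) G))

  ∈-downFrom : ∀ {n x} → x ∈ downFrom n → x ℕ.< n
  ∈-downFrom {suc n} (here refl) = ℕₚ.≤-refl
  ∈-downFrom {suc n} (there x∈)  = ℕₚ.m<n⇒m<1+n (∈-downFrom x∈)

  -- Binomial coefficients

  pascal : ∀ n k → suc n C suc k ≡ n C k ℕ.+ n C suc k
  pascal n k = sym (nCk+nC[k+1]≡[n+1]C[k+1] n k)

  absorption : ∀ n k → suc k ℕ.* (suc n C suc k) ≡ suc n ℕ.* (n C k)
  absorption n       zero    = trans (ℕₚ.*-identityˡ (suc n C 1)) (trans (nC1≡n (suc n)) (sym (ℕₚ.*-identityʳ (suc n))))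
  absorption zero    (suc k) = trans (cong (suc (suc k) ℕ.*_) (k>n⇒nCk≡0 {1} {suc (suc k)} (ℕ.s≤s (ℕ.s≤s ℕ.z≤n))))
    (trans (ℕₚ.*-zeroʳ (suc (suc k))) (sym (trans (ℕₚ.*-identityˡ (0 C suc k)) (k>n⇒nCk≡0 {0} {suc k} (ℕ.s≤s ℕ.z≤n)))))
  absorption (suc m) (suc l) = begin
    suc (suc l) ℕ.* (suc (suc m) C suc (suc l))                        ≡⟨ cong (suc (suc l) ℕ.*_) (pascal (suc m) (suc l)) ⟩
    suc (suc l) ℕ.* (a ℕ.+ b)                                          ≡⟨ split l a b ⟩
    suc l ℕ.* a ℕ.+ a ℕ.+ suc (suc l) ℕ.* b                            ≡⟨ cong₂ (λ x y → x ℕ.+ a ℕ.+ y) (absorption m l) (absorption m (suc l)) ⟩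
    suc m ℕ.* (m C l) ℕ.+ a ℕ.+ suc m ℕ.* (m C suc l)                  ≡⟨ join m (m C l) a (m C suc l) ⟩
    suc m ℕ.* (m C l ℕ.+ m C suc l) ℕ.+ a                              ≡⟨ cong (λ x → suc m ℕ.* x ℕ.+ a) (pascal m l) ⟨
    suc m ℕ.* a ℕ.+ a                                                  ≡⟨ ℕₚ.+-comm (suc m ℕ.* a) a ⟩
    suc (suc m) ℕ.* a                                                  ∎
    where
    open ≡-Reasoning
    a = suc m C suc l
    b = suc m C suc (suc l)
    split : ∀ l a b → suc (suc l) ℕ.* (a ℕ.+ b) ≡ suc l ℕ.* a ℕ.+ a ℕ.+ suc (suc l) ℕ.* b
    split = ℕ-solve-∀
    join : ∀ m x a y → suc m ℕ.* x ℕ.+ a ℕ.+ suc m ℕ.* y ≡ suc m ℕ.* (x ℕ.+ y) ℕ.+ a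
    join = ℕ-solve-∀

  -- Both sides count the pairs of disjoint subsets of sizes `j` and `k` of a set with `n + j`
  -- elements: the `j`-set first, or the union first.
  trinomial-revision : ∀ n k j → (n ℕ.+ j) C j ℕ.* (n C k) ≡ (k ℕ.+ j) C j ℕ.* ((n ℕ.+ j) C (k ℕ.+ j))
  trinomial-revision n k zero    rewrite ℕₚ.+-identityʳ n | ℕₚ.+-identityʳ k = refl
  trinomial-revision n k (suc j) rewrite ℕₚ.+-suc n j | ℕₚ.+-suc k j = ℕₚ.*-cancelˡ-≡ _ _ (suc j) (begin
    suc j ℕ.* (suc (n ℕ.+ j) C suc j ℕ.* (n C k))                           ≡⟨ ℕₚ.*-assoc (suc j) (suc (n ℕ.+ j) C suc j) (n C k) ⟨
    suc j ℕ.* (suc (n ℕ.+ j) C suc j) ℕ.* (n C k)                           ≡⟨ cong (ℕ._* (n C k)) (absorption (n ℕ.+ j) j) ⟩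
    suc (n ℕ.+ j) ℕ.* ((n ℕ.+ j) C j) ℕ.* (n C k)                           ≡⟨ ℕₚ.*-assoc (suc (n ℕ.+ j)) ((n ℕ.+ j) C j) (n C k) ⟩
    suc (n ℕ.+ j) ℕ.* ((n ℕ.+ j) C j ℕ.* (n C k))                           ≡⟨ cong (suc (n ℕ.+ j) ℕ.*_) (trinomial-revision n k j) ⟩
    suc (n ℕ.+ j) ℕ.* ((k ℕ.+ j) C j ℕ.* ((n ℕ.+ j) C (k ℕ.+ j)))           ≡⟨ swap (suc (n ℕ.+ j)) ((k ℕ.+ j) C j) ((n ℕ.+ j) C (k ℕ.+ j)) ⟩
    (k ℕ.+ j) C j ℕ.* (suc (n ℕ.+ j) ℕ.* ((n ℕ.+ j) C (k ℕ.+ j)))           ≡⟨ cong ((k ℕ.+ j) C j ℕ.*_) (absorption (n ℕ.+ j) (k ℕ.+ j)) ⟨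
    (k ℕ.+ j) C j ℕ.* (suc (k ℕ.+ j) ℕ.* (suc (n ℕ.+ j) C suc (k ℕ.+ j)))   ≡⟨ swap′ ((k ℕ.+ j) C j) (suc (k ℕ.+ j)) (suc (n ℕ.+ j) C suc (k ℕ.+ j)) ⟩
    suc (k ℕ.+ j) ℕ.* ((k ℕ.+ j) C j) ℕ.* (suc (n ℕ.+ j) C suc (k ℕ.+ j))   ≡⟨ cong (ℕ._* (suc (n ℕ.+ j) C suc (k ℕ.+ j))) (absorption (k ℕ.+ j) j) ⟨
    suc j ℕ.* (suc (k ℕ.+ j) C suc j) ℕ.* (suc (n ℕ.+ j) C suc (k ℕ.+ j))   ≡⟨ ℕₚ.*-assoc (suc j) (suc (k ℕ.+ j) C suc j) (suc (n ℕ.+ j) C suc (k ℕ.+ j)) ⟩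
    suc j ℕ.* (suc (k ℕ.+ j) C suc j ℕ.* (suc (n ℕ.+ j) C suc (k ℕ.+ j)))   ∎)
    where
    open ≡-Reasoning
    swap : ∀ a b c → a ℕ.* (b ℕ.* c) ≡ b ℕ.* (a ℕ.* c)
    swap = ℕ-solve-∀
    swap′ : ∀ a b c → a ℕ.* (b ℕ.* c) ≡ b ℕ.* a ℕ.* c
    swap′ = ℕ-solve-∀

  C-mono : ∀ {m n} k → m ℕ.≤ n → m C k ℕ.≤ n C k
  C-mono {m} {n} k m≤n = go (ℕₚ.≤⇒≤′ m≤n)
    where
    step : ∀ n k → n C k ℕ.≤ suc n C k
    step n zero    = ℕₚ.≤-refl
    step n (suc k) = subst (n C suc k ℕ.≤_) (sym (pascal n k)) (ℕₚ.m≤n+m (n C suc k) (n C k))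
    go : ∀ {n} → m ℕ.≤′ n → m C k ℕ.≤ n C k
    go ℕ.≤′-refl         = ℕₚ.≤-refl
    go (ℕ.≤′-step {n} p) = ℕₚ.≤-trans (go p) (step n k)

  nCk>0 : ∀ {n k} → k ℕ.≤ n → 0 ℕ.< n C k
  nCk>0 {n} {k} k≤n = ℕₚ.≤-trans (ℕₚ.≤-reflexive (sym (nCn≡1 k))) (C-mono k k≤n)

  -- Members of `choose k (downFrom n)` are decreasing, so this is the number of chosen elements
  -- below the one at position `i`.
  fromEnd : ∀ {k} → Fin k → ℕ
  fromEnd {suc k} zero    = k
  fromEnd {suc k} (suc i) = fromEnd i

  -- The factorial moments of the i-th largest element of a random k-subset of {0,…,n-1}.
  hockey-stick : ∀ k n j (i : Fin k) →
    ∑ (choose k (downFrom n)) (λ v → ι ((lookup v i ℕ.+ j) C j)) ≡ ι ((fromEnd i ℕ.+ j) C j ℕ.* ((n ℕ.+ j) C (k ℕ.+ j)))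
  hockey-stick (suc k) zero j i =
    sym (cong ι (trans (cong ((fromEnd i ℕ.+ j) C j ℕ.*_) (k>n⇒nCk≡0 {j} {suc k ℕ.+ j} (ℕ.s≤s (ℕₚ.m≤n+m j k))))
      (ℕₚ.*-zeroʳ ((fromEnd i ℕ.+ j) C j))))
  hockey-stick (suc k) (suc n) j zero = begin
    ∑ (choose (suc k) (downFrom (suc n))) (λ v → ι ((lookup v zero ℕ.+ j) C j))
      ≡⟨ ∑-choose k n (downFrom n) (λ v → ι ((lookup v zero ℕ.+ j) C j)) ⟩
    ∑ (choose k (downFrom n)) (λ _ → ι ((n ℕ.+ j) C j)) + ∑ (choose (suc k) (downFrom n)) (λ v → ι ((lookup v zero ℕ.+ j) C j))
      ≡⟨ cong₂ _+_ (∑-const (choose k (downFrom n)) (ι ((n ℕ.+ j) C j))) (hockey-stick (suc k) n j zero) ⟩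
    ι (length (choose k (downFrom n))) * ι ((n ℕ.+ j) C j) + ι ((k ℕ.+ j) C j ℕ.* c)
      ≡⟨ cong (λ l → ι l * ι ((n ℕ.+ j) C j) + ι ((k ℕ.+ j) C j ℕ.* c)) (trans (length-choose k (downFrom n)) (cong (_C k) (length-downFrom n))) ⟩
    ι (n C k) * ι ((n ℕ.+ j) C j) + ι ((k ℕ.+ j) C j ℕ.* c)
      ≡⟨ cong (_+ ι ((k ℕ.+ j) C j ℕ.* c)) (ι-* (n C k) ((n ℕ.+ j) C j)) ⟨
    ι (n C k ℕ.* ((n ℕ.+ j) C j)) + ι ((k ℕ.+ j) C j ℕ.* c)
      ≡⟨ ι-+ (n C k ℕ.* ((n ℕ.+ j) C j)) ((k ℕ.+ j) C j ℕ.* c) ⟨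
    ι (n C k ℕ.* ((n ℕ.+ j) C j) ℕ.+ (k ℕ.+ j) C j ℕ.* c)
      ≡⟨ cong (λ x → ι (x ℕ.+ (k ℕ.+ j) C j ℕ.* c)) (trans (ℕₚ.*-comm (n C k) ((n ℕ.+ j) C j)) (trinomial-revision n k j)) ⟩
    ι ((k ℕ.+ j) C j ℕ.* ((n ℕ.+ j) C (k ℕ.+ j)) ℕ.+ (k ℕ.+ j) C j ℕ.* c)
      ≡⟨ cong ι (ℕₚ.*-distribˡ-+ ((k ℕ.+ j) C j) ((n ℕ.+ j) C (k ℕ.+ j)) c) ⟨
    ι ((k ℕ.+ j) C j ℕ.* ((n ℕ.+ j) C (k ℕ.+ j) ℕ.+ c))
      ≡⟨ cong (λ x → ι ((k ℕ.+ j) C j ℕ.* x)) (pascal (n ℕ.+ j) (k ℕ.+ j)) ⟨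
    ι ((k ℕ.+ j) C j ℕ.* (suc (n ℕ.+ j) C suc (k ℕ.+ j))) ∎
    where
    open ≡-Reasoning
    c = (n ℕ.+ j) C suc (k ℕ.+ j)
  hockey-stick (suc k) (suc n) j (suc i) = begin
    ∑ (choose (suc k) (downFrom (suc n))) (λ v → ι ((lookup v (suc i) ℕ.+ j) C j))
      ≡⟨ ∑-choose k n (downFrom n) (λ v → ι ((lookup v (suc i) ℕ.+ j) C j)) ⟩
    ∑ (choose k (downFrom n)) (λ v → ι ((lookup v i ℕ.+ j) C j)) + ∑ (choose (suc k) (downFrom n)) (λ v → ι ((lookup v (suc i) ℕ.+ j) C j))
      ≡⟨ cong₂ _+_ (hockey-stick k n j i) (hockey-stick (suc k) n j (suc i)) ⟩
    ι (b ℕ.* ((n ℕ.+ j) C (k ℕ.+ j))) + ι (b ℕ.* ((n ℕ.+ j) C suc (k ℕ.+ j)))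
      ≡⟨ ι-+ (b ℕ.* ((n ℕ.+ j) C (k ℕ.+ j))) (b ℕ.* ((n ℕ.+ j) C suc (k ℕ.+ j))) ⟨
    ι (b ℕ.* ((n ℕ.+ j) C (k ℕ.+ j)) ℕ.+ b ℕ.* ((n ℕ.+ j) C suc (k ℕ.+ j)))
      ≡⟨ cong ι (ℕₚ.*-distribˡ-+ b ((n ℕ.+ j) C (k ℕ.+ j)) ((n ℕ.+ j) C suc (k ℕ.+ j))) ⟨
    ι (b ℕ.* ((n ℕ.+ j) C (k ℕ.+ j) ℕ.+ (n ℕ.+ j) C suc (k ℕ.+ j)))
      ≡⟨ cong (λ x → ι (b ℕ.* x)) (pascal (n ℕ.+ j) (k ℕ.+ j)) ⟨
    ι (b ℕ.* (suc (n ℕ.+ j) C suc (k ℕ.+ j))) ∎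
    where
    open ≡-Reasoning
    b = (fromEnd i ℕ.+ j) C j

  -- Cubic polynomials dual to the order statistics of a random 4-subset

  δ : ∀ {n} → Fin n → Fin n → ℚ
  δ i j = if does (i Fin.≟ j) then 1ℚ else 0ℚ

  -- The inverse of the Pascal matrix ((3 − i) + j choose j).
  pascalInverse : Fin 4 → Fin 4 → ℤ
  pascalInverse p j = lookup (lookup
    ( (ℤ.- ℤ.+ 1 ∷ᵥ ℤ.+ 3 ∷ᵥ ℤ.- ℤ.+ 3 ∷ᵥ ℤ.+ 1 ∷ᵥ []ᵥ)
    ∷ᵥ (ℤ.+ 4 ∷ᵥ ℤ.- ℤ.+ 11 ∷ᵥ ℤ.+ 10 ∷ᵥ ℤ.- ℤ.+ 3 ∷ᵥ []ᵥ)
    ∷ᵥ (ℤ.- ℤ.+ 6 ∷ᵥ ℤ.+ 14 ∷ᵥ ℤ.- ℤ.+ 11 ∷ᵥ ℤ.+ 3 ∷ᵥ []ᵥ)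
    ∷ᵥ (ℤ.+ 4 ∷ᵥ ℤ.- ℤ.+ 6 ∷ᵥ ℤ.+ 4 ∷ᵥ ℤ.- ℤ.+ 1 ∷ᵥ []ᵥ)
    ∷ᵥ []ᵥ) p) j

  coef : Fin 4 → Fin 4 → ℚ
  coef p j = pascalInverse p j / 1

  coef-inverse : ∀ p (i : Fin 4) → ∑ (allFin 4) (λ j → coef p j * ι ((fromEnd i ℕ.+ toℕ j) C toℕ j)) ≡ δ p i
  coef-inverse = from-yes (all? (λ p → all? (λ i → ∑ (allFin 4) (λ j → coef p j * ι ((fromEnd i ℕ.+ toℕ j) C toℕ j)) ≟ δ p i)))

  -- A uniform point is a random member of a random 4-subset, so each dual function has mean 1/4,
  -- whatever `p` is. The fraction under the sum is the mean of the normalised binomial `e j` over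
  -- the grid.
  coef-sum : ∀ p → ∑ (allFin 4) (λ j → coef p j * (ℤ.+ ((4 ℕ.+ toℕ j) C toℕ j) / suc (toℕ j))) ≡ ℤ.+ 1 / 4
  coef-sum = from-yes (all? (λ p → ∑ (allFin 4) (λ j → coef p j * (ℤ.+ ((4 ℕ.+ toℕ j) C toℕ j) / suc (toℕ j))) ≟ (ℤ.+ 1 / 4)))

  -- 346 is the largest of the four sums, attained at `p` = 2. The weights are the bounds for `e j`,
  -- which do not depend on `N`.
  coef-bound : ∀ p → ∑ (allFin 4) (λ j → ∣ coef p j ∣ * ι ((4 ℕ.+ toℕ j) C toℕ j)) ≤ ι 346
  coef-bound = from-yes (all? (λ p → ∑ (allFin 4) (λ j → ∣ coef p j ∣ * ι ((4 ℕ.+ toℕ j) C toℕ j)) ≤? ι 346))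

  module DualBasis (N : ℕ) (4≤N : 4 ℕ.≤ N) where

    β : ℚ
    β = ι (N C 4)

    β>0 : 0ℚ < β
    β>0 = ι>0 (nCk>0 4≤N)

    private
      scale : ∀ j → ∃ λ q → ι ((N ℕ.+ j) C (4 ℕ.+ j)) * q ≡ 1ℚ × 0ℚ < q
      scale j = reciprocal (ι>0 (nCk>0 (ℕₚ.+-monoˡ-≤ j 4≤N)))

      q : ℕ → ℚ
      q j = proj₁ (scale j) * β

      q≥0 : ∀ j → 0ℚ ≤ q j
      q≥0 j = *-nonNeg (<⇒≤ (proj₂ (proj₂ (scale j)))) (ι≥0 (N C 4))

      q-cancel : ∀ j → ι ((N ℕ.+ j) C (4 ℕ.+ j)) * q j ≡ β
      q-cancel j = trans (sym (*-assoc (ι ((N ℕ.+ j) C (4 ℕ.+ j))) (proj₁ (scale j)) β))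
        (trans (cong (_* β) (proj₁ (proj₂ (scale j)))) (*-identityˡ β))

      -- Scaled so that its mean at position `i` of a random 4-subset of the grid is C(`fromEnd i` +
      -- j, j), which no longer involves `N`. One constant matrix of coefficients then serves all
      -- grids.
      e : ℕ → ℕ → ℚ
      e j x = ι ((x ℕ.+ j) C j) * q j

      -- This is the value of `e j` at `N`. As `e j` increases, it bounds all values on the grid,
      -- and it is free of `N` by trinomial revision with `k` = 4.
      N-choose : ∀ j → ι ((N ℕ.+ j) C j) * q j ≡ ι ((4 ℕ.+ j) C j)
      N-choose j = begin
        ι ((N ℕ.+ j) C j) * (s * β)                                ≡⟨ lemma₁ (ι ((N ℕ.+ j) C j)) s β ⟩
        ι ((N ℕ.+ j) C j) * β * s                                  ≡⟨ cong (_* s) (ι-* ((N ℕ.+ j) C j) (N C 4)) ⟨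
        ι ((N ℕ.+ j) C j ℕ.* N C 4) * s                            ≡⟨ cong (λ x → ι x * s) (trinomial-revision N 4 j) ⟩
        ι ((4 ℕ.+ j) C j ℕ.* (N ℕ.+ j) C (4 ℕ.+ j)) * s            ≡⟨ cong (_* s) (ι-* ((4 ℕ.+ j) C j) ((N ℕ.+ j) C (4 ℕ.+ j))) ⟩
        ι ((4 ℕ.+ j) C j) * ι ((N ℕ.+ j) C (4 ℕ.+ j)) * s          ≡⟨ *-assoc (ι ((4 ℕ.+ j) C j)) (ι ((N ℕ.+ j) C (4 ℕ.+ j))) s ⟩
        ι ((4 ℕ.+ j) C j) * (ι ((N ℕ.+ j) C (4 ℕ.+ j)) * s)        ≡⟨ cong (ι ((4 ℕ.+ j) C j) *_) (proj₁ (proj₂ (scale j))) ⟩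
        ι ((4 ℕ.+ j) C j) * 1ℚ                                     ≡⟨ *-identityʳ (ι ((4 ℕ.+ j) C j)) ⟩
        ι ((4 ℕ.+ j) C j)                                          ∎
        where
        open ≡-Reasoning
        s = proj₁ (scale j)
        lemma₁ : ∀ a b c → a * (b * c) ≡ a * c * b
        lemma₁ = solve-∀ ℚ-ring

      e-bound : ∀ j {x} → x ℕ.< N → ∣ e j x ∣ ≤ ι ((4 ℕ.+ j) C j)
      e-bound j {x} x<N = subst₂ _≤_ (sym (0≤p⇒∣p∣≡p (*-nonNeg (ι≥0 ((x ℕ.+ j) C j)) (q≥0 j)))) (N-choose j)
        (*-monoʳ (q≥0 j) (ι-mono (C-mono j (ℕₚ.+-monoˡ-≤ j (ℕₚ.<⇒≤ x<N)))))

      e-choose : ∀ j (i : Fin 4) → ∑ (choose 4 (downFrom N)) (λ v → e j (lookup v i)) ≡ ι ((fromEnd i ℕ.+ j) C j) * β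
      e-choose j i = begin
        ∑ (choose 4 (downFrom N)) (λ v → e j (lookup v i))                ≡⟨ ∑-*ʳ (choose 4 (downFrom N)) (q j) (λ v → ι ((lookup v i ℕ.+ j) C j)) ⟩
        ∑ (choose 4 (downFrom N)) (λ v → ι ((lookup v i ℕ.+ j) C j)) * q j ≡⟨ cong (_* q j) (hockey-stick 4 N j i) ⟩
        ι (b ℕ.* (N ℕ.+ j) C (4 ℕ.+ j)) * q j                              ≡⟨ cong (_* q j) (ι-* b ((N ℕ.+ j) C (4 ℕ.+ j))) ⟩
        ι b * ι ((N ℕ.+ j) C (4 ℕ.+ j)) * q j                              ≡⟨ *-assoc (ι b) (ι ((N ℕ.+ j) C (4 ℕ.+ j))) (q j) ⟩
        ι b * (ι ((N ℕ.+ j) C (4 ℕ.+ j)) * q j)                            ≡⟨ cong (ι b *_) (q-cancel j) ⟩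
        ι b * β                                                            ∎
        where
        open ≡-Reasoning
        b = (fromEnd i ℕ.+ j) C j

      e-sum : ∀ j → ∑ (downFrom N) (e j) ≡ (ℤ.+ ((4 ℕ.+ j) C j) / suc j) * ι N
      e-sum j = *-cancelʳ-≡ (begin
        ∑ (downFrom N) (e j) * ι (suc j)                         ≡⟨ cong (_* ι (suc j)) (∑-*ʳ (downFrom N) (q j) (λ x → ι ((x ℕ.+ j) C j))) ⟩
        ∑ (downFrom N) (λ x → ι ((x ℕ.+ j) C j)) * q j * ι (suc j) ≡⟨ cong (λ x → x * q j * ι (suc j)) ∑C ⟩
        ι ((N ℕ.+ j) C suc j) * q j * ι (suc j)                  ≡⟨ lemma (ι ((N ℕ.+ j) C suc j)) (q j) (ι (suc j)) ⟩
        ι (suc j) * ι ((N ℕ.+ j) C suc j) * q j                  ≡⟨ cong (_* q j) (ι-* (suc j) ((N ℕ.+ j) C suc j)) ⟨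
        ι (suc j ℕ.* (N ℕ.+ j) C suc j) * q j                    ≡⟨ cong (λ x → ι x * q j) abs ⟩
        ι (N ℕ.* (N ℕ.+ j) C j) * q j                            ≡⟨ cong (_* q j) (ι-* N ((N ℕ.+ j) C j)) ⟩
        ι N * ι ((N ℕ.+ j) C j) * q j                            ≡⟨ *-assoc (ι N) (ι ((N ℕ.+ j) C j)) (q j) ⟩
        ι N * (ι ((N ℕ.+ j) C j) * q j)                          ≡⟨ cong (ι N *_) (N-choose j) ⟩
        ι N * ι ((4 ℕ.+ j) C j)                                  ≡⟨ cong (ι N *_) (/-*-cancel (ℤ.+ ((4 ℕ.+ j) C j)) j) ⟨
        ι N * (r * ι (suc j))                                    ≡⟨ lemma₂ (ι N) r (ι (suc j)) ⟩
        r * ι N * ι (suc j)                                      ∎)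
        where
        open ≡-Reasoning
        r = ℤ.+ ((4 ℕ.+ j) C j) / suc j
        *-cancelʳ-≡ : ∀ {a b} → a * ι (suc j) ≡ b * ι (suc j) → a ≡ b
        *-cancelʳ-≡ eq = ≤-antisym (*-cancelʳ-≤ (ι-suc>0 j) (≤-reflexive eq)) (*-cancelʳ-≤ (ι-suc>0 j) (≤-reflexive (sym eq)))
        lemma : ∀ a b c → a * b * c ≡ c * a * b
        lemma = solve-∀ ℚ-ring
        lemma₂ : ∀ a b c → a * (b * c) ≡ b * a * c
        lemma₂ = solve-∀ ℚ-ring
        ∑C : ∑ (downFrom N) (λ x → ι ((x ℕ.+ j) C j)) ≡ ι ((N ℕ.+ j) C suc j)
        ∑C = go N
          where
          go : ∀ n → ∑ (downFrom n) (λ x → ι ((x ℕ.+ j) C j)) ≡ ι ((n ℕ.+ j) C suc j)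
          go zero    = sym (cong ι (k>n⇒nCk≡0 {j} {suc j} ℕₚ.≤-refl))
          go (suc n) = trans (cong (ι ((n ℕ.+ j) C j) +_) (go n))
            (trans (sym (ι-+ ((n ℕ.+ j) C j) ((n ℕ.+ j) C suc j))) (cong ι (sym (pascal (n ℕ.+ j) j))))
        abs : suc j ℕ.* (N ℕ.+ j) C suc j ≡ N ℕ.* (N ℕ.+ j) C j
        abs = sym (begin
          N ℕ.* (N ℕ.+ j) C j                ≡⟨ ℕₚ.*-comm N ((N ℕ.+ j) C j) ⟩
          (N ℕ.+ j) C j ℕ.* N                ≡⟨ cong ((N ℕ.+ j) C j ℕ.*_) (nC1≡n N) ⟨
          (N ℕ.+ j) C j ℕ.* N C 1            ≡⟨ trinomial-revision N 1 j ⟩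
          suc j C j ℕ.* (N ℕ.+ j) C suc j    ≡⟨ cong (ℕ._* (N ℕ.+ j) C suc j) sucjCj ⟩
          suc j ℕ.* (N ℕ.+ j) C suc j        ∎)
          where
          sucjCj : suc j C j ≡ suc j
          sucjCj = trans (nCk≡nC[n∸k] (ℕₚ.n≤1+n j)) (trans (cong (suc j C_) (ℕₚ.m+n∸n≡m 1 j)) (nC1≡n (suc j)))

    f : Fin 4 → ℕ → ℚ
    f p x = ∑ (allFin 4) (λ j → coef p j * e (toℕ j) x)

    f-bound : ∀ p {x} → x ℕ.< N → ∣ f p x ∣ ≤ ι 346
    f-bound p {x} x<N = ≤-trans (∑-∣∣ (allFin 4) (λ j → coef p j * e (toℕ j) x))
      (≤-trans (∑-mono (allFin 4) (λ j _ → ∣*∣≤ {coef p j} {e (toℕ j) x} ≤-refl (e-bound (toℕ j) x<N))) (coef-bound p))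

    f-dual : ∀ p i → ∑ (choose 4 (downFrom N)) (λ v → f p (lookup v i)) ≡ δ p i * β
    f-dual p i = begin
      ∑ (choose 4 (downFrom N)) (λ v → f p (lookup v i))
        ≡⟨ ∑-swap (choose 4 (downFrom N)) (allFin 4) (λ v j → coef p j * e (toℕ j) (lookup v i)) ⟩
      ∑ (allFin 4) (λ j → ∑ (choose 4 (downFrom N)) (λ v → coef p j * e (toℕ j) (lookup v i)))
        ≡⟨ ∑-cong (allFin 4) (λ j → trans (∑-*ˡ (choose 4 (downFrom N)) (coef p j) (λ v → e (toℕ j) (lookup v i)))
             (trans (cong (coef p j *_) (e-choose (toℕ j) i)) (sym (*-assoc (coef p j) (ι ((fromEnd i ℕ.+ toℕ j) C toℕ j)) β)))) ⟩
      ∑ (allFin 4) (λ j → coef p j * ι ((fromEnd i ℕ.+ toℕ j) C toℕ j) * β)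
        ≡⟨ ∑-*ʳ (allFin 4) β (λ j → coef p j * ι ((fromEnd i ℕ.+ toℕ j) C toℕ j)) ⟩
      ∑ (allFin 4) (λ j → coef p j * ι ((fromEnd i ℕ.+ toℕ j) C toℕ j)) * β
        ≡⟨ cong (_* β) (coef-inverse p i) ⟩
      δ p i * β ∎
      where open ≡-Reasoning

    f-sum : ∀ p → ∑ (downFrom N) (f p) ≡ (ℤ.+ 1 / 4) * ι N
    f-sum p = begin
      ∑ (downFrom N) (f p)
        ≡⟨ ∑-swap (downFrom N) (allFin 4) (λ x j → coef p j * e (toℕ j) x) ⟩
      ∑ (allFin 4) (λ j → ∑ (downFrom N) (λ x → coef p j * e (toℕ j) x))
        ≡⟨ ∑-cong (allFin 4) (λ j → trans (∑-*ˡ (downFrom N) (coef p j) (e (toℕ j)))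
             (trans (cong (coef p j *_) (e-sum (toℕ j))) (sym (*-assoc (coef p j) (ℤ.+ ((4 ℕ.+ toℕ j) C toℕ j) / suc (toℕ j)) (ι N))))) ⟩
      ∑ (allFin 4) (λ j → coef p j * (ℤ.+ ((4 ℕ.+ toℕ j) C toℕ j) / suc (toℕ j)) * ι N)
        ≡⟨ ∑-*ʳ (allFin 4) (ι N) (λ j → coef p j * (ℤ.+ ((4 ℕ.+ toℕ j) C toℕ j) / suc (toℕ j))) ⟩
      ∑ (allFin 4) (λ j → coef p j * (ℤ.+ ((4 ℕ.+ toℕ j) C toℕ j) / suc (toℕ j))) * ι N
        ≡⟨ cong (_* ι N) (coef-sum p) ⟩
      (ℤ.+ 1 / 4) * ι N ∎
      where open ≡-Reasoning

  -- The nonlinear part of ∏ (1 + hᵢ), and Banach iteration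

  ∏[1+_] : ∀ {k} → Vec ℚ k → ℚ
  ∏[1+ []ᵥ ]     = 1ℚ
  ∏[1+ h ∷ᵥ v ]  = (1ℚ + h) * ∏[1+ v ]

  sumᵥ : ∀ {k} → Vec ℚ k → ℚ
  sumᵥ []ᵥ      = 0ℚ
  sumᵥ (h ∷ᵥ v) = h + sumᵥ v

  -- Given by recursion and not as a difference: each new term is a product of two factors of first
  -- order, and the second-order Lipschitz bound is read off term by term.
  remainder : ∀ {k} → Vec ℚ k → ℚ
  remainder []ᵥ      = 0ℚ
  remainder (h ∷ᵥ v) = remainder v + h * (∏[1+ v ] - 1ℚ)

  ∏-expand : ∀ {k} (v : Vec ℚ k) → ∏[1+ v ] ≡ 1ℚ + sumᵥ v + remainder v
  ∏-expand []ᵥ      = refl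
  ∏-expand (h ∷ᵥ v) = trans (split h ∏[1+ v ]) (trans (cong (λ x → x + h * (∏[1+ v ] - 1ℚ) + h) (∏-expand v))
    (join h (sumᵥ v) (remainder v) (h * (∏[1+ v ] - 1ℚ))))
    where
    split : ∀ h p → (1ℚ + h) * p ≡ p + h * (p - 1ℚ) + h
    split = solve-∀ ℚ-ring
    join : ∀ h s r x → 1ℚ + s + r + x + h ≡ 1ℚ + (h + s) + (r + x)
    join = solve-∀ ℚ-ring

  module _ {η : ℚ} (0≤η : 0ℚ ≤ η) (η≤1 : η ≤ 1ℚ) where

    private
      -- For entries of size at most η ≤ 1, `a k` times η bounds the product minus 1, `b k` is a
      -- Lipschitz constant of the product, and `c k` times η one of the remainder. In closed form
      -- they are 2^k - 1, k 2^(k-1) and k (2^(k-1) - 1), so `c 4` is 28.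
      a b c : ℕ → ℚ
      a zero    = 0ℚ
      a (suc k) = a k + a k + 1ℚ
      b zero    = 0ℚ
      b (suc k) = b k + a k + 1ℚ + b k
      c zero    = 0ℚ
      c (suc k) = c k + a k + b k

      a≥0 : ∀ k → 0ℚ ≤ a k
      a≥0 zero    = ≤-refl
      a≥0 (suc k) = +-nonNeg (+-nonNeg (a≥0 k) (a≥0 k)) (ι≥0 1)

      ∏-bound : ∀ {k} (v : Vec ℚ k) → (∀ i → ∣ lookup v i ∣ ≤ η) → ∣ ∏[1+ v ] - 1ℚ ∣ ≤ a k * η
      ∏-bound []ᵥ          v≤ = ≤-reflexive (sym (*-zeroˡ η))
      ∏-bound {suc k} (h ∷ᵥ v) v≤ = subst₂ _≤_ (cong ∣_∣ (sym (split h ∏[1+ v ]))) (join (a k) η)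
        (∣+∣≤ {p - 1ℚ + h * (p - 1ℚ)} {h} (∣+∣≤ {p - 1ℚ} {h * (p - 1ℚ)} ih (∣*∣≤ {h} {p - 1ℚ} (≤-trans (v≤ zero) η≤1) ih)) (v≤ zero))
        where
        p = ∏[1+ v ]
        ih = ∏-bound v (λ i → v≤ (suc i))
        split : ∀ h p → (1ℚ + h) * p - 1ℚ ≡ p - 1ℚ + h * (p - 1ℚ) + h
        split = solve-∀ ℚ-ring
        join : ∀ a e → a * e + 1ℚ * (a * e) + e ≡ (a + a + 1ℚ) * e
        join = solve-∀ ℚ-ring

    module _ {d : ℚ} where

      private
        ∏-lipschitz : ∀ {k} (v w : Vec ℚ k) → (∀ i → ∣ lookup v i ∣ ≤ η) → (∀ i → ∣ lookup w i ∣ ≤ η) →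
                      (∀ i → ∣ lookup v i - lookup w i ∣ ≤ d) → ∣ ∏[1+ v ] - ∏[1+ w ] ∣ ≤ b k * d
        ∏-lipschitz []ᵥ []ᵥ _ _ _ = ≤-reflexive (sym (*-zeroˡ d))
        ∏-lipschitz {suc k} (g ∷ᵥ v) (h ∷ᵥ w) v≤ w≤ vw≤ = subst₂ _≤_ (cong ∣_∣ (sym (split g h p q))) (join (a k) (b k) d)
          (∣+∣≤ {p - q + (g - h) * (p - 1ℚ) + (g - h)} {h * (p - q)}
            (∣+∣≤ {p - q + (g - h) * (p - 1ℚ)} {g - h}
              (∣+∣≤ {p - q} {(g - h) * (p - 1ℚ)} ih (∣*∣≤ {g - h} {p - 1ℚ} (vw≤ zero) p≤))
              (vw≤ zero))
            (∣*∣≤ {h} {p - q} (≤-trans (w≤ zero) η≤1) ih))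
          where
          p = ∏[1+ v ]
          q = ∏[1+ w ]
          ih = ∏-lipschitz v w (λ i → v≤ (suc i)) (λ i → w≤ (suc i)) (λ i → vw≤ (suc i))
          p≤ : ∣ p - 1ℚ ∣ ≤ a k
          p≤ = ≤-trans (∏-bound v (λ i → v≤ (suc i))) (subst (a k * η ≤_) (*-identityʳ (a k)) (*-monoˡ (a≥0 k) η≤1))
          split : ∀ g h p q → (1ℚ + g) * p - (1ℚ + h) * q ≡ p - q + (g - h) * (p - 1ℚ) + (g - h) + h * (p - q)
          split = solve-∀ ℚ-ring
          join : ∀ a b d → b * d + d * a + d + 1ℚ * (b * d) ≡ (b + a + 1ℚ + b) * d
          join = solve-∀ ℚ-ring

        remainder-lipschitz′ : ∀ {k} (v w : Vec ℚ k) → (∀ i → ∣ lookup v i ∣ ≤ η) → (∀ i → ∣ lookup w i ∣ ≤ η) →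
                      (∀ i → ∣ lookup v i - lookup w i ∣ ≤ d) → ∣ remainder v - remainder w ∣ ≤ c k * (η * d)
        remainder-lipschitz′ []ᵥ []ᵥ _ _ _ = ≤-reflexive (sym (*-zeroˡ (η * d)))
        remainder-lipschitz′ {suc k} (g ∷ᵥ v) (h ∷ᵥ w) v≤ w≤ vw≤ =
          subst₂ _≤_ (cong ∣_∣ (sym (split (remainder v) (remainder w) g h p q))) (join (a k) (b k) (c k) η d)
          (∣+∣≤ {remainder v - remainder w + (g - h) * (p - 1ℚ)} {h * (p - q)}
            (∣+∣≤ {remainder v - remainder w} {(g - h) * (p - 1ℚ)}
              (remainder-lipschitz′ v w (λ i → v≤ (suc i)) (λ i → w≤ (suc i)) (λ i → vw≤ (suc i)))
              (∣*∣≤ {g - h} {p - 1ℚ} (vw≤ zero) (∏-bound v (λ i → v≤ (suc i)))))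
            (∣*∣≤ {h} {p - q} (w≤ zero) (∏-lipschitz v w (λ i → v≤ (suc i)) (λ i → w≤ (suc i)) (λ i → vw≤ (suc i)))))
          where
          p = ∏[1+ v ]
          q = ∏[1+ w ]
          split : ∀ r s g h p q → (r + g * (p - 1ℚ)) - (s + h * (q - 1ℚ)) ≡ r - s + (g - h) * (p - 1ℚ) + h * (p - q)
          split = solve-∀ ℚ-ring
          join : ∀ a b c e d → c * (e * d) + d * (a * e) + e * (b * d) ≡ (c + a + b) * (e * d)
          join = solve-∀ ℚ-ring

      remainder-lipschitz : ∀ (v w : Vec ℚ 4) → (∀ i → ∣ lookup v i ∣ ≤ η) → (∀ i → ∣ lookup w i ∣ ≤ η) →
                            (∀ i → ∣ lookup v i - lookup w i ∣ ≤ d) → ∣ remainder v - remainder w ∣ ≤ ι 28 * (η * d)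
      remainder-lipschitz = remainder-lipschitz′

  -- `R` vanishes at 0 and halves distances in the ball of radius `s`, so it is at most `s`/2 there;
  -- with a target of size at most `s`/2 the iteration stays in the ball. Since ℚ is not complete,
  -- the outcome is a solution up to any prescribed error and not a fixed point.
  module _ {r : ℕ} (R : (Fin r → ℚ) → Fin r → ℚ) (target : Fin r → ℚ) {s : ℚ}
           (R-zero : ∀ i → R (λ _ → 0ℚ) i ≡ 0ℚ)
           (target≤ : ∀ i → ∣ target i ∣ ≤ ½ * s)
           (R-lipschitz : ∀ y z d → (∀ i → ∣ y i ∣ ≤ s) → (∀ i → ∣ z i ∣ ≤ s) → (∀ i → ∣ y i - z i ∣ ≤ d) →
                          ∀ i → ∣ R y i - R z i ∣ ≤ ½ * d)
           (0<s : 0ℚ < s) where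

    private
      -- The residual bound `d` halves at each step, but only (k + 1) d ≤ s is recorded: (k + 2)/2 ≤
      -- k + 1 preserves it, it needs no powers of 2, and it makes `d` as small as desired.
      Approximation : ℕ → Set
      Approximation k = ∃ λ z → ∃ λ d → (∀ i → ∣ z i ∣ ≤ s) × (∀ i → ∣ z i + R z i - target i ∣ ≤ d) × 0ℚ ≤ d × ι (suc k) * d ≤ s

      zero≤ : ∣ 0ℚ ∣ ≤ s
      zero≤ = <⇒≤ 0<s

      halves : ∀ x → ½ * x + ½ * x ≡ x
      halves x = trans (sym (*-distribʳ-+ x ½ ½)) (*-identityˡ x)

      ½≥0 : 0ℚ ≤ ½
      ½≥0 = nonNegative⁻¹ ½

      R≤ : ∀ z → (∀ i → ∣ z i ∣ ≤ s) → ∀ i → ∣ R z i ∣ ≤ ½ * s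
      R≤ z z≤ i = subst (λ x → ∣ x ∣ ≤ ½ * s) (trans (cong (λ x → R z i - x) (R-zero i)) (minus-zero (R z i)))
        (R-lipschitz z (λ _ → 0ℚ) s z≤ (λ _ → zero≤) (λ j → subst (λ x → ∣ x ∣ ≤ s) (sym (minus-zero (z j))) (z≤ j)) i)
        where
        minus-zero : ∀ x → x - 0ℚ ≡ x
        minus-zero = solve-∀ ℚ-ring

      step : ∀ k → Approximation k → Approximation (suc k)
      step k (z , d , z≤ , res≤ , 0≤d , kd≤s) = z′ , ½ * d , z′≤ , res′≤ , *-nonNeg ½≥0 0≤d , kd′≤s
        where
        z′ = λ i → target i - R z i
        z′≤ : ∀ i → ∣ z′ i ∣ ≤ s
        z′≤ i = subst (∣ z′ i ∣ ≤_) (halves s)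
          (∣+∣≤ {target i} { - R z i} (target≤ i) (subst (_≤ ½ * s) (sym (∣-p∣≡∣p∣ (R z i))) (R≤ z z≤ i)))
        moved : ∀ i → ∣ z′ i - z i ∣ ≤ d
        moved i = subst (_≤ d) (trans (sym (∣-p∣≡∣p∣ (z i + R z i - target i))) (cong ∣_∣ (flip (z i) (R z i) (target i)))) (res≤ i)
          where
          flip : ∀ a b c → - (a + b - c) ≡ c - b - a
          flip = solve-∀ ℚ-ring
        -- The new residual is `R z′ − R z`, at most half the displacement, and the displacement is
        -- minus the old residual.
        res′≤ : ∀ i → ∣ z′ i + R z′ i - target i ∣ ≤ ½ * d
        res′≤ i = subst (λ x → ∣ x ∣ ≤ ½ * d) (cancel (target i) (R z′ i) (R z i)) (R-lipschitz z′ z d z′≤ z≤ moved i)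
          where
          cancel : ∀ t a b → a - b ≡ t - b + a - t
          cancel = solve-∀ ℚ-ring
        kd′≤s : ι (suc (suc k)) * (½ * d) ≤ s
        kd′≤s = ≤-trans (by-slack
          (trans (cong₂ (λ x y → x * d - y * (½ * d)) (ι-+ 1 k) (ι-+ 2 k)) (slack (ι k) d))
          (*-nonNeg ½≥0 (*-nonNeg (ι≥0 k) 0≤d))) kd≤s
          where
          slack : ∀ n d → (ι 1 + n) * d - (ι 2 + n) * (½ * d) ≡ ½ * (n * d)
          slack = solve-∀ ℚ-ring

      start : Approximation 0
      start = (λ _ → 0ℚ) , s , (λ _ → zero≤) , res≤ , <⇒≤ 0<s , ≤-reflexive (*-identityˡ s)
        where
        res≤ : ∀ i → ∣ 0ℚ + R (λ _ → 0ℚ) i - target i ∣ ≤ s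
        res≤ i = subst (λ x → ∣ 0ℚ + x - target i ∣ ≤ s) (sym (R-zero i))
          (subst (_≤ s) (sym (trans (cong ∣_∣ (+-identityˡ (- target i))) (∣-p∣≡∣p∣ (target i))))
            (≤-trans (target≤ i) (by-slack (slack s) (*-nonNeg ½≥0 (<⇒≤ 0<s)))))
          where
          slack : ∀ s → s - ½ * s ≡ ½ * s
          slack = solve-∀ ℚ-ring

      approximation : ∀ k → Approximation k
      approximation zero    = start
      approximation (suc k) = step k (approximation k)

    -- Banach iteration z ↦ target − R z.
    approximate-solution : ∀ ε → 0ℚ < ε → ∃ λ z → (∀ i → ∣ z i ∣ ≤ s) × (∀ i → ∣ z i + R z i - target i ∣ ≤ ε)
    approximate-solution ε 0<ε with reciprocal 0<ε
    ... | 1/ε , ε/ε≡1 , 0<1/ε with archimedean (s * 1/ε)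
    ... | k , s/ε≤k with approximation k
    ... | z , d , z≤ , res≤ , 0≤d , kd≤s = z , z≤ , λ i → ≤-trans (res≤ i) d≤ε
      where
      s≤kε : s ≤ ε * ι (suc k)
      s≤kε = ≤-trans (≤-reflexive (trans (sym (*-identityʳ s)) (trans (cong (s *_) (sym ε/ε≡1)) (rearrange s ε 1/ε))))
        (*-monoˡ (<⇒≤ 0<ε) (≤-trans s/ε≤k (ι-mono (ℕₚ.n≤1+n k))))
        where
        rearrange : ∀ a b c → a * (b * c) ≡ b * (a * c)
        rearrange = solve-∀ ℚ-ring
      d≤ε : d ≤ ε
      d≤ε = *-cancelʳ-≤ (ι-suc>0 k) (≤-trans (≤-reflexive (*-comm d (ι (suc k)))) (≤-trans kd≤s s≤kε))

  -- Permutations sorting a list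

  ⟦_⟧ : Bool → ℚ
  ⟦ b ⟧ = if b then 1ℚ else 0ℚ

  ⟦⟧≥0 : ∀ b → 0ℚ ≤ ⟦ b ⟧
  ⟦⟧≥0 true  = ι≥0 1
  ⟦⟧≥0 false = ≤-refl

  ⟦⟧≤1 : ∀ b → ⟦ b ⟧ ≤ 1ℚ
  ⟦⟧≤1 true  = ≤-refl
  ⟦⟧≤1 false = ι≥0 1

  <ᵇ-true : ∀ {m n} → m ℕ.< n → (m <ᵇ n) ≡ true
  <ᵇ-true {m} {n} m<n with m <ᵇ n | ℕₚ.<⇒<ᵇ m<n
  ... | true | _ = refl

  <ᵇ-false : ∀ {m n} → n ℕ.≤ m → (m <ᵇ n) ≡ false
  <ᵇ-false {m} {n} n≤m with m <ᵇ n in eq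
  ... | false = refl
  ... | true  = ⊥-elim (ℕₚ.<⇒≱ (ℕₚ.<ᵇ⇒< m n (subst T (sym eq) _)) n≤m)

  <ᵇ-true⁻ : ∀ {m n} → (m <ᵇ n) ≡ true → m ℕ.< n
  <ᵇ-true⁻ {m} {n} eq = ℕₚ.<ᵇ⇒< m n (subst T (sym eq) _)

  ⇔ᵇ-true : ∀ {a b} → a ≡ b → (a ⇔ᵇ b) ≡ true
  ⇔ᵇ-true {true}  refl = refl
  ⇔ᵇ-true {false} refl = refl

  ⇔ᵇ-true⁻ : ∀ a b → (a ⇔ᵇ b) ≡ true → a ≡ b
  ⇔ᵇ-true⁻ true  true  _ = refl
  ⇔ᵇ-true⁻ false false _ = refl

  all-tabulate⁺ : ∀ {n} {I : Set} (p : I → Bool) (f : Fin n → I) → (∀ i → p (f i) ≡ true) → all p (tabulate f) ≡ true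
  all-tabulate⁺ {zero}  p f ok = refl
  all-tabulate⁺ {suc n} p f ok = cong₂ _∧_ (ok zero) (all-tabulate⁺ p (f ∘ suc) (λ i → ok (suc i)))

  all-tabulate⁻ : ∀ {n} {I : Set} (p : I → Bool) (f : Fin n → I) → all p (tabulate f) ≡ true → ∀ i → p (f i) ≡ true
  all-tabulate⁻ {suc n} p f eq i with p (f zero) in eq₀
  all-tabulate⁻ {suc n} p f eq zero    | true = eq₀
  all-tabulate⁻ {suc n} p f eq (suc i) | true = all-tabulate⁻ p (f ∘ suc) eq i

  allPairs⁺ : ∀ {k} (p : Fin k → Fin k → Bool) → (∀ i j → p i j ≡ true) → all (λ i → all (p i) (allFin k)) (allFin k) ≡ true
  allPairs⁺ p ok = all-tabulate⁺ _ (λ i → i) (λ i → all-tabulate⁺ (p i) (λ j → j) (ok i))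

  allPairs⁻ : ∀ {k} (p : Fin k → Fin k → Bool) → all (λ i → all (p i) (allFin k)) (allFin k) ≡ true → ∀ i j → p i j ≡ true
  allPairs⁻ p eq i = all-tabulate⁻ (p i) (λ j → j) (all-tabulate⁻ _ (λ i → i) eq i)

  perm-injective : ∀ {n} (σ : Permutation′ n) {i j} → σ ⟨$⟩ʳ i ≡ σ ⟨$⟩ʳ j → i ≡ j
  perm-injective σ eq = trans (sym (inverseˡ σ)) (trans (cong (σ ⟨$⟩ˡ_) eq) (inverseˡ σ))

  injective⇒permutation : ∀ {n} (f : Fin n → Fin n) → (∀ {i j} → f i ≡ f j → i ≡ j) →
                          ∃ λ (π : Permutation′ n) → ∀ i → π ⟨$⟩ʳ i ≡ f i
  injective⇒permutation {n} f f-inj =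
    permutation f (λ y → proj₁ (surj f f-inj y)) (λ y → proj₂ (surj f f-inj y)) (λ x → f-inj (proj₂ (surj f f-inj (f x)))) , λ _ → refl
    where
    surj : ∀ {n} (f : Fin n → Fin n) → (∀ {i j} → f i ≡ f j → i ≡ j) → ∀ y → ∃ λ i → f i ≡ y
    surj {suc n} f f-inj y with any? (λ i → f i Fin.≟ y)
    ... | yes hit = hit
    ... | no  miss = ⊥-elim (ℕₚ.1+n≰n (injective⇒≤ {f = λ i → punchOut (y≢ i)} (λ {i} {j} eq → f-inj (punchOut-injective (y≢ i) (y≢ j) eq))))
      where
      y≢ : ∀ i → y ≢ f i
      y≢ i y≡ = miss (i , sym y≡)

  private
    count# : {I : Set} → (I → Bool) → List I → ℕ
    count# p []       = 0
    count# p (x ∷ xs) = (if p x then 1 else 0) ℕ.+ count# p xs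

    count#-mono : {I : Set} {p q : I → Bool} → (∀ x → p x ≡ true → q x ≡ true) → ∀ xs → count# p xs ℕ.≤ count# q xs
    count#-mono imp []       = ℕ.z≤n
    count#-mono {p = p} {q} imp (x ∷ xs) with p x in px
    ... | false = ℕₚ.≤-trans (count#-mono imp xs) (ℕₚ.m≤n+m _ (if q x then 1 else 0))
    ... | true rewrite imp x px = ℕ.s≤s (count#-mono imp xs)

    count#-strict : ∀ {n} {I : Set} {p q : I → Bool} → (∀ x → p x ≡ true → q x ≡ true) → (f : Fin n → I) →
                    ∀ i → p (f i) ≡ false → q (f i) ≡ true → count# p (tabulate f) ℕ.< count# q (tabulate f)
    count#-strict imp f zero px qx rewrite px | qx = ℕ.s≤s (count#-mono imp (tabulate (f ∘ suc)))
    count#-strict {p = p} {q} imp f (suc i) px qx with p (f zero) in p₀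
    ... | false = ℕₚ.<-≤-trans (count#-strict imp (f ∘ suc) i px qx) (ℕₚ.m≤n+m _ (if q (f zero) then 1 else 0))
    ... | true rewrite imp (f zero) p₀ = ℕ.s≤s (count#-strict imp (f ∘ suc) i px qx)

    count#-true : ∀ {n} {I : Set} (f : Fin n → I) → count# (λ _ → true) (tabulate f) ≡ n
    count#-true {zero}  f = refl
    count#-true {suc n} f = cong suc (count#-true (f ∘ suc))

  -- The value of `i` is the number of larger keys. Distinct keys make this injective, and an
  -- injective self-map of a finite set is a permutation.
  ranking : ∀ {n} (key : Fin n → ℕ) → (∀ {i j} → key i ≡ key j → i ≡ j) →
            ∃ λ (π : Permutation′ n) → ∀ i j → key j ℕ.< key i → toℕ (π ⟨$⟩ʳ i) ℕ.< toℕ (π ⟨$⟩ʳ j)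
  ranking {n} key key-inj = π , λ i j lt → subst₂ ℕ._<_ (toℕπ i) (toℕπ j) (rank-anti i j lt)
    where
    above : Fin n → Fin n → Bool
    above i j = key i <ᵇ key j

    rank : Fin n → ℕ
    rank i = count# (above i) (allFin n)

    rank-anti : ∀ i j → key j ℕ.< key i → rank i ℕ.< rank j
    rank-anti i j lt = count#-strict {p = above i} {q = above j} (λ x i<x → <ᵇ-true (ℕₚ.<-trans lt (<ᵇ-true⁻ {key i} {key x} i<x)))
      (λ x → x) i (<ᵇ-false {key i} ℕₚ.≤-refl) (<ᵇ-true lt)

    rank<n : ∀ i → rank i ℕ.< n
    rank<n i = subst (rank i ℕ.<_) (count#-true {n} (λ x → x))
      (count#-strict {p = above i} {q = λ _ → true} (λ _ _ → refl) (λ x → x) i (<ᵇ-false {key i} ℕₚ.≤-refl) refl)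

    f : Fin n → Fin n
    f i = fromℕ< (rank<n i)

    rank≡ : ∀ i j → f i ≡ f j → rank i ≡ rank j
    rank≡ i j eq = trans (sym (toℕ-fromℕ< (rank<n i))) (trans (cong toℕ eq) (toℕ-fromℕ< (rank<n j)))

    f-inj : ∀ {i j} → f i ≡ f j → i ≡ j
    f-inj {i} {j} eq with ℕₚ.<-cmp (key i) (key j)
    ... | tri< lt _ _ = ⊥-elim (ℕₚ.<⇒≢ (rank-anti j i lt) (sym (rank≡ i j eq)))
    ... | tri≈ _ e _  = key-inj e
    ... | tri> _ _ gt = ⊥-elim (ℕₚ.<⇒≢ (rank-anti i j gt) (rank≡ i j eq))

    π = proj₁ (injective⇒permutation f f-inj)

    toℕπ : ∀ i → rank i ≡ toℕ (π ⟨$⟩ʳ i)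
    toℕπ i = sym (trans (cong toℕ (proj₂ (injective⇒permutation f f-inj) i)) (toℕ-fromℕ< (rank<n i)))

  -- Values reverse the labels; since `points` also lists the columns from last to first, the grid
  -- is merely rotated by a half turn. Nothing is asked of positions with equal labels: tuples
  -- containing such positions go into the error term `ties`.
  Sorts : (P : List ℕ) → Permutation′ (length P) → Set
  Sorts P π = ∀ s t → List.lookup P t ℕ.< List.lookup P s → toℕ (π ⟨$⟩ʳ s) ℕ.< toℕ (π ⟨$⟩ʳ t)

  sortingPermutation : (P : List ℕ) → ∃ (Sorts P)
  sortingPermutation P = proj₁ ranked , λ s t lt → proj₂ ranked s t (key-mono s t lt)
    where
    n = length P
    -- Lexicographic: positions are below `n`, so the label decides and the position breaks ties.
    key : Fin n → ℕ
    key s = List.lookup P s ℕ.* n ℕ.+ toℕ s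

    key-mono : ∀ s t → List.lookup P t ℕ.< List.lookup P s → key t ℕ.< key s
    key-mono s t lt = ℕₚ.<-≤-trans (ℕₚ.+-monoʳ-< (List.lookup P t ℕ.* n) (toℕ<n t))
      (ℕₚ.≤-trans (ℕₚ.≤-reflexive (ℕₚ.+-comm (List.lookup P t ℕ.* n) n))
        (ℕₚ.≤-trans (ℕₚ.*-monoˡ-≤ n lt) (ℕₚ.m≤m+n (List.lookup P s ℕ.* n) (toℕ s))))

    key-inj : ∀ {s t} → key s ≡ key t → s ≡ t
    key-inj {s} {t} eq with ℕₚ.<-cmp (List.lookup P s) (List.lookup P t)
    ... | tri< lt _ _ = ⊥-elim (ℕₚ.<⇒≢ (key-mono t s lt) eq)
    ... | tri> _ _ gt = ⊥-elim (ℕₚ.<⇒≢ (key-mono s t gt) (sym eq))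
    ... | tri≈ _ e _  = toℕ-injective (ℕₚ.+-cancelˡ-≡ (List.lookup P t ℕ.* n) _ _ (trans (cong (λ x → x ℕ.* n ℕ.+ toℕ s) (sym e)) eq))

    ranked = ranking key key-inj

  -- Labels are sorted in decreasing order: the largest label takes the smallest value.
  matches : ∀ {k} → Permutation′ k → Vec ℕ k → Bool
  matches {k} σ v = all (λ i → all (λ j → (lookup v j <ᵇ lookup v i) ⇔ᵇ (toℕ (σ ⟨$⟩ʳ i) <ᵇ toℕ (σ ⟨$⟩ʳ j))) (allFin k)) (allFin k)

  tie : ∀ {k} → Vec ℕ k → Fin k → Fin k → Bool
  tie v i j = not (does (i Fin.≟ j)) ∧ (lookup v i ≡ᵇ lookup v j)

  -- A count of ordered pairs where an indicator would do: it is at least 1 on every tied tuple, and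
  -- its total splits into one easy sum for each pair of positions.
  ties : ∀ {k} → Vec ℕ k → ℚ
  ties {k} v = ∑ (allFin k) (λ i → ∑ (allFin k) (λ j → ⟦ tie v i j ⟧))

  ties≥0 : ∀ {k} (v : Vec ℕ k) → 0ℚ ≤ ties v
  ties≥0 {k} v = ∑-nonNeg (allFin k) (λ i → ∑-nonNeg (allFin k) (λ j → ⟦⟧≥0 (tie v i j)))

  private
    ∑-member : ∀ {n} {I : Set} (f : Fin n → I) (g : I → ℚ) → (∀ x → 0ℚ ≤ g x) → ∀ i → g (f i) ≤ ∑ (tabulate f) g
    ∑-member f g g≥0 zero    = subst (_≤ ∑ (tabulate f) g) (+-identityʳ (g (f zero))) (+-monoʳ-≤ (g (f zero)) (∑-nonNeg (tabulate (f ∘ suc)) g≥0))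
    ∑-member f g g≥0 (suc i) = ≤-trans (∑-member (f ∘ suc) g g≥0 i)
      (subst (_≤ ∑ (tabulate f) g) (+-identityˡ (∑ (tabulate (f ∘ suc)) g)) (+-monoˡ-≤ (∑ (tabulate (f ∘ suc)) g) (g≥0 (f zero))))

  ≡ᵇ-refl : ∀ n → (n ≡ᵇ n) ≡ true
  ≡ᵇ-refl zero    = refl
  ≡ᵇ-refl (suc n) = ≡ᵇ-refl n

  tied⇒1≤ties : ∀ {k} (v : Vec ℕ k) i j → i ≢ j → lookup v i ≡ lookup v j → 1ℚ ≤ ties v
  tied⇒1≤ties {k} v i j i≢j eq = subst (_≤ ties v) tied (≤-trans (∑-member (λ j → j) (λ j → ⟦ tie v i j ⟧) (λ j → ⟦⟧≥0 (tie v i j)) j)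
    (∑-member (λ i → i) (λ i → ∑ (allFin k) (λ j → ⟦ tie v i j ⟧)) (λ i → ∑-nonNeg (allFin k) (λ j → ⟦⟧≥0 (tie v i j))) i))
    where
    tied : ⟦ tie v i j ⟧ ≡ 1ℚ
    tied with i Fin.≟ j
    ... | yes i≡j = ⊥-elim (i≢j i≡j)
    ... | no  _   rewrite eq | ≡ᵇ-refl (lookup v j) = refl

  module _ {k : ℕ} (σ : Permutation′ k) (P : List ℕ) (π : Permutation′ (length P)) (sorts : Sorts P π) where

    private
      values : Vec (Fin (length P)) k → Vec ℕ k
      values = Vec.map (List.lookup P)

      untied : ∀ s t → List.lookup P s ≢ List.lookup P t →
               (toℕ (π ⟨$⟩ʳ s) <ᵇ toℕ (π ⟨$⟩ʳ t)) ≡ (List.lookup P t <ᵇ List.lookup P s)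
      untied s t ≢ with ℕₚ.<-cmp (List.lookup P s) (List.lookup P t)
      ... | tri< lt _ _ = trans (<ᵇ-false (ℕₚ.<⇒≤ (sorts t s lt))) (sym (<ᵇ-false (ℕₚ.<⇒≤ lt)))
      ... | tri≈ _ eq _ = ⊥-elim (≢ eq)
      ... | tri> _ _ gt = trans (<ᵇ-true (sorts s t gt)) (sym (<ᵇ-true gt))

      compare : ∀ a i j → i ≢ j → lookup (values a) i ≢ lookup (values a) j →
                (toℕ (π ⟨$⟩ʳ lookup a i) <ᵇ toℕ (π ⟨$⟩ʳ lookup a j)) ≡ (lookup (values a) j <ᵇ lookup (values a) i)
      compare a i j i≢j ≢ = trans (untied (lookup a i) (lookup a j) (λ eq → ≢ (trans (lookup-map i (List.lookup P) a) (trans eq (sym (lookup-map j (List.lookup P) a))))))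
        (cong₂ _<ᵇ_ (sym (lookup-map j (List.lookup P) a)) (sym (lookup-map i (List.lookup P) a)))

      diagonal : ∀ {I : Set} {i j : I} (g h : I → ℕ) → i ≡ j → (g i <ᵇ g j) ≡ (h i <ᵇ h j)
      diagonal {i = i} g h refl = trans (<ᵇ-false {g i} ℕₚ.≤-refl) (sym (<ᵇ-false {h i} ℕₚ.≤-refl))

      matches⇒induces : ∀ a → matches σ (values a) ≡ true → induces σ π a ≡ true
      matches⇒induces a ok = allPairs⁺ _ (λ i j → ⇔ᵇ-true (agree i j))
        where
        agree′ : ∀ i j → (lookup (values a) j <ᵇ lookup (values a) i) ≡ (toℕ (σ ⟨$⟩ʳ i) <ᵇ toℕ (σ ⟨$⟩ʳ j))
        agree′ i j = ⇔ᵇ-true⁻ _ _ (allPairs⁻ (λ i j → (lookup (values a) j <ᵇ lookup (values a) i) ⇔ᵇ (toℕ (σ ⟨$⟩ʳ i) <ᵇ toℕ (σ ⟨$⟩ʳ j))) ok i j)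
        distinct : ∀ i j → i ≢ j → lookup (values a) i ≢ lookup (values a) j
        distinct i j i≢j eq with ℕₚ.<-cmp (toℕ (σ ⟨$⟩ʳ i)) (toℕ (σ ⟨$⟩ʳ j))
        ... | tri< lt _ _ = ℕₚ.<-irrefl (sym eq) (<ᵇ-true⁻ (trans (agree′ i j) (<ᵇ-true lt)))
        ... | tri≈ _ e _  = i≢j (perm-injective σ (toℕ-injective e))
        ... | tri> _ _ gt = ℕₚ.<-irrefl eq (<ᵇ-true⁻ (trans (agree′ j i) (<ᵇ-true gt)))
        agree : ∀ i j → (toℕ (π ⟨$⟩ʳ lookup a i) <ᵇ toℕ (π ⟨$⟩ʳ lookup a j)) ≡ (toℕ (σ ⟨$⟩ʳ i) <ᵇ toℕ (σ ⟨$⟩ʳ j))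
        agree i j with i Fin.≟ j
        ... | yes i≡j = diagonal (λ i → toℕ (π ⟨$⟩ʳ lookup a i)) (λ i → toℕ (σ ⟨$⟩ʳ i)) i≡j
        ... | no  i≢j = trans (compare a i j i≢j (distinct i j i≢j)) (agree′ i j)

      induces⇒matches : ∀ a → (∀ i j → i ≢ j → lookup (values a) i ≢ lookup (values a) j) → induces σ π a ≡ true → matches σ (values a) ≡ true
      induces⇒matches a distinct ok = allPairs⁺ _ (λ i j → ⇔ᵇ-true (agree i j))
        where
        agree′ : ∀ i j → (toℕ (π ⟨$⟩ʳ lookup a i) <ᵇ toℕ (π ⟨$⟩ʳ lookup a j)) ≡ (toℕ (σ ⟨$⟩ʳ i) <ᵇ toℕ (σ ⟨$⟩ʳ j))
        agree′ i j = ⇔ᵇ-true⁻ _ _ (allPairs⁻ (λ i j → (toℕ (π ⟨$⟩ʳ lookup a i) <ᵇ toℕ (π ⟨$⟩ʳ lookup a j)) ⇔ᵇ (toℕ (σ ⟨$⟩ʳ i) <ᵇ toℕ (σ ⟨$⟩ʳ j))) ok i j)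
        agree : ∀ i j → (lookup (values a) j <ᵇ lookup (values a) i) ≡ (toℕ (σ ⟨$⟩ʳ i) <ᵇ toℕ (σ ⟨$⟩ʳ j))
        agree i j with i Fin.≟ j
        ... | yes refl = trans (<ᵇ-false {lookup (values a) i} ℕₚ.≤-refl) (sym (<ᵇ-false {toℕ (σ ⟨$⟩ʳ i)} ℕₚ.≤-refl))
        ... | no  i≢j  = trans (sym (compare a i j i≢j (distinct i j i≢j))) (agree′ i j)

      matches≤induces : ∀ a → ⟦ matches σ (values a) ⟧ ≤ ⟦ induces σ π a ⟧
      matches≤induces a with matches σ (values a) in eq
      ... | false = ⟦⟧≥0 (induces σ π a)
      ... | true rewrite matches⇒induces a eq = ≤-refl

      induces≤matches+ties : ∀ a → ⟦ induces σ π a ⟧ ≤ ⟦ matches σ (values a) ⟧ + ties (values a)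
      induces≤matches+ties a with any? (λ i → any? (λ j → ¬? (i Fin.≟ j) ×-dec (lookup (values a) i ℕ.≟ lookup (values a) j)))
      ... | yes (i , j , i≢j , eq) = ≤-trans (⟦⟧≤1 (induces σ π a)) (≤-trans (tied⇒1≤ties (values a) i j i≢j eq)
              (subst (_≤ ⟦ matches σ (values a) ⟧ + ties (values a)) (+-identityˡ (ties (values a))) (+-monoˡ-≤ (ties (values a)) (⟦⟧≥0 (matches σ (values a))))))
      ... | no none = ≤-trans le (subst (_≤ ⟦ matches σ (values a) ⟧ + ties (values a)) (+-identityʳ ⟦ matches σ (values a) ⟧) (+-monoʳ-≤ ⟦ matches σ (values a) ⟧ (ties≥0 (values a))))
        where
        le : ⟦ induces σ π a ⟧ ≤ ⟦ matches σ (values a) ⟧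
        le with induces σ π a in eq
        ... | false = ⟦⟧≥0 (matches σ (values a))
        ... | true rewrite induces⇒matches a (λ i j i≢j e → none (i , j , i≢j , e)) eq = ≤-refl

      choose-map : ∀ {I J : Set} k (g : I → J) xs → choose k (map g xs) ≡ map (Vec.map g) (choose k xs)
      choose-map zero    g xs       = refl
      choose-map (suc k) g []       = refl
      choose-map (suc k) g (x ∷ xs) = begin
        map (g x ∷ᵥ_) (choose k (map g xs)) ++ choose (suc k) (map g xs)                              ≡⟨ cong₂ (λ u v → map (g x ∷ᵥ_) u ++ v) (choose-map k g xs) (choose-map (suc k) g xs) ⟩
        map (g x ∷ᵥ_) (map (Vec.map g) (choose k xs)) ++ map (Vec.map g) (choose (suc k) xs)          ≡⟨ cong (_++ map (Vec.map g) (choose (suc k) xs)) (trans (sym (map-∘ (choose k xs))) (map-∘ (choose k xs))) ⟩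
        map (Vec.map g) (map (x ∷ᵥ_) (choose k xs)) ++ map (Vec.map g) (choose (suc k) xs)            ≡⟨ map-++ (Vec.map g) (map (x ∷ᵥ_) (choose k xs)) (choose (suc k) xs) ⟨
        map (Vec.map g) (map (x ∷ᵥ_) (choose k xs) ++ choose (suc k) xs)                              ∎
        where open ≡-Reasoning

      ∑-values : ∀ (G : Vec ℕ k → ℚ) → ∑ (kSubsets (length P) k) (λ a → G (values a)) ≡ ∑ (choose k P) G
      ∑-values G = begin
        ∑ (choose k (allFin (length P))) (λ a → G (values a))       ≡⟨ ∑-map values (choose k (allFin (length P))) G ⟨
        ∑ (map values (choose k (allFin (length P)))) G             ≡⟨ cong (λ l → ∑ l G) (choose-map k (List.lookup P) (allFin (length P))) ⟨
        ∑ (choose k (map (List.lookup P) (allFin (length P)))) G    ≡⟨ cong (λ l → ∑ (choose k l) G) (trans (map-tabulate (λ i → i) (List.lookup P)) (tabulate-lookup P)) ⟩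
        ∑ (choose k P) G                                            ∎
        where open ≡-Reasoning

      ι-count : ι (count σ π) ≡ ∑ (kSubsets (length P) k) (λ a → ⟦ induces σ π a ⟧)
      ι-count = go (kSubsets (length P) k)
        where
        go : ∀ as → ι (sum (map (λ a → if induces σ π a then 1 else 0) as)) ≡ ∑ as (λ a → ⟦ induces σ π a ⟧)
        go []       = refl
        go (a ∷ as) = trans (ι-+ (if induces σ π a then 1 else 0) (sum (map (λ a → if induces σ π a then 1 else 0) as)))
          (cong₂ _+_ (ind (induces σ π a)) (go as))
          where
          ind : ∀ b → ι (if b then 1 else 0) ≡ ⟦ b ⟧
          ind true  = refl
          ind false = refl

    -- Labels that match `σ` are distinct, so the way ties are broken cannot destroy an occurrence.
    count-lower : ∑ (choose k P) (λ v → ⟦ matches σ v ⟧) ≤ ι (count σ π)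
    count-lower = subst₂ _≤_ (∑-values (λ v → ⟦ matches σ v ⟧)) (sym ι-count)
      (∑-mono (kSubsets (length P) k) (λ a _ → matches≤induces a))

    -- Breaking ties may create occurrences that the labels do not show, but only in tuples with two
    -- equal labels, and there `ties` is at least 1.
    count-upper : ι (count σ π) ≤ ∑ (choose k P) (λ v → ⟦ matches σ v ⟧ + ties v)
    count-upper = subst₂ _≤_ (sym ι-count) (∑-values (λ v → ⟦ matches σ v ⟧ + ties v))
      (∑-mono (kSubsets (length P) k) (λ a _ → induces≤matches+ties a))

  -- Sums over tuples inducing a pattern

  swapAt : ∀ {k} {I : Set} → Fin k → Vec I (suc k) → Vec I (suc k)
  swapAt {suc k} zero    (x ∷ᵥ y ∷ᵥ v) = y ∷ᵥ x ∷ᵥ v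
  swapAt {suc k} (suc i) (x ∷ᵥ v)      = x ∷ᵥ swapAt i v

  act : ∀ {k} {I : Set} → List (Fin k) → Vec I (suc k) → Vec I (suc k)
  act w v = foldr swapAt v w

  map-swapAt : ∀ {k} {I J : Set} (g : I → J) (i : Fin k) v → Vec.map g (swapAt i v) ≡ swapAt i (Vec.map g v)
  map-swapAt {suc k} g zero    (x ∷ᵥ y ∷ᵥ v) = refl
  map-swapAt {suc k} g (suc i) (x ∷ᵥ v)      = cong (g x ∷ᵥ_) (map-swapAt g i v)

  map-act : ∀ {k} {I J : Set} (g : I → J) (w : List (Fin k)) v → Vec.map g (act w v) ≡ act w (Vec.map g v)
  map-act g []      v = refl
  map-act g (i ∷ w) v = trans (map-swapAt g i (act w v)) (cong (swapAt i) (map-act g w v))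

  -- Interchanging neighbouring coordinates is an exchange of two nested sums. This is why
  -- permutations are decomposed into adjacent transpositions below.
  ∑-tuples-swapAt : ∀ {k} {I : Set} (xs : List I) (i : Fin k) (G : Vec I (suc k) → ℚ) →
                    ∑ (tuples (suc k) xs) (λ v → G (swapAt i v)) ≡ ∑ (tuples (suc k) xs) G
  ∑-tuples-swapAt {suc k} xs zero G = begin
    ∑ (tuples (2 ℕ.+ k) xs) (λ v → G (swapAt zero v))                           ≡⟨ unfold (λ v → G (swapAt zero v)) ⟩
    ∑ xs (λ x → ∑ xs (λ y → ∑ (tuples k xs) (λ v → G (y ∷ᵥ x ∷ᵥ v))))           ≡⟨ ∑-swap xs xs (λ x y → ∑ (tuples k xs) (λ v → G (y ∷ᵥ x ∷ᵥ v))) ⟩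
    ∑ xs (λ y → ∑ xs (λ x → ∑ (tuples k xs) (λ v → G (y ∷ᵥ x ∷ᵥ v))))           ≡⟨ unfold G ⟨
    ∑ (tuples (2 ℕ.+ k) xs) G                                                   ∎
    where
    open ≡-Reasoning
    unfold : ∀ H → ∑ (tuples (2 ℕ.+ k) xs) H ≡ ∑ xs (λ x → ∑ xs (λ y → ∑ (tuples k xs) (λ v → H (x ∷ᵥ y ∷ᵥ v))))
    unfold H = trans (∑-tuples (suc k) xs H) (∑-cong xs (λ x → ∑-tuples k xs (λ v → H (x ∷ᵥ v))))
  ∑-tuples-swapAt {suc k} xs (suc i) G = trans (∑-tuples (suc k) xs (λ v → G (swapAt (suc i) v)))
    (trans (∑-cong xs (λ x → ∑-tuples-swapAt xs i (λ v → G (x ∷ᵥ v)))) (sym (∑-tuples (suc k) xs G)))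

  ∑-tuples-act : ∀ {k} {I : Set} (xs : List I) (w : List (Fin k)) (G : Vec I (suc k) → ℚ) →
                 ∑ (tuples (suc k) xs) (λ v → G (act w v)) ≡ ∑ (tuples (suc k) xs) G
  ∑-tuples-act xs []      G = refl
  ∑-tuples-act xs (i ∷ w) G = trans (∑-tuples-act xs w (λ v → G (swapAt i v))) (∑-tuples-swapAt xs i G)

  -- Reduced words in the adjacent transpositions, one for each of the 24 elements of S₄.
  words : List (List (Fin 3))
  words = concatMap (λ u → concatMap (λ v → map (λ w → u ++ v ++ w) from₀) from₁) from₂
    where
    s₀ s₁ s₂ : Fin 3
    s₀ = zero
    s₁ = suc zero
    s₂ = suc (suc zero)
    from₀ from₁ from₂ : List (List (Fin 3))
    from₀ = [] ∷ (s₀ ∷ []) ∷ []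
    from₁ = [] ∷ (s₁ ∷ []) ∷ (s₀ ∷ s₁ ∷ []) ∷ []
    from₂ = [] ∷ (s₂ ∷ []) ∷ (s₁ ∷ s₂ ∷ []) ∷ (s₀ ∷ s₁ ∷ s₂ ∷ []) ∷ []

  -- A permutation of four points is accessible to evaluation only through its four values. Facts
  -- about permutations are checked on all 256 quadruples of values, with this as the alternative
  -- that injectivity excludes.
  Clash : (a b c d : Fin 4) → Set
  Clash a b c d = a ≡ b ⊎ a ≡ c ⊎ a ≡ d ⊎ b ≡ c ⊎ b ≡ d ⊎ c ≡ d

  clash? : ∀ a b c d → Dec (Clash a b c d)
  clash? a b c d = (a Fin.≟ b) ⊎-dec (a Fin.≟ c) ⊎-dec (a Fin.≟ d) ⊎-dec (b Fin.≟ c) ⊎-dec (b Fin.≟ d) ⊎-dec (c Fin.≟ d)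

  no-clash : ∀ (σ : Permutation′ 4) → ¬ Clash (σ ⟨$⟩ʳ # 0) (σ ⟨$⟩ʳ # 1) (σ ⟨$⟩ʳ # 2) (σ ⟨$⟩ʳ # 3)
  no-clash σ (inj₁ eq) with () ← perm-injective σ eq
  no-clash σ (inj₂ (inj₁ eq)) with () ← perm-injective σ eq
  no-clash σ (inj₂ (inj₂ (inj₁ eq))) with () ← perm-injective σ eq
  no-clash σ (inj₂ (inj₂ (inj₂ (inj₁ eq)))) with () ← perm-injective σ eq
  no-clash σ (inj₂ (inj₂ (inj₂ (inj₂ (inj₁ eq))))) with () ← perm-injective σ eq
  no-clash σ (inj₂ (inj₂ (inj₂ (inj₂ (inj₂ eq))))) with () ← perm-injective σ eq

  abstract
    clash⊎word : ∀ (a b c d : Fin 4) → Clash a b c d ⊎ Any.Any (λ w → act w (Vec.allFin 4) ≡ a ∷ᵥ b ∷ᵥ c ∷ᵥ d ∷ᵥ []ᵥ) words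
    clash⊎word = from-yes (all? λ a → all? λ b → all? λ c → all? λ d →
      clash? a b c d ⊎-dec Any.any? (λ w → ≡-dec Fin._≟_ (act w (Vec.allFin 4)) (a ∷ᵥ b ∷ᵥ c ∷ᵥ d ∷ᵥ []ᵥ)) words)

  word : (σ : Permutation′ 4) → ∃ λ w → act w (Vec.allFin 4) ≡ Vec.tabulate (σ ⟨$⟩ʳ_)
  word σ with clash⊎word (σ ⟨$⟩ʳ # 0) (σ ⟨$⟩ʳ # 1) (σ ⟨$⟩ʳ # 2) (σ ⟨$⟩ʳ # 3)
  ... | inj₂ found = Any.satisfied found
  ... | inj₁ clash = ⊥-elim (no-clash σ clash)

  permute : ∀ {k} {I : Set} → Permutation′ k → Vec I k → Vec I k
  permute σ v = Vec.tabulate (λ i → lookup v (σ ⟨$⟩ʳ i))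

  ∑-tuples-permute : ∀ {I : Set} (xs : List I) (σ : Permutation′ 4) (G : Vec I 4 → ℚ) →
                     ∑ (tuples 4 xs) (λ v → G (permute σ v)) ≡ ∑ (tuples 4 xs) G
  ∑-tuples-permute xs σ G = trans (∑-cong (tuples 4 xs) (λ v → cong G (permute≡act v))) (∑-tuples-act xs w G)
    where
    w = proj₁ (word σ)
    open ≡-Reasoning
    permute≡act : ∀ v → permute σ v ≡ act w v
    permute≡act v = begin
      permute σ v                              ≡⟨ tabulate-∘ (lookup v) (σ ⟨$⟩ʳ_) ⟩
      Vec.map (lookup v) (Vec.tabulate (σ ⟨$⟩ʳ_)) ≡⟨ cong (Vec.map (lookup v)) (proj₂ (word σ)) ⟨
      Vec.map (lookup v) (act w (Vec.allFin 4)) ≡⟨ map-act (lookup v) w (Vec.allFin 4) ⟩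
      act w (Vec.map (lookup v) (Vec.allFin 4)) ≡⟨ cong (act w) (map-lookup-allFin v) ⟩
      act w v                                  ∎

  descendsFrom : ∀ {k} → ℕ → Vec ℕ k → Bool
  descendsFrom b []ᵥ      = true
  descendsFrom b (x ∷ᵥ v) = (x <ᵇ b) ∧ descendsFrom x v

  descends : ∀ {k} → Vec ℕ k → Bool
  descends []ᵥ      = true
  descends (x ∷ᵥ v) = descendsFrom x v

  private
    ⟦∧⟧ : ∀ a b c → ⟦ a ∧ b ⟧ * c ≡ ⟦ a ⟧ * (⟦ b ⟧ * c)
    ⟦∧⟧ true  b c = sym (*-identityˡ (⟦ b ⟧ * c))
    ⟦∧⟧ false b c = trans (*-zeroˡ c) (sym (*-zeroˡ (⟦ b ⟧ * c)))

    ∑-below : ∀ n b (g : ℕ → ℚ) → b ℕ.≤ n → ∑ (downFrom n) (λ x → ⟦ x <ᵇ b ⟧ * g x) ≡ ∑ (downFrom b) g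
    ∑-below zero    .zero g ℕ.z≤n = refl
    ∑-below (suc n) b g b≤ with ℕₚ.m≤n⇒m<n∨m≡n b≤
    ... | inj₁ (ℕ.s≤s b≤n) rewrite <ᵇ-false b≤n = trans (cong₂ _+_ (*-zeroˡ (g n)) (∑-below n b g b≤n)) (+-identityˡ (∑ (downFrom b) g))
    ... | inj₂ refl = ∑-cong∈ (downFrom (suc n)) (λ x x∈ → trans (cong (λ t → ⟦ t ⟧ * g x) (<ᵇ-true (∈-downFrom x∈))) (*-identityˡ (g x)))

    ∑-choose-head : ∀ k n (K : Vec ℕ (suc k) → ℚ) →
                    ∑ (downFrom n) (λ x → ∑ (choose k (downFrom x)) (λ v → K (x ∷ᵥ v))) ≡ ∑ (choose (suc k) (downFrom n)) K
    ∑-choose-head k zero    K = refl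
    ∑-choose-head k (suc n) K = trans (cong (∑ (choose k (downFrom n)) (λ v → K (n ∷ᵥ v)) +_) (∑-choose-head k n K)) (sym (∑-choose k n (downFrom n) K))

    ∑-descendsFrom : ∀ k n b (K : Vec ℕ k → ℚ) → b ℕ.≤ n →
                     ∑ (tuples k (downFrom n)) (λ v → ⟦ descendsFrom b v ⟧ * K v) ≡ ∑ (choose k (downFrom b)) K
    ∑-descendsFrom zero    n b K b≤n = cong (_+ 0ℚ) (*-identityˡ (K []ᵥ))
    ∑-descendsFrom (suc k) n b K b≤n = begin
      ∑ (tuples (suc k) (downFrom n)) (λ v → ⟦ descendsFrom b v ⟧ * K v)
        ≡⟨ ∑-tuples k (downFrom n) (λ v → ⟦ descendsFrom b v ⟧ * K v) ⟩
      ∑ (downFrom n) (λ x → ∑ (tuples k (downFrom n)) (λ v → ⟦ (x <ᵇ b) ∧ descendsFrom x v ⟧ * K (x ∷ᵥ v)))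
        ≡⟨ ∑-cong∈ (downFrom n) (λ x x∈ → begin
             ∑ (tuples k (downFrom n)) (λ v → ⟦ (x <ᵇ b) ∧ descendsFrom x v ⟧ * K (x ∷ᵥ v))
               ≡⟨ ∑-cong (tuples k (downFrom n)) (λ v → ⟦∧⟧ (x <ᵇ b) (descendsFrom x v) (K (x ∷ᵥ v))) ⟩
             ∑ (tuples k (downFrom n)) (λ v → ⟦ x <ᵇ b ⟧ * (⟦ descendsFrom x v ⟧ * K (x ∷ᵥ v)))
               ≡⟨ ∑-*ˡ (tuples k (downFrom n)) ⟦ x <ᵇ b ⟧ (λ v → ⟦ descendsFrom x v ⟧ * K (x ∷ᵥ v)) ⟩
             ⟦ x <ᵇ b ⟧ * ∑ (tuples k (downFrom n)) (λ v → ⟦ descendsFrom x v ⟧ * K (x ∷ᵥ v))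
               ≡⟨ cong (⟦ x <ᵇ b ⟧ *_) (∑-descendsFrom k n x (λ v → K (x ∷ᵥ v)) (ℕₚ.<⇒≤ (∈-downFrom x∈))) ⟩
             ⟦ x <ᵇ b ⟧ * ∑ (choose k (downFrom x)) (λ v → K (x ∷ᵥ v)) ∎) ⟩
      ∑ (downFrom n) (λ x → ⟦ x <ᵇ b ⟧ * ∑ (choose k (downFrom x)) (λ v → K (x ∷ᵥ v)))
        ≡⟨ ∑-below n b (λ x → ∑ (choose k (downFrom x)) (λ v → K (x ∷ᵥ v))) b≤n ⟩
      ∑ (downFrom b) (λ x → ∑ (choose k (downFrom x)) (λ v → K (x ∷ᵥ v)))
        ≡⟨ ∑-choose-head k b K ⟩
      ∑ (choose (suc k) (downFrom b)) K ∎
      where open ≡-Reasoning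

  -- As `downFrom n` is decreasing, `choose` produces each strictly decreasing tuple exactly once.
  ∑-descends : ∀ k n (K : Vec ℕ k → ℚ) →
               ∑ (tuples k (downFrom n)) (λ v → ⟦ descends v ⟧ * K v) ≡ ∑ (choose k (downFrom n)) K
  ∑-descends zero    n K = cong (_+ 0ℚ) (*-identityˡ (K []ᵥ))
  ∑-descends (suc k) n K = begin
    ∑ (tuples (suc k) (downFrom n)) (λ v → ⟦ descends v ⟧ * K v)
      ≡⟨ ∑-tuples k (downFrom n) (λ v → ⟦ descends v ⟧ * K v) ⟩
    ∑ (downFrom n) (λ x → ∑ (tuples k (downFrom n)) (λ v → ⟦ descendsFrom x v ⟧ * K (x ∷ᵥ v)))
      ≡⟨ ∑-cong∈ (downFrom n) (λ x x∈ → ∑-descendsFrom k n x (λ v → K (x ∷ᵥ v)) (ℕₚ.<⇒≤ (∈-downFrom x∈))) ⟩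
    ∑ (downFrom n) (λ x → ∑ (choose k (downFrom x)) (λ v → K (x ∷ᵥ v)))
      ≡⟨ ∑-choose-head k n K ⟩
    ∑ (choose (suc k) (downFrom n)) K ∎
    where open ≡-Reasoning

  Descending : ∀ {k} → Vec ℕ k → Set
  Descending v = ∀ p q → p Fin.< q → lookup v q ℕ.< lookup v p

  private
    descendsFrom⁻ : ∀ {k} b (v : Vec ℕ k) → descendsFrom b v ≡ true → (∀ i → lookup v i ℕ.< b) × Descending v
    descendsFrom⁻ b []ᵥ      ok = (λ ()) , (λ ())
    descendsFrom⁻ b (x ∷ᵥ v) ok with x <ᵇ b in x<b
    ... | true with descendsFrom⁻ x v ok
    ... | below , desc = below′ , desc′
      where
      below′ : ∀ i → lookup (x ∷ᵥ v) i ℕ.< b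
      below′ zero    = <ᵇ-true⁻ x<b
      below′ (suc i) = ℕₚ.<-trans (below i) (<ᵇ-true⁻ x<b)
      desc′ : Descending (x ∷ᵥ v)
      desc′ zero    (suc q) _           = below q
      desc′ (suc p) (suc q) (ℕ.s≤s p<q) = desc p q p<q

    descendsFrom⁺ : ∀ {k} b (v : Vec ℕ k) → (∀ i → lookup v i ℕ.< b) → Descending v → descendsFrom b v ≡ true
    descendsFrom⁺ b []ᵥ      _     _    = refl
    descendsFrom⁺ b (x ∷ᵥ v) below desc = cong₂ _∧_ (<ᵇ-true (below zero))
      (descendsFrom⁺ x v (λ i → desc zero (suc i) (ℕ.s≤s ℕ.z≤n)) (λ p q p<q → desc (suc p) (suc q) (ℕ.s≤s p<q)))

    descends⁻ : ∀ {k} (v : Vec ℕ k) → descends v ≡ true → Descending v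
    descends⁻ (x ∷ᵥ v) ok zero    (suc q) _           = proj₁ (descendsFrom⁻ x v ok) q
    descends⁻ (x ∷ᵥ v) ok (suc p) (suc q) (ℕ.s≤s p<q) = proj₂ (descendsFrom⁻ x v ok) p q p<q

    descends⁺ : ∀ {k} (v : Vec ℕ k) → Descending v → descends v ≡ true
    descends⁺ []ᵥ      desc = refl
    descends⁺ (x ∷ᵥ v) desc = descendsFrom⁺ x v (λ i → desc zero (suc i) (ℕ.s≤s ℕ.z≤n)) (λ p q p<q → desc (suc p) (suc q) (ℕ.s≤s p<q))

  -- Entry `i` of `permute σ v` is the entry of `v` at `σ i`. Comparing entries `i` and `j` thus
  -- compares `v` at `σ i` and `σ j`, and agreement with the reversed order of these indices for all
  -- pairs says that `v` descends.
  matches-permute : ∀ {k} (σ : Permutation′ k) (v : Vec ℕ k) → matches σ (permute σ v) ≡ descends v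
  matches-permute {k} σ v with descends v in desc | matches σ (permute σ v) in str
  ... | true  | true  = refl
  ... | false | false = refl
  ... | true  | false = trans (sym str) (allPairs⁺ _ (λ i j → ⇔ᵇ-true (agree i j)))
    where
    agree : ∀ i j → (lookup (permute σ v) j <ᵇ lookup (permute σ v) i) ≡ (toℕ (σ ⟨$⟩ʳ i) <ᵇ toℕ (σ ⟨$⟩ʳ j))
    agree i j rewrite lookup∘tabulate (λ i → lookup v (σ ⟨$⟩ʳ i)) i | lookup∘tabulate (λ i → lookup v (σ ⟨$⟩ʳ i)) j
      with ℕₚ.<-cmp (toℕ (σ ⟨$⟩ʳ i)) (toℕ (σ ⟨$⟩ʳ j))
    ... | tri< lt _ _ = trans (<ᵇ-true (descends⁻ v desc (σ ⟨$⟩ʳ i) (σ ⟨$⟩ʳ j) lt)) (sym (<ᵇ-true lt))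
    ... | tri≈ _ eq _ = trans (<ᵇ-false (ℕₚ.≤-reflexive (cong (lookup v) (toℕ-injective eq)))) (sym (<ᵇ-false (ℕₚ.≤-reflexive (sym eq))))
    ... | tri> _ _ gt = trans (<ᵇ-false (ℕₚ.<⇒≤ (descends⁻ v desc (σ ⟨$⟩ʳ j) (σ ⟨$⟩ʳ i) gt))) (sym (<ᵇ-false (ℕₚ.<⇒≤ gt)))
  ... | false | true  = trans (sym (descends⁺ v descending)) desc
    where
    agree : ∀ i j → (lookup (permute σ v) j <ᵇ lookup (permute σ v) i) ≡ (toℕ (σ ⟨$⟩ʳ i) <ᵇ toℕ (σ ⟨$⟩ʳ j))
    agree i j = ⇔ᵇ-true⁻ _ _ (allPairs⁻ (λ i j → (lookup (permute σ v) j <ᵇ lookup (permute σ v) i) ⇔ᵇ (toℕ (σ ⟨$⟩ʳ i) <ᵇ toℕ (σ ⟨$⟩ʳ j))) str i j)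
    lookup-permute⁻ : ∀ p → lookup (permute σ v) (σ ⟨$⟩ˡ p) ≡ lookup v p
    lookup-permute⁻ p = trans (lookup∘tabulate (λ i → lookup v (σ ⟨$⟩ʳ i)) (σ ⟨$⟩ˡ p)) (cong (lookup v) (inverseʳ σ))
    descending : Descending v
    descending p q p<q = subst₂ ℕ._<_ (lookup-permute⁻ q) (lookup-permute⁻ p)
      (<ᵇ-true⁻ (trans (agree (σ ⟨$⟩ˡ p) (σ ⟨$⟩ˡ q)) (<ᵇ-true (subst₂ ℕ._<_ (cong toℕ (sym (inverseʳ σ))) (cong toℕ (sym (inverseʳ σ))) p<q))))

  -- Change of variables: the label tuples that match `σ` are the `σ`-permutations of decreasing
  -- ones. It turns the sum over labels into one over 4-subsets, to which the dual basis applies.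
  ∑-matches : ∀ n (σ : Permutation′ 4) (K : Vec ℕ 4 → ℚ) →
             ∑ (tuples 4 (downFrom n)) (λ v → ⟦ matches σ v ⟧ * K v) ≡ ∑ (choose 4 (downFrom n)) (λ v → K (permute σ v))
  ∑-matches n σ K = begin
    ∑ (tuples 4 (downFrom n)) (λ v → ⟦ matches σ v ⟧ * K v)
      ≡⟨ ∑-tuples-permute (downFrom n) σ (λ v → ⟦ matches σ v ⟧ * K v) ⟨
    ∑ (tuples 4 (downFrom n)) (λ v → ⟦ matches σ (permute σ v) ⟧ * K (permute σ v))
      ≡⟨ ∑-cong (tuples 4 (downFrom n)) (λ v → cong (λ b → ⟦ b ⟧ * K (permute σ v)) (matches-permute σ v)) ⟩
    ∑ (tuples 4 (downFrom n)) (λ v → ⟦ descends v ⟧ * K (permute σ v))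
      ≡⟨ ∑-descends 4 n (λ v → K (permute σ v)) ⟩
    ∑ (choose 4 (downFrom n)) (λ v → K (permute σ v)) ∎
    where open ≡-Reasoning

  length-tuples : ∀ {I : Set} k (xs : List I) → ∑ (tuples k xs) (λ _ → 1ℚ) ≡ ι (length xs ℕ.^ k)
  length-tuples zero    xs = refl
  length-tuples (suc k) xs = begin
    ∑ (tuples (suc k) xs) (λ _ → 1ℚ)                ≡⟨ ∑-tuples k xs (λ _ → 1ℚ) ⟩
    ∑ xs (λ _ → ∑ (tuples k xs) (λ _ → 1ℚ))         ≡⟨ ∑-const xs (∑ (tuples k xs) (λ _ → 1ℚ)) ⟩
    ι (length xs) * ∑ (tuples k xs) (λ _ → 1ℚ)      ≡⟨ cong (ι (length xs) *_) (length-tuples k xs) ⟩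
    ι (length xs) * ι (length xs ℕ.^ k)             ≡⟨ ι-* (length xs) (length xs ℕ.^ k) ⟨
    ι (length xs ℕ.^ suc k)                         ∎
    where open ≡-Reasoning

  private
    ≢⇒≡ᵇ : ∀ {m n} → m ≢ n → (m ≡ᵇ n) ≡ false
    ≢⇒≡ᵇ {m} {n} m≢n with m ≡ᵇ n in eq
    ... | false = refl
    ... | true  = ⊥-elim (m≢n (ℕₚ.≡ᵇ⇒≡ m n (subst T (sym eq) _)))

    ∑-≡ᵇ : ∀ n c → ∑ (downFrom n) (λ x → ⟦ x ≡ᵇ c ⟧) ≤ 1ℚ
    ∑-≡ᵇ zero    c = ι≥0 1
    ∑-≡ᵇ (suc n) c with n ℕ.≟ c
    ... | yes refl = ≤-reflexive (trans (cong₂ _+_ (cong ⟦_⟧ (≡ᵇ-refl n)) (trans (∑-cong∈ (downFrom n) (λ x x∈ → cong ⟦_⟧ (≢⇒≡ᵇ (ℕₚ.<⇒≢ (∈-downFrom x∈)))))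
           (trans (∑-const (downFrom n) 0ℚ) (*-zeroʳ (ι (length (downFrom n))))))) (+-identityʳ 1ℚ))
    ... | no n≢c = subst (_≤ 1ℚ) (sym (trans (cong (λ t → ⟦ t ⟧ + ∑ (downFrom n) (λ x → ⟦ x ≡ᵇ c ⟧)) (≢⇒≡ᵇ n≢c)) (+-identityˡ _))) (∑-≡ᵇ n c)

    ∑-equal : ∀ k n (i j : Fin (suc k)) → i ≢ j → ∑ (tuples (suc k) (downFrom n)) (λ v → ⟦ lookup v i ≡ᵇ lookup v j ⟧) ≤ ι (n ℕ.^ k)
    ∑-equal k n zero zero i≢j = ⊥-elim (i≢j refl)
    ∑-equal (suc k) n zero (suc j) _ = begin
      ∑ (tuples (2 ℕ.+ k) (downFrom n)) (λ v → ⟦ lookup v zero ≡ᵇ lookup v (suc j) ⟧)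
        ≡⟨ ∑-tuples (suc k) (downFrom n) (λ v → ⟦ lookup v zero ≡ᵇ lookup v (suc j) ⟧) ⟩
      ∑ (downFrom n) (λ x → ∑ (tuples (suc k) (downFrom n)) (λ v → ⟦ x ≡ᵇ lookup v j ⟧))
        ≡⟨ ∑-swap (downFrom n) (tuples (suc k) (downFrom n)) (λ x v → ⟦ x ≡ᵇ lookup v j ⟧) ⟩
      ∑ (tuples (suc k) (downFrom n)) (λ v → ∑ (downFrom n) (λ x → ⟦ x ≡ᵇ lookup v j ⟧))
        ≤⟨ ∑-mono (tuples (suc k) (downFrom n)) (λ v _ → ∑-≡ᵇ n (lookup v j)) ⟩
      ∑ (tuples (suc k) (downFrom n)) (λ _ → 1ℚ)
        ≡⟨ trans (length-tuples (suc k) (downFrom n)) (cong (λ l → ι (l ℕ.^ suc k)) (length-downFrom n)) ⟩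
      ι (n ℕ.^ suc k) ∎
      where open ≤-Reasoning
    ∑-equal (suc k) n (suc i) zero i≢j = begin
      ∑ (tuples (2 ℕ.+ k) (downFrom n)) (λ v → ⟦ lookup v (suc i) ≡ᵇ lookup v zero ⟧)
        ≡⟨ ∑-cong (tuples (2 ℕ.+ k) (downFrom n)) (λ v → cong ⟦_⟧ (≡ᵇ-sym (lookup v (suc i)) (lookup v zero))) ⟩
      ∑ (tuples (2 ℕ.+ k) (downFrom n)) (λ v → ⟦ lookup v zero ≡ᵇ lookup v (suc i) ⟧)
        ≤⟨ ∑-equal (suc k) n zero (suc i) (λ ()) ⟩
      ι (n ℕ.^ suc k) ∎
      where
      open ≤-Reasoning
      ≡ᵇ-sym : ∀ a b → (a ≡ᵇ b) ≡ (b ≡ᵇ a)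
      ≡ᵇ-sym zero    zero    = refl
      ≡ᵇ-sym zero    (suc b) = refl
      ≡ᵇ-sym (suc a) zero    = refl
      ≡ᵇ-sym (suc a) (suc b) = ≡ᵇ-sym a b
    ∑-equal (suc k) n (suc i) (suc j) i≢j = begin
      ∑ (tuples (2 ℕ.+ k) (downFrom n)) (λ v → ⟦ lookup v (suc i) ≡ᵇ lookup v (suc j) ⟧)
        ≡⟨ ∑-tuples (suc k) (downFrom n) (λ v → ⟦ lookup v (suc i) ≡ᵇ lookup v (suc j) ⟧) ⟩
      ∑ (downFrom n) (λ x → ∑ (tuples (suc k) (downFrom n)) (λ v → ⟦ lookup v i ≡ᵇ lookup v j ⟧))
        ≤⟨ ∑-mono (downFrom n) (λ x _ → ∑-equal k n i j (λ eq → i≢j (cong suc eq))) ⟩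
      ∑ (downFrom n) (λ _ → ι (n ℕ.^ k))
        ≡⟨ trans (∑-const (downFrom n) (ι (n ℕ.^ k))) (cong (λ l → ι l * ι (n ℕ.^ k)) (length-downFrom n)) ⟩
      ι n * ι (n ℕ.^ k)
        ≡⟨ ι-* n (n ℕ.^ k) ⟨
      ι (n ℕ.^ suc k) ∎
      where open ≤-Reasoning

  -- Each of the 16 ordered pairs of positions costs at most n³, so among the n⁴ tuples ties have
  -- relative weight of order 1/n.
  ∑-ties : ∀ n → ∑ (tuples 4 (downFrom n)) ties ≤ ι 16 * ι (n ℕ.^ 3)
  ∑-ties n = begin
    ∑ (tuples 4 (downFrom n)) ties
      ≡⟨ ∑-swap (tuples 4 (downFrom n)) (allFin 4) (λ v i → ∑ (allFin 4) (λ j → ⟦ tie v i j ⟧)) ⟩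
    ∑ (allFin 4) (λ i → ∑ (tuples 4 (downFrom n)) (λ v → ∑ (allFin 4) (λ j → ⟦ tie v i j ⟧)))
      ≡⟨ ∑-cong (allFin 4) (λ i → ∑-swap (tuples 4 (downFrom n)) (allFin 4) (λ v j → ⟦ tie v i j ⟧)) ⟩
    ∑ (allFin 4) (λ i → ∑ (allFin 4) (λ j → ∑ (tuples 4 (downFrom n)) (λ v → ⟦ tie v i j ⟧)))
      ≤⟨ ∑-mono (allFin 4) (λ i _ → ∑-mono (allFin 4) (λ j _ → pair i j)) ⟩
    ∑ (allFin 4) (λ _ → ∑ (allFin 4) (λ _ → ι (n ℕ.^ 3)))
      ≡⟨ trans (∑-cong (allFin 4) (λ _ → ∑-const (allFin 4) (ι (n ℕ.^ 3)))) (trans (∑-const (allFin 4) (ι 4 * ι (n ℕ.^ 3))) (sym (*-assoc (ι 4) (ι 4) (ι (n ℕ.^ 3))))) ⟩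
    ι 16 * ι (n ℕ.^ 3) ∎
    where
    open ≤-Reasoning
    pair : ∀ i j → ∑ (tuples 4 (downFrom n)) (λ v → ⟦ tie v i j ⟧) ≤ ι (n ℕ.^ 3)
    pair i j with i Fin.≟ j
    ... | yes _   = subst (_≤ ι (n ℕ.^ 3)) (sym (trans (∑-const (tuples 4 (downFrom n)) 0ℚ) (*-zeroʳ (ι (length (tuples 4 (downFrom n))))))) (ι≥0 (n ℕ.^ 3))
    ... | no  i≢j = ∑-equal 3 n i j i≢j

  ties≤16 : ∀ (v : Vec ℕ 4) → ties v ≤ ι 16
  ties≤16 v = ≤-trans (∑-mono (allFin 4) {g = λ _ → ι 4} (λ i _ → ∑-mono (allFin 4) {g = λ _ → 1ℚ} (λ j _ → ⟦⟧≤1 (tie v i j)))) ≤-refl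

  -- Weighted grids

  weight : ∀ {k} → (ℕ → ℕ → ℚ) → Vec ℕ k → Vec ℕ k → ℚ
  weight w []ᵥ      []ᵥ      = 1ℚ
  weight w (x ∷ᵥ X) (y ∷ᵥ Y) = w x y * weight w X Y

  private
    ∑-replicate : ∀ m (y : ℕ) (g : ℕ → ℚ) → ∑ (replicate m y) g ≡ ι m * g y
    ∑-replicate zero    y g = sym (*-zeroˡ (g y))
    ∑-replicate (suc m) y g = trans (cong (g y +_) (∑-replicate m y g)) (trans (lemma (g y) (ι m)) (cong (_* g y) (sym (ι-+ 1 m))))
      where
      lemma : ∀ a b → a + b * a ≡ (ι 1 + b) * a
      lemma = solve-∀ ℚ-ring

    ∑-choose-++ : ∀ {I : Set} k (c P : List I) (G : Vec I k → ℚ) → (∀ v → 0ℚ ≤ G v) → ∑ (choose k P) G ≤ ∑ (choose k (c ++ P)) G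
    ∑-choose-++ zero    c       P G G≥0 = ≤-refl
    ∑-choose-++ (suc k) []      P G G≥0 = ≤-refl
    ∑-choose-++ (suc k) (x ∷ c) P G G≥0 = ≤-trans (∑-choose-++ (suc k) c P G G≥0)
      (subst₂ _≤_ (+-identityˡ (∑ (choose (suc k) (c ++ P)) G)) (sym (∑-choose k x (c ++ P) G))
        (+-monoˡ-≤ (∑ (choose (suc k) (c ++ P)) G) (∑-nonNeg (choose k (c ++ P)) (λ v → G≥0 (x ∷ᵥ v)))))

    -- Only tuples with at most one entry from `c` are kept. With `c` a column of the grid, the
    -- tuples dropped are those with two points in it, and dropping them is harmless as `G` is
    -- nonnegative.
    ∑-choose-++-suc : ∀ {I : Set} k (c P : List I) (G : Vec I (suc k) → ℚ) → (∀ v → 0ℚ ≤ G v) →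
                      ∑ c (λ y → ∑ (choose k P) (λ v → G (y ∷ᵥ v))) + ∑ (choose (suc k) P) G ≤ ∑ (choose (suc k) (c ++ P)) G
    ∑-choose-++-suc k []      P G G≥0 = ≤-reflexive (+-identityˡ (∑ (choose (suc k) P) G))
    ∑-choose-++-suc k (x ∷ c) P G G≥0 = subst₂ _≤_
      (sym (+-assoc (∑ (choose k P) (λ v → G (x ∷ᵥ v))) (∑ c (λ y → ∑ (choose k P) (λ v → G (y ∷ᵥ v)))) (∑ (choose (suc k) P) G)))
      (sym (∑-choose k x (c ++ P) G))
      (+-mono-≤ (∑-choose-++ k c P (λ v → G (x ∷ᵥ v)) (λ v → G≥0 (x ∷ᵥ v))) (∑-choose-++-suc k c P G G≥0))

  module Points (N : ℕ) (W : ℕ → ℕ → ℕ) where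

    column : ℕ → List ℕ
    column x = concatMap (λ y → replicate (W x y) y) (downFrom N)

    -- The y-coordinates of the points of a multiset with W x y copies of (x , y), listed column by column.
    points : ℕ → List ℕ
    points n = concatMap column (downFrom n)

    private
      w : ℕ → ℕ → ℚ
      w x y = ι (W x y)

    ∑-column : ∀ x g → ∑ (column x) g ≡ ∑ (downFrom N) (λ y → w x y * g y)
    ∑-column x g = trans (∑-concatMap (λ y → replicate (W x y) y) (downFrom N) g) (∑-cong (downFrom N) (λ y → ∑-replicate (W x y) y g))

    -- The part of the sum over `k`-subsets of the point multiset in which no two points share a
    -- column, grouped by cells; `weight` counts the copies. Labels may still coincide.
    distinctColumns : ∀ k n → (Vec ℕ k → ℚ) → ℚ
    distinctColumns k n G = ∑ (choose k (downFrom n)) (λ X → ∑ (tuples k (downFrom N)) (λ Y → weight w X Y * G Y))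

    private
      split-first : ∀ k n G → distinctColumns (suc k) (suc n) G
                    ≡ ∑ (downFrom N) (λ y → w n y * distinctColumns k n (λ v → G (y ∷ᵥ v))) + distinctColumns (suc k) n G
      split-first k n G = trans (∑-choose k n (downFrom n) (λ X → ∑ (tuples (suc k) (downFrom N)) (λ Y → weight w X Y * G Y)))
        (cong (_+ distinctColumns (suc k) n G) (begin
          ∑ Xs (λ X → ∑ (tuples (suc k) (downFrom N)) (λ Y → weight w (n ∷ᵥ X) Y * G Y))
            ≡⟨ ∑-cong Xs (λ X → ∑-tuples k (downFrom N) (λ Y → weight w (n ∷ᵥ X) Y * G Y)) ⟩
          ∑ Xs (λ X → ∑ (downFrom N) (λ y → ∑ Ys (λ Y → w n y * weight w X Y * G (y ∷ᵥ Y))))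
            ≡⟨ ∑-swap Xs (downFrom N) (λ X y → ∑ Ys (λ Y → w n y * weight w X Y * G (y ∷ᵥ Y))) ⟩
          ∑ (downFrom N) (λ y → ∑ Xs (λ X → ∑ Ys (λ Y → w n y * weight w X Y * G (y ∷ᵥ Y))))
            ≡⟨ ∑-cong (downFrom N) (λ y → trans
                 (∑-cong Xs (λ X → trans (∑-cong Ys (λ Y → *-assoc (w n y) (weight w X Y) (G (y ∷ᵥ Y)))) (∑-*ˡ Ys (w n y) (λ Y → weight w X Y * G (y ∷ᵥ Y)))))
                 (∑-*ˡ Xs (w n y) (λ X → ∑ Ys (λ Y → weight w X Y * G (y ∷ᵥ Y))))) ⟩
          ∑ (downFrom N) (λ y → w n y * distinctColumns k n (λ v → G (y ∷ᵥ v))) ∎))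
        where
        open ≡-Reasoning
        Xs = choose k (downFrom n)
        Ys = tuples k (downFrom N)

    distinctColumns≤ : ∀ k n G → (∀ v → 0ℚ ≤ G v) → distinctColumns k n G ≤ ∑ (choose k (points n)) G
    distinctColumns≤ zero    n       G G≥0 = ≤-reflexive (trans (+-identityʳ _) (cong (_+ 0ℚ) (*-identityˡ (G []ᵥ))))
    distinctColumns≤ (suc k) zero    G G≥0 = ≤-refl
    distinctColumns≤ (suc k) (suc n) G G≥0 = begin
      distinctColumns (suc k) (suc n) G
        ≡⟨ split-first k n G ⟩
      ∑ (downFrom N) (λ y → w n y * distinctColumns k n (λ v → G (y ∷ᵥ v))) + distinctColumns (suc k) n G
        ≤⟨ +-mono-≤ (∑-mono (downFrom N) (λ y _ → *-monoˡ (ι≥0 (W n y)) (distinctColumns≤ k n (λ v → G (y ∷ᵥ v)) (λ v → G≥0 (y ∷ᵥ v)))))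
             (distinctColumns≤ (suc k) n G G≥0) ⟩
      ∑ (downFrom N) (λ y → w n y * ∑ (choose k (points n)) (λ v → G (y ∷ᵥ v))) + ∑ (choose (suc k) (points n)) G
        ≡⟨ cong (_+ ∑ (choose (suc k) (points n)) G) (∑-column n (λ y → ∑ (choose k (points n)) (λ v → G (y ∷ᵥ v)))) ⟨
      ∑ (column n) (λ y → ∑ (choose k (points n)) (λ v → G (y ∷ᵥ v))) + ∑ (choose (suc k) (points n)) G
        ≤⟨ ∑-choose-++-suc k (column n) (points n) G G≥0 ⟩
      ∑ (choose (suc k) (column n ++ points n)) G ∎
      where open ≤-Reasoning

    module _ (c : ℚ) (columnSum : ∀ x → x ℕ.< N → ∑ (downFrom N) (w x) ≡ c) where

      length-points : ∀ n → n ℕ.≤ N → ι (length (points n)) ≡ ι n * c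
      length-points n n≤N = begin
        ι (length (points n))                             ≡⟨ *-identityʳ (ι (length (points n))) ⟨
        ι (length (points n)) * 1ℚ                        ≡⟨ ∑-const (points n) 1ℚ ⟨
        ∑ (points n) (λ _ → 1ℚ)                           ≡⟨ ∑-concatMap column (downFrom n) (λ _ → 1ℚ) ⟩
        ∑ (downFrom n) (λ x → ∑ (column x) (λ _ → 1ℚ))    ≡⟨ ∑-cong∈ (downFrom n) (λ x x∈ → trans (∑-column x (λ _ → 1ℚ))
                                                               (trans (∑-cong (downFrom N) (λ y → *-identityʳ (w x y))) (columnSum x (ℕₚ.<-≤-trans (∈-downFrom x∈) n≤N)))) ⟩
        ∑ (downFrom n) (λ _ → c)                          ≡⟨ ∑-const (downFrom n) c ⟩
        ι (length (downFrom n)) * c                       ≡⟨ cong (λ l → ι l * c) (length-downFrom n) ⟩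
        ι n * c                                           ∎
        where open ≡-Reasoning

      private
        power : ℕ → ℚ
        power zero    = 1ℚ
        power (suc k) = c * power k

      ∑-weight : ∀ k (X : Vec ℕ k) → (∀ i → lookup X i ℕ.< N) → ∑ (tuples k (downFrom N)) (weight w X) ≡ power k
      ∑-weight zero    []ᵥ      X<N = +-identityʳ 1ℚ
      ∑-weight (suc k) (x ∷ᵥ X) X<N = begin
        ∑ (tuples (suc k) (downFrom N)) (weight w (x ∷ᵥ X))                         ≡⟨ ∑-tuples k (downFrom N) (weight w (x ∷ᵥ X)) ⟩
        ∑ (downFrom N) (λ y → ∑ (tuples k (downFrom N)) (λ Y → w x y * weight w X Y)) ≡⟨ ∑-product (downFrom N) (tuples k (downFrom N)) (w x) (weight w X) ⟩
        ∑ (downFrom N) (w x) * ∑ (tuples k (downFrom N)) (weight w X)               ≡⟨ cong₂ _*_ (columnSum x (X<N zero)) (∑-weight k X (λ i → X<N (suc i))) ⟩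
        c * power k                                                                 ∎
        where open ≡-Reasoning

      distinctColumns-1 : distinctColumns 4 N (λ _ → 1ℚ) ≡ ι (N C 4) * (c * (c * (c * c)))
      distinctColumns-1 = begin
        distinctColumns 4 N (λ _ → 1ℚ)
          ≡⟨ ∑-cong∈ (choose 4 (downFrom N)) (λ X X∈ → trans (∑-cong (tuples 4 (downFrom N)) (λ Y → *-identityʳ (weight w X Y)))
               (∑-weight 4 X (λ i → ∈-downFrom (∈-choose 4 (downFrom N) X∈ i)))) ⟩
        ∑ (choose 4 (downFrom N)) (λ _ → power 4)
          ≡⟨ ∑-const (choose 4 (downFrom N)) (power 4) ⟩
        ι (length (choose 4 (downFrom N))) * power 4
          ≡⟨ cong₂ (λ l p → ι l * p) (trans (length-choose 4 (downFrom N)) (cong (_C 4) (length-downFrom N))) (cong (λ t → c * (c * (c * t))) (*-identityʳ c)) ⟩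
        ι (N C 4) * (c * (c * (c * c))) ∎
        where open ≡-Reasoning

    distinctColumns-matches : ∀ σ → distinctColumns 4 N (λ v → ⟦ matches σ v ⟧)
      ≡ ∑ (choose 4 (downFrom N)) (λ X → ∑ (choose 4 (downFrom N)) (λ Y → weight w X (permute σ Y)))
    distinctColumns-matches σ = ∑-cong (choose 4 (downFrom N)) (λ X →
      trans (∑-cong (tuples 4 (downFrom N)) (λ Y → *-comm (weight w X Y) ⟦ matches σ Y ⟧)) (∑-matches N σ (weight w X)))

    private
      weight≥0 : ∀ {k} (X Y : Vec ℕ k) → 0ℚ ≤ weight w X Y
      weight≥0 []ᵥ      []ᵥ      = ι≥0 1
      weight≥0 (x ∷ᵥ X) (y ∷ᵥ Y) = *-nonNeg (ι≥0 (W x y)) (weight≥0 X Y)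

      ∈-tuples : ∀ {I : Set} k (xs : List I) {v} → v ∈ tuples k xs → ∀ i → lookup v i ∈ xs
      ∈-tuples (suc k) xs v∈ i with find (∈-concatMap⁻ (λ x → map (x ∷ᵥ_) (tuples k xs)) {xs = xs} v∈)
      ... | x , x∈ , v∈′ with ∈-map⁻ (x ∷ᵥ_) v∈′
      ∈-tuples (suc k) xs v∈ zero    | x , x∈ , v∈′ | u , u∈ , refl = x∈
      ∈-tuples (suc k) xs v∈ (suc i) | x , x∈ , v∈′ | u , u∈ , refl = ∈-tuples k xs u∈ i

    distinctColumns-ties : ∀ u → 0ℚ ≤ u → (∀ {x y} → x ℕ.< N → y ℕ.< N → w x y ≤ u) →
      distinctColumns 4 N ties ≤ ι (N C 4) * ((u * (u * (u * u))) * (ι 16 * ι (N ℕ.^ 3)))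
    distinctColumns-ties u 0≤u w≤u = begin
      distinctColumns 4 N ties
        ≤⟨ ∑-mono (choose 4 (downFrom N)) (λ X X∈ → ∑-mono (tuples 4 (downFrom N)) (λ Y Y∈ → *-monoʳ (ties≥0 Y)
             (weight≤ X Y (λ i → ∈-downFrom (∈-choose 4 (downFrom N) X∈ i)) (λ i → ∈-downFrom (∈-tuples 4 (downFrom N) Y∈ i))))) ⟩
      ∑ (choose 4 (downFrom N)) (λ _ → ∑ (tuples 4 (downFrom N)) (λ Y → power 4 * ties Y))
        ≡⟨ trans (∑-const (choose 4 (downFrom N)) (∑ (tuples 4 (downFrom N)) (λ Y → power 4 * ties Y)))
             (cong₂ (λ l t → ι l * t) (trans (length-choose 4 (downFrom N)) (cong (_C 4) (length-downFrom N))) (∑-*ˡ (tuples 4 (downFrom N)) (power 4) ties)) ⟩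
      ι (N C 4) * (power 4 * ∑ (tuples 4 (downFrom N)) ties)
        ≤⟨ *-monoˡ (ι≥0 (N C 4)) (*-monoˡ power4≥0 (∑-ties N)) ⟩
      ι (N C 4) * (power 4 * (ι 16 * ι (N ℕ.^ 3)))
        ≡⟨ cong (λ t → ι (N C 4) * ((u * (u * (u * t))) * (ι 16 * ι (N ℕ.^ 3)))) (*-identityʳ u) ⟩
      ι (N C 4) * ((u * (u * (u * u))) * (ι 16 * ι (N ℕ.^ 3))) ∎
      where
      open ≤-Reasoning
      power : ℕ → ℚ
      power zero    = 1ℚ
      power (suc k) = u * power k
      weight≤ : ∀ {k} (X Y : Vec ℕ k) → (∀ i → lookup X i ℕ.< N) → (∀ i → lookup Y i ℕ.< N) → weight w X Y ≤ power k
      weight≤ []ᵥ      []ᵥ      X<N Y<N = ≤-refl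
      weight≤ (x ∷ᵥ X) (y ∷ᵥ Y) X<N Y<N = *-mono (ι≥0 (W x y)) (≤-trans (weight≥0 X Y) ih) (w≤u (X<N zero) (Y<N zero)) ih
        where
        ih = weight≤ X Y (λ i → X<N (suc i)) (λ i → Y<N (suc i))
      power4≥0 : 0ℚ ≤ power 4
      power4≥0 = *-nonNeg 0≤u (*-nonNeg 0≤u (*-nonNeg 0≤u (*-nonNeg 0≤u (ι≥0 1))))

  -- Pattern densities in a weighted grid, with explicit error

  density-count : ∀ {k n} (σ : Permutation′ k) (π : Permutation′ n) → 0 ℕ.< n C k → density σ π * ι (n C k) ≡ ι (count σ π)
  density-count {k} {n} σ π 0<C with n C k
  ... | suc m = /-*-cancel (ℤ.+ count σ π) m

  k!*nCk≤n^k : ∀ n k → k ℕ.! ℕ.* n C k ℕ.≤ n ℕ.^ k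
  k!*nCk≤n^k n       zero    = ℕₚ.≤-refl
  k!*nCk≤n^k zero    (suc k) = ℕₚ.≤-reflexive (trans (cong (suc k ℕ.! ℕ.*_) (k>n⇒nCk≡0 {0} {suc k} (ℕ.s≤s ℕ.z≤n))) (ℕₚ.*-zeroʳ (suc k ℕ.!)))
  k!*nCk≤n^k (suc n) (suc k) = begin
    suc k ℕ.* k ℕ.! ℕ.* suc n C suc k        ≡⟨ swap (suc k) (k ℕ.!) (suc n C suc k) ⟩
    k ℕ.! ℕ.* (suc k ℕ.* suc n C suc k)      ≡⟨ cong (k ℕ.! ℕ.*_) (absorption n k) ⟩
    k ℕ.! ℕ.* (suc n ℕ.* n C k)              ≡⟨ swap′ (k ℕ.!) (suc n) (n C k) ⟩
    suc n ℕ.* (k ℕ.! ℕ.* n C k)              ≤⟨ ℕₚ.*-monoʳ-≤ (suc n) (ℕₚ.≤-trans (k!*nCk≤n^k n k) (ℕₚ.^-monoˡ-≤ k (ℕₚ.n≤1+n n))) ⟩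
    suc n ℕ.* suc n ℕ.^ k                    ∎
    where
    open ℕₚ.≤-Reasoning
    swap : ∀ a b c → a ℕ.* b ℕ.* c ≡ b ℕ.* (a ℕ.* c)
    swap = ℕ-solve-∀
    swap′ : ∀ a b c → a ℕ.* (b ℕ.* c) ≡ b ℕ.* (a ℕ.* c)
    swap′ = ℕ-solve-∀

  24*nC4 : ∀ m → 24 ℕ.* (4 ℕ.+ m) C 4 ≡ (4 ℕ.+ m) ℕ.* ((3 ℕ.+ m) ℕ.* ((2 ℕ.+ m) ℕ.* (1 ℕ.+ m)))
  24*nC4 m = begin
    24 ℕ.* (4 ℕ.+ m) C 4                                    ≡⟨ ℕₚ.*-assoc 6 4 ((4 ℕ.+ m) C 4) ⟩
    6 ℕ.* (4 ℕ.* (4 ℕ.+ m) C 4)                             ≡⟨ cong (6 ℕ.*_) (absorption (3 ℕ.+ m) 3) ⟩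
    6 ℕ.* ((4 ℕ.+ m) ℕ.* (3 ℕ.+ m) C 3)                     ≡⟨ pull 2 3 (4 ℕ.+ m) ((3 ℕ.+ m) C 3) ⟩
    (4 ℕ.+ m) ℕ.* (2 ℕ.* (3 ℕ.* (3 ℕ.+ m) C 3))             ≡⟨ cong (λ t → (4 ℕ.+ m) ℕ.* (2 ℕ.* t)) (absorption (2 ℕ.+ m) 2) ⟩
    (4 ℕ.+ m) ℕ.* (2 ℕ.* ((3 ℕ.+ m) ℕ.* (2 ℕ.+ m) C 2))     ≡⟨ cong ((4 ℕ.+ m) ℕ.*_) (swap 2 (3 ℕ.+ m) ((2 ℕ.+ m) C 2)) ⟩
    (4 ℕ.+ m) ℕ.* ((3 ℕ.+ m) ℕ.* (2 ℕ.* (2 ℕ.+ m) C 2))     ≡⟨ cong (λ t → (4 ℕ.+ m) ℕ.* ((3 ℕ.+ m) ℕ.* t)) (absorption (1 ℕ.+ m) 1) ⟩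
    (4 ℕ.+ m) ℕ.* ((3 ℕ.+ m) ℕ.* ((2 ℕ.+ m) ℕ.* (1 ℕ.+ m) C 1)) ≡⟨ cong (λ t → (4 ℕ.+ m) ℕ.* ((3 ℕ.+ m) ℕ.* ((2 ℕ.+ m) ℕ.* t))) (nC1≡n (1 ℕ.+ m)) ⟩
    (4 ℕ.+ m) ℕ.* ((3 ℕ.+ m) ℕ.* ((2 ℕ.+ m) ℕ.* (1 ℕ.+ m))) ∎
    where
    open ≡-Reasoning
    pull : ∀ a b c d → a ℕ.* b ℕ.* (c ℕ.* d) ≡ c ℕ.* (a ℕ.* (b ℕ.* d))
    pull = ℕ-solve-∀
    swap : ∀ a b c → a ℕ.* (b ℕ.* c) ≡ b ℕ.* (a ℕ.* c)
    swap = ℕ-solve-∀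

  ι-^3 : ∀ n → ι (n ℕ.^ 3) ≡ ι n * ι n * ι n
  ι-^3 n = trans (cong ι (cube n)) (trans (ι-* (n ℕ.* n) n) (cong (_* ι n) (ι-* n n)))
    where
    cube : ∀ n → n ℕ.* (n ℕ.* (n ℕ.* 1)) ≡ n ℕ.* n ℕ.* n
    cube = ℕ-solve-∀

  ι-^4 : ∀ n → ι (n ℕ.^ 4) ≡ ι n * (ι n * ι n * ι n)
  ι-^4 n = trans (ι-* n (n ℕ.^ 3)) (cong (ι n *_) (ι-^3 n))

  24nC4≤n⁴ : ∀ n → ι 24 * ι (n C 4) ≤ ι n * (ι n * ι n * ι n)
  24nC4≤n⁴ n = subst₂ _≤_ (ι-* 24 (n C 4)) (ι-^4 n) (ι-mono (k!*nCk≤n^k n 4))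

  n⁴-6n³≤24nC4 : ∀ n → 4 ℕ.≤ n → ι n * (ι n * ι n * ι n) - ι 6 * (ι n * ι n * ι n) ≤ ι 24 * ι (n C 4)
  n⁴-6n³≤24nC4 n 4≤n with ℕₚ.m≤n⇒∃[o]m+o≡n 4≤n
  -- The slack is 11n² - 6n, written in m = n - 4 to be visibly nonnegative.
  ... | m , refl = by-slack (trans (cong₂ (λ s t → s - (t * (t * t * t) - ι 6 * (t * t * t))) product (ι-+ 4 m)) (slack (ι m)))
    (*-nonNeg (+-nonNeg (ι≥0 4) (ι≥0 m)) (+-nonNeg (*-nonNeg (ι≥0 11) (ι≥0 m)) (ι≥0 38)))
    where
    product : ι 24 * ι ((4 ℕ.+ m) C 4) ≡ (ι 4 + ι m) * ((ι 3 + ι m) * ((ι 2 + ι m) * (ι 1 + ι m)))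
    product = begin
      ι 24 * ι ((4 ℕ.+ m) C 4)                                           ≡⟨ ι-* 24 ((4 ℕ.+ m) C 4) ⟨
      ι (24 ℕ.* (4 ℕ.+ m) C 4)                                           ≡⟨ cong ι (24*nC4 m) ⟩
      ι ((4 ℕ.+ m) ℕ.* ((3 ℕ.+ m) ℕ.* ((2 ℕ.+ m) ℕ.* (1 ℕ.+ m))))        ≡⟨ ι-* (4 ℕ.+ m) ((3 ℕ.+ m) ℕ.* ((2 ℕ.+ m) ℕ.* (1 ℕ.+ m))) ⟩
      ι (4 ℕ.+ m) * ι ((3 ℕ.+ m) ℕ.* ((2 ℕ.+ m) ℕ.* (1 ℕ.+ m)))          ≡⟨ cong₂ _*_ (ι-+ 4 m) (ι-* (3 ℕ.+ m) ((2 ℕ.+ m) ℕ.* (1 ℕ.+ m))) ⟩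
      (ι 4 + ι m) * (ι (3 ℕ.+ m) * ι ((2 ℕ.+ m) ℕ.* (1 ℕ.+ m)))          ≡⟨ cong₂ (λ s t → (ι 4 + ι m) * (s * t)) (ι-+ 3 m) (trans (ι-* (2 ℕ.+ m) (1 ℕ.+ m)) (cong₂ _*_ (ι-+ 2 m) (ι-+ 1 m))) ⟩
      (ι 4 + ι m) * ((ι 3 + ι m) * ((ι 2 + ι m) * (ι 1 + ι m)))          ∎
      where open ≡-Reasoning
    slack : ∀ x → (ι 4 + x) * ((ι 3 + x) * ((ι 2 + x) * (ι 1 + x))) - ((ι 4 + x) * ((ι 4 + x) * (ι 4 + x) * (ι 4 + x)) - ι 6 * ((ι 4 + x) * (ι 4 + x) * (ι 4 + x)))
                  ≡ (ι 4 + x) * (ι 11 * x + ι 38)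
    slack = solve-∀ ℚ-ring

  -- Here n = N, m = N³, k = c₀⁴, b = 24 C(N,4), D = 24 C(L,4) for L points, and V = 576 times the
  -- number of occurrences. Up to relative errors of order 1/N, b is nm, D is (nm)²k and V is kb²a,
  -- so V/D, which is 24 times the density, is close to `a`.
  module Estimate {n m k b D V a : ℚ}
    (12≤n : ι 12 ≤ n) (0<m : 0ℚ < m) (0<k : 0ℚ < k) (b≤ : b ≤ n * m) (≤b : n * m - ι 6 * m ≤ b)
    (D≤ : D ≤ n * m * (n * m) * k) (≤D : b * (n * m) * k ≤ D) (0≤a : 0ℚ ≤ a) (a≤2 : a ≤ ι 2) (0≤b : 0ℚ ≤ b)
    (≤V : k * (b * b) * a ≤ V) (V≤ : V ≤ ι 408 * (D - b * (n * m) * k) + k * (b * b) * a + ι 6144 * (b * m * k)) where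

    private
      0≤n : 0ℚ ≤ n
      0≤n = ≤-trans (ι≥0 12) 12≤n
      0≤m = <⇒≤ 0<m
      0≤k = <⇒≤ 0<k
      0≤u = p≤q⇒0≤q-p b≤
      0≤q = p≤q⇒0≤q-p ≤b
      X = n * m * (n * m) * k
      0<X : 0ℚ < X
      0<X = *-pos (*-pos nm nm) 0<k
        where nm = *-pos (<-≤-trans (ι-suc>0 11) 12≤n) 0<m

      -- From n ≥ 12 it follows that nm - 6m, and so b, is at least half of nm.
      X≤2D : X ≤ ι 2 * D
      X≤2D = by-slack (slack n m k b D)
        (+-nonNeg (*-nonNeg (ι≥0 2) (p≤q⇒0≤q-p ≤D))
          (*-nonNeg (*-nonNeg (*-nonNeg 0≤n 0≤m) 0≤k) (+-nonNeg (*-nonNeg (ι≥0 2) 0≤q) (*-nonNeg 0≤m (p≤q⇒0≤q-p 12≤n)))))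
        where
        slack : ∀ n m k b D → ι 2 * D - n * m * (n * m) * k
          ≡ ι 2 * (D - b * (n * m) * k) + n * m * k * (ι 2 * (b - (n * m - ι 6 * m)) + m * (n - ι 12))
        slack = solve-∀ ℚ-ring

    D>0 : 0ℚ < D
    D>0 = *-cancelˡ-<-nonNeg (ι 2) {{nonNegative (ι≥0 2)}} (subst (_< ι 2 * D) (sym (*-zeroʳ (ι 2))) (<-≤-trans 0<X X≤2D))

    -- The loss is at most a(X - kb²), with a ≤ 2, nm - b ≤ 6m and nm + b ≤ 2nm; this is the 24 =
    -- 2·6·2. The final constant is the larger one that `upper` requires.
    lower : (a * D - V) * n ≤ ι 17184 * D
    lower = ≤-trans (by-slack (slack n m k b D V a)
        (*-nonNeg 0≤n (+-nonNeg (+-nonNeg (p≤q⇒0≤q-p ≤V) (*-nonNeg 0≤a (p≤q⇒0≤q-p D≤)))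
          (+-nonNeg (*-nonNeg (*-nonNeg (p≤q⇒0≤q-p a≤2) 0≤k) (*-nonNeg 0≤u (+-nonNeg (*-nonNeg 0≤n 0≤m) 0≤b)))
            (*-nonNeg (*-nonNeg (ι≥0 2) 0≤k) (+-nonNeg (*-nonNeg (*-nonNeg (ι≥0 2) (*-nonNeg 0≤n 0≤m)) 0≤q) (*-nonNeg 0≤u 0≤u)))))))
      (≤-trans (*-monoˡ (ι≥0 24) X≤2D) (by-slack (const D) (*-nonNeg (ι≥0 17136) (<⇒≤ D>0))))
      where
      const : ∀ D → ι 17184 * D - ι 24 * (ι 2 * D) ≡ ι 17136 * D
      const = solve-∀ ℚ-ring
      slack : ∀ n m k b D V a → ι 24 * (n * m * (n * m) * k) - (a * D - V) * n
        ≡ n * ((V - k * (b * b) * a) + a * (n * m * (n * m) * k - D)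
            + ((ι 2 - a) * k * ((n * m - b) * (n * m + b)) + ι 2 * k * (ι 2 * (n * m) * (b - (n * m - ι 6 * m)) + (n * m - b) * (n * m - b))))
      slack = solve-∀ ℚ-ring

    -- 8592 = 408·6 + 6144: the first summand comes from 4-subsets with two points in a column, the
    -- second from ties. Passing from X to 2D doubles it to 17184.
    upper : (V - a * D) * n ≤ ι 17184 * D
    upper = ≤-trans (by-slack (slack n m k b D V a)
        (*-nonNeg 0≤n (+-nonNeg (+-nonNeg (+-nonNeg (p≤q⇒0≤q-p V≤) (*-nonNeg (ι≥0 408) (p≤q⇒0≤q-p D≤)))
          (*-nonNeg 0≤k (+-nonNeg (*-nonNeg (ι≥0 408) (*-nonNeg (*-nonNeg 0≤n 0≤m) 0≤q)) (*-nonNeg (ι≥0 6144) (*-nonNeg 0≤m 0≤u)))))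
          (*-nonNeg 0≤a (+-nonNeg (p≤q⇒0≤q-p ≤D) (*-nonNeg (*-nonNeg 0≤k 0≤b) 0≤u))))))
      (≤-trans (*-monoˡ (ι≥0 8592) X≤2D) (≤-reflexive (sym (*-assoc (ι 8592) (ι 2) D))))
      where
      slack : ∀ n m k b D V a → ι 8592 * (n * m * (n * m) * k) - (V - a * D) * n
        ≡ n * ((ι 408 * (D - b * (n * m) * k) + k * (b * b) * a + ι 6144 * (b * m * k) - V) + ι 408 * (n * m * (n * m) * k - D)
            + k * (ι 408 * (n * m * (b - (n * m - ι 6 * m))) + ι 6144 * (m * (n * m - b)))
            + a * ((D - b * (n * m) * k) + k * b * (n * m - b)))
      slack = solve-∀ ℚ-ring

  -- The cell weights imitate a permuton of density 1 + h. They lie between 0 and 2c₀, and the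
  -- vanishing sums of h give every column the same weight c₀N, so the number of points and the
  -- number of 4-subsets in distinct columns are known exactly.
  module WeightedGrid (N : ℕ) (12≤N : 12 ℕ.≤ N) (W : ℕ → ℕ → ℕ) (c₀ : ℚ) (0<c₀ : 0ℚ < c₀) (h : ℕ → ℕ → ℚ)
    (W≡ : ∀ {x y} → x ℕ.< N → y ℕ.< N → ι (W x y) ≡ c₀ * (1ℚ + h x y))
    (∣h∣≤1 : ∀ {x y} → x ℕ.< N → y ℕ.< N → ∣ h x y ∣ ≤ 1ℚ)
    (h-sum : ∀ x → ∑ (downFrom N) (h x) ≡ 0ℚ) where

    open Points N W

    P : List ℕ
    P = points N

    π : Permutation′ (length P)
    π = proj₁ (sortingPermutation P)

    private
      n = ι N
      m = n * n * n
      c = c₀ * n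
      k = c₀ * (c₀ * (c₀ * c₀))
      β = ι (N C 4)
      w : ℕ → ℕ → ℚ
      w x y = ι (W x y)

      0<n : 0ℚ < n
      0<n = <-≤-trans (ι-suc>0 11) (ι-mono 12≤N)

      columnSum : ∀ x → x ℕ.< N → ∑ (downFrom N) (w x) ≡ c
      columnSum x x<N = begin
        ∑ (downFrom N) (w x)                              ≡⟨ ∑-cong∈ (downFrom N) (λ y y∈ → W≡ x<N (∈-downFrom y∈)) ⟩
        ∑ (downFrom N) (λ y → c₀ * (1ℚ + h x y))          ≡⟨ ∑-*ˡ (downFrom N) c₀ (λ y → 1ℚ + h x y) ⟩
        c₀ * ∑ (downFrom N) (λ y → 1ℚ + h x y)            ≡⟨ cong (c₀ *_) (∑-+ (downFrom N) (λ _ → 1ℚ) (h x)) ⟩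
        c₀ * (∑ (downFrom N) (λ _ → 1ℚ) + ∑ (downFrom N) (h x)) ≡⟨ cong₂ (λ s t → c₀ * (s + t)) (trans (∑-const (downFrom N) 1ℚ) (trans (*-identityʳ (ι (length (downFrom N)))) (cong ι (length-downFrom N)))) (h-sum x) ⟩
        c₀ * (n + 0ℚ)                                     ≡⟨ cong (c₀ *_) (+-identityʳ n) ⟩
        c₀ * n                                            ∎
        where open ≡-Reasoning

    ιlength : ι (length P) ≡ ι N * (c₀ * ι N)
    ιlength = length-points c columnSum N ℕₚ.≤-refl

    private
      power : ℕ → ℚ
      power zero    = 1ℚ
      power (suc j) = c₀ * power j

      weight≡ : ∀ {j} (X Y : Vec ℕ j) → (∀ i → lookup X i ℕ.< N) → (∀ i → lookup Y i ℕ.< N) →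
                weight w X Y ≡ power j * ∏[1+ Vec.zipWith h X Y ]
      weight≡ []ᵥ      []ᵥ      X<N Y<N = refl
      weight≡ {suc j} (x ∷ᵥ X) (y ∷ᵥ Y) X<N Y<N = trans
        (cong₂ _*_ (W≡ (X<N zero) (Y<N zero)) (weight≡ X Y (λ i → X<N (suc i)) (λ i → Y<N (suc i))))
        (regroup c₀ (1ℚ + h x y) (power j) ∏[1+ Vec.zipWith h X Y ])
        where
        regroup : ∀ a b c d → a * b * (c * d) ≡ a * c * (b * d)
        regroup = solve-∀ ℚ-ring

      total : ι (length P C 4) ≡ ∑ (choose 4 P) (λ _ → 1ℚ)
      total = sym (trans (∑-const (choose 4 P) 1ℚ) (trans (*-identityʳ (ι (length (choose 4 P)))) (cong ι (length-choose 4 P))))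

      D≤ : ι 24 * ι (length P C 4) ≤ n * m * (n * m) * k
      D≤ = subst (ι 24 * ι (length P C 4) ≤_) (trans (cong (λ t → t * (t * t * t)) ιlength) (regroup n c₀)) (24nC4≤n⁴ (length P))
        where
        regroup : ∀ n c → n * (c * n) * (n * (c * n) * (n * (c * n)) * (n * (c * n)))
                          ≡ n * (n * n * n) * (n * (n * n * n)) * (c * (c * (c * c)))
        regroup = solve-∀ ℚ-ring

      ones : distinctColumns 4 N (λ _ → 1ℚ) ≡ β * (n * m) * k
      ones = trans (distinctColumns-1 c columnSum) (regroup β n c₀)
        where
        regroup : ∀ b n c → b * (c * n * (c * n * (c * n * (c * n)))) ≡ b * (n * (n * n * n)) * (c * (c * (c * c)))
        regroup = solve-∀ ℚ-ring

      β≤ : β * (n * m) * k ≤ ι (length P C 4)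
      β≤ = subst₂ _≤_ ones (sym total) (distinctColumns≤ 4 N (λ _ → 1ℚ) (λ _ → ι≥0 1))

      distinctColumns-slack : ∀ s t → distinctColumns 4 N (λ v → ι 17 - (s v + t v))
                              ≡ ι 17 * distinctColumns 4 N (λ _ → 1ℚ) - (distinctColumns 4 N s + distinctColumns 4 N t)
      distinctColumns-slack s t = begin
        ∑ Xs (λ X → ∑ Ys (λ Y → weight w X Y * (ι 17 - (s Y + t Y))))
          ≡⟨ ∑-cong Xs (λ X → trans (∑-cong Ys (λ Y → distrib (weight w X Y) (s Y) (t Y)))
               (trans (∑-- Ys (λ Y → ι 17 * (weight w X Y * 1ℚ)) (λ Y → weight w X Y * s Y + weight w X Y * t Y))
                 (cong₂ _-_ (∑-*ˡ Ys (ι 17) (λ Y → weight w X Y * 1ℚ)) (∑-+ Ys (λ Y → weight w X Y * s Y) (λ Y → weight w X Y * t Y))))) ⟩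
        ∑ Xs (λ X → ι 17 * ∑ Ys (λ Y → weight w X Y * 1ℚ) - (∑ Ys (λ Y → weight w X Y * s Y) + ∑ Ys (λ Y → weight w X Y * t Y)))
          ≡⟨ ∑-- Xs (λ X → ι 17 * ∑ Ys (λ Y → weight w X Y * 1ℚ)) (λ X → ∑ Ys (λ Y → weight w X Y * s Y) + ∑ Ys (λ Y → weight w X Y * t Y)) ⟩
        ∑ Xs (λ X → ι 17 * ∑ Ys (λ Y → weight w X Y * 1ℚ)) - ∑ Xs (λ X → ∑ Ys (λ Y → weight w X Y * s Y) + ∑ Ys (λ Y → weight w X Y * t Y))
          ≡⟨ cong₂ _-_ (∑-*ˡ Xs (ι 17) (λ X → ∑ Ys (λ Y → weight w X Y * 1ℚ))) (∑-+ Xs (λ X → ∑ Ys (λ Y → weight w X Y * s Y)) (λ X → ∑ Ys (λ Y → weight w X Y * t Y))) ⟩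
        ι 17 * distinctColumns 4 N (λ _ → 1ℚ) - (distinctColumns 4 N s + distinctColumns 4 N t) ∎
        where
        open ≡-Reasoning
        Xs = choose 4 (downFrom N)
        Ys = tuples 4 (downFrom N)
        distrib : ∀ w s t → w * (ι 17 - (s + t)) ≡ ι 17 * (w * 1ℚ) - (w * s + w * t)
        distrib = solve-∀ ℚ-ring

    module _ (σ : Permutation′ 4) (a : ℚ) (0≤a : 0ℚ ≤ a) (a≤2 : a ≤ ι 2)
      (main : ∑ (choose 4 (downFrom N)) (λ X → ∑ (choose 4 (downFrom N)) (λ Y → ∏[1+ Vec.zipWith h X (permute σ Y) ])) ≡ β * β * a) where

      private
        matches-sum : distinctColumns 4 N (λ v → ⟦ matches σ v ⟧) ≡ k * (β * β) * a
        matches-sum = begin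
          distinctColumns 4 N (λ v → ⟦ matches σ v ⟧)
            ≡⟨ distinctColumns-matches σ ⟩
          ∑ Xs (λ X → ∑ Xs (λ Y → weight w X (permute σ Y)))
            ≡⟨ ∑-cong∈ Xs (λ X X∈ → trans (∑-cong∈ Xs (λ Y Y∈ → weight≡ X (permute σ Y) (below X∈) (λ i → subst (ℕ._< N) (sym (lookup∘tabulate (λ i → lookup Y (σ ⟨$⟩ʳ i)) i)) (below Y∈ (σ ⟨$⟩ʳ i)))))
                 (∑-*ˡ Xs (power 4) (λ Y → ∏[1+ Vec.zipWith h X (permute σ Y) ]))) ⟩
          ∑ Xs (λ X → power 4 * ∑ Xs (λ Y → ∏[1+ Vec.zipWith h X (permute σ Y) ]))
            ≡⟨ ∑-*ˡ Xs (power 4) (λ X → ∑ Xs (λ Y → ∏[1+ Vec.zipWith h X (permute σ Y) ])) ⟩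
          power 4 * ∑ Xs (λ X → ∑ Xs (λ Y → ∏[1+ Vec.zipWith h X (permute σ Y) ]))
            ≡⟨ cong₂ _*_ (cong (λ t → c₀ * (c₀ * (c₀ * t))) (*-identityʳ c₀)) main ⟩
          k * (β * β * a)
            ≡⟨ *-assoc k (β * β) a ⟨
          k * (β * β) * a ∎
          where
          open ≡-Reasoning
          Xs = choose 4 (downFrom N)
          below : ∀ {X : Vec ℕ 4} → X ∈ Xs → ∀ i → lookup X i ℕ.< N
          below X∈ i = ∈-downFrom (∈-choose 4 (downFrom N) X∈ i)

        sorts = proj₂ (sortingPermutation P)
        S = λ (v : Vec ℕ 4) → ⟦ matches σ v ⟧

        count≥ : k * (β * β) * a ≤ ι (count σ π)
        count≥ = ≤-trans (≤-reflexive (sym matches-sum)) (≤-trans (distinctColumns≤ 4 N S (λ v → ⟦⟧≥0 (matches σ v))) (count-lower σ P π sorts))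

        ties-sum : distinctColumns 4 N ties ≤ β * (ι 256 * (m * k))
        ties-sum = subst (distinctColumns 4 N ties ≤_) (trans (cong (λ t → β * ((u * (u * (u * u))) * (ι 16 * t))) (ι-^3 N)) (regroup β c₀ m))
          (distinctColumns-ties u (*-nonNeg (<⇒≤ 0<c₀) (ι≥0 2)) w≤u)
          where
          -- Since 1 + h ≤ 2. Four such factors and the 16 ordered pairs give the 256.
          u = c₀ * ι 2
          w≤u : ∀ {x y} → x ℕ.< N → y ℕ.< N → w x y ≤ u
          w≤u {x} {y} x<N y<N = subst (_≤ u) (sym (W≡ x<N y<N)) (*-monoˡ (<⇒≤ 0<c₀) (+-monoʳ-≤ 1ℚ (≤-trans (p≤∣p∣ (h x y)) (∣h∣≤1 x<N y<N))))
          regroup : ∀ b c m → b * ((c * ι 2 * (c * ι 2 * (c * ι 2 * (c * ι 2)))) * (ι 16 * m)) ≡ b * (ι 256 * (m * (c * (c * (c * c)))))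
          regroup = solve-∀ ℚ-ring

        -- `distinctColumns≤` bounds from below only. It is applied to 17 minus the function in
        -- question, which is nonnegative because a match contributes at most 1 and ties at most 16;
        -- the price is 17 for each 4-subset with a repeated column.
        count≤ : ι (count σ π) ≤ ι 17 * (ι (length P C 4) - β * (n * m) * k) + k * (β * β) * a + β * (ι 256 * (m * k))
        count≤ = begin
          ι (count σ π)
            ≤⟨ count-upper σ P π sorts ⟩
          ∑ (choose 4 P) (λ v → S v + ties v)
            ≡⟨ complement ⟩
          ι 17 * ι (length P C 4) - ∑ (choose 4 P) (λ v → ι 17 - (S v + ties v))
            ≤⟨ +-monoʳ-≤ (ι 17 * ι (length P C 4)) (neg-antimono-≤ (distinctColumns≤ 4 N (λ v → ι 17 - (S v + ties v))
                 (λ v → p≤q⇒0≤q-p (+-mono-≤ (⟦⟧≤1 (matches σ v)) (ties≤16 v))))) ⟩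
          ι 17 * ι (length P C 4) - distinctColumns 4 N (λ v → ι 17 - (S v + ties v))
            ≡⟨ cong (λ t → ι 17 * ι (length P C 4) - t) (trans (distinctColumns-slack S ties) (cong₂ (λ s t → ι 17 * s - (t + distinctColumns 4 N ties)) ones matches-sum)) ⟩
          ι 17 * ι (length P C 4) - (ι 17 * (β * (n * m) * k) - (k * (β * β) * a + distinctColumns 4 N ties))
            ≡⟨ regroup (ι (length P C 4)) (β * (n * m) * k) (k * (β * β) * a) (distinctColumns 4 N ties) ⟩
          ι 17 * (ι (length P C 4) - β * (n * m) * k) + k * (β * β) * a + distinctColumns 4 N ties
            ≤⟨ +-monoʳ-≤ (ι 17 * (ι (length P C 4) - β * (n * m) * k) + k * (β * β) * a) ties-sum ⟩
          ι 17 * (ι (length P C 4) - β * (n * m) * k) + k * (β * β) * a + β * (ι 256 * (m * k)) ∎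
          where
          open ≤-Reasoning
          regroup : ∀ A B C D → ι 17 * A - (ι 17 * B - (C + D)) ≡ ι 17 * (A - B) + C + D
          regroup = solve-∀ ℚ-ring
          cancel : ∀ A B → B ≡ A - (A - B)
          cancel = solve-∀ ℚ-ring
          complement : ∑ (choose 4 P) (λ v → S v + ties v) ≡ ι 17 * ι (length P C 4) - ∑ (choose 4 P) (λ v → ι 17 - (S v + ties v))
          complement = trans (cancel (ι 17 * ι (length P C 4)) (∑ (choose 4 P) (λ v → S v + ties v)))
            (cong (λ t → ι 17 * ι (length P C 4) - t) (sym (trans (∑-- (choose 4 P) (λ _ → ι 17) (λ v → S v + ties v))
              (cong (λ t → t - ∑ (choose 4 P) (λ v → S v + ties v)) (trans (∑-const (choose 4 P) (ι 17)) (trans (*-comm (ι (length (choose 4 P))) (ι 17)) (cong (λ l → ι 17 * ι l) (length-choose 4 P))))))))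

        b = ι 24 * β
        D = ι 24 * ι (length P C 4)
        V = ι 576 * ι (count σ π)

        ≤D : b * (n * m) * k ≤ D
        ≤D = subst (_≤ D) (regroup β (n * m) k) (*-monoˡ (ι≥0 24) β≤)
          where
          regroup : ∀ b x k → ι 24 * (b * x * k) ≡ ι 24 * b * x * k
          regroup = solve-∀ ℚ-ring

        ≤V : k * (b * b) * a ≤ V
        ≤V = subst (_≤ V) (regroup k β a) (*-monoˡ (ι≥0 576) count≥)
          where
          regroup : ∀ k b a → ι 576 * (k * (b * b) * a) ≡ k * (ι 24 * b * (ι 24 * b)) * a
          regroup = solve-∀ ℚ-ring

        V≤ : V ≤ ι 408 * (D - b * (n * m) * k) + k * (b * b) * a + ι 6144 * (b * m * k)
        V≤ = subst (V ≤_) (regroup (ι (length P C 4)) β (n * m) k a m) (*-monoˡ (ι≥0 576) count≤)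
          where
          regroup : ∀ C b x k a m → ι 576 * (ι 17 * (C - b * x * k) + k * (b * b) * a + b * (ι 256 * (m * k)))
            ≡ ι 408 * (ι 24 * C - ι 24 * b * x * k) + k * (ι 24 * b * (ι 24 * b)) * a + ι 6144 * (ι 24 * b * m * k)
          regroup = solve-∀ ℚ-ring

        module E = Estimate {n} {m} {k} {b} {D} {V} {a} (ι-mono 12≤N) (*-pos (*-pos 0<n 0<n) 0<n)
          (*-pos 0<c₀ (*-pos 0<c₀ (*-pos 0<c₀ 0<c₀))) (24nC4≤n⁴ N) (n⁴-6n³≤24nC4 N (ℕₚ.≤-trans (ℕₚ.m≤n+m 4 8) 12≤N)) D≤ ≤D 0≤a a≤2
          (*-nonNeg (ι≥0 24) (ι≥0 (N C 4))) ≤V V≤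

        0<lengthPC4 : 0 ℕ.< length P C 4
        0<lengthPC4 = positive-multiple (length P C 4) E.D>0
          where
          positive-multiple : ∀ j → 0ℚ < ι 24 * ι j → 0 ℕ.< j
          positive-multiple zero    0<0 = ⊥-elim (<-irrefl refl 0<0)
          positive-multiple (suc j) _   = ℕ.s≤s ℕ.z≤n

        V≡ : ι 24 * density σ π * D ≡ V
        V≡ = trans (regroup (density σ π) (ι (length P C 4))) (cong (ι 576 *_) (density-count σ π 0<lengthPC4))
          where
          regroup : ∀ d C → ι 24 * d * (ι 24 * C) ≡ ι 576 * (d * C)
          regroup = solve-∀ ℚ-ring

      density-estimate : ∣ ι 24 * density σ π - a ∣ * ι N ≤ ι 17184
      density-estimate = *-cancelʳ-≤ E.D>0 (subst (_≤ ι 17184 * D) (sym (trans (cong (λ t → ∣ ι 24 * density σ π - a ∣ * t * D) (sym (0≤p⇒∣p∣≡p (<⇒≤ 0<n))))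
        (trans (cong₂ _*_ (sym (∣p*q∣≡∣p∣*∣q∣ (ι 24 * density σ π - a) n)) (sym (0≤p⇒∣p∣≡p (<⇒≤ E.D>0)))) (sym (∣p*q∣≡∣p∣*∣q∣ ((ι 24 * density σ π - a) * n) D)))))
        (∣p∣≤ (subst (_≤ ι 17184 * D) up E.upper) (subst (_≤ ι 17184 * D) low E.lower)))
        where
        up : (V - a * D) * n ≡ (ι 24 * density σ π - a) * n * D
        up = trans (cong (λ t → (t - a * D) * n) (sym V≡)) (regroup (ι 24 * density σ π) a D n)
          where
          regroup : ∀ d a D n → (d * D - a * D) * n ≡ (d - a) * n * D
          regroup = solve-∀ ℚ-ring
        low : (a * D - V) * n ≡ - ((ι 24 * density σ π - a) * n * D)
        low = trans (cong (λ t → (a * D - t) * n) (sym V≡)) (regroup (ι 24 * density σ π) a D n)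
          where
          regroup : ∀ d a D n → (a * D - d * D) * n ≡ - ((d - a) * n * D)
          regroup = solve-∀ ℚ-ring

  -- Perturbations of the uniform permuton

  ∑-tabulate : ∀ {n} {I : Set} (f : Fin n → I) (g : I → ℚ) → ∑ (tabulate f) g ≡ ∑ (allFin n) (g ∘ f)
  ∑-tabulate {n} f g = trans (cong (λ l → ∑ l g) (sym (map-tabulate (λ i → i) f))) (∑-map f (allFin n) g)

  ∑-δ : ∀ n (g : Fin n → ℚ) t → ∑ (allFin n) (λ i → g i * δ i t) ≡ g t
  ∑-δ (suc n) g zero = trans (cong₂ _+_ (*-identityʳ (g zero)) (trans (∑-tabulate suc (λ i → g i * δ i zero))
    (trans (∑-cong (allFin n) (λ i → *-zeroʳ (g (suc i)))) (trans (∑-const (allFin n) 0ℚ) (*-zeroʳ (ι (length (allFin n)))))))) (+-identityʳ (g zero))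
  ∑-δ (suc n) g (suc t) = trans (cong₂ _+_ (*-zeroʳ (g zero)) (trans (∑-tabulate suc (λ i → g i * δ i (suc t))) (∑-δ n (g ∘ suc) t))) (+-identityˡ (g (suc t)))

  -- Stated for any predicate preserved under multiples so that it can be nested: over `y` for fixed
  -- `x`, and then over `x`.
  commonMultiple : (Q : ℕ → ℕ → Set) → (∀ x d e → Q x d → Q x (e ℕ.* d)) → (∀ x → ∃ λ d → 0 ℕ.< d × Q x d) →
                   ∀ n → ∃ λ d → 0 ℕ.< d × (∀ x → x ℕ.< n → Q x d)
  commonMultiple Q closed exist zero    = 1 , ℕ.s≤s ℕ.z≤n , λ _ ()
  commonMultiple Q closed exist (suc n) with commonMultiple Q closed exist n | exist n
  ... | d , 0<d , Qd | e , 0<e , Qe = e ℕ.* d , ℕₚ.*-mono-< 0<e 0<d , both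
    where
    both : ∀ x → x ℕ.< suc n → Q x (e ℕ.* d)
    both x x<1+n with x ℕ.≟ n
    ... | yes refl = subst (Q n) (ℕₚ.*-comm d e) (closed n e d Qe)
    ... | no  x≢n  = closed x d e (Qd x (ℕₚ.≤∧≢⇒< (ℕₚ.≤-pred x<1+n) x≢n))

  -- Absolute values give natural numerators for an arbitrary `g`. They disappear in the
  -- application, where `g` is 1 + h with h of size at most 1 on the grid.
  commonDenominator : ∀ (g : ℕ → ℕ → ℚ) N → ∃ λ d → 0 ℕ.< d ×
    ∃ λ (W : ℕ → ℕ → ℕ) → ∀ {x y} → x ℕ.< N → y ℕ.< N → ι (W x y) ≡ ι d * ∣ g x y ∣
  commonDenominator g N = d , 0<d , W , W≡
    where
    Integral : ℚ → ℕ → Set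
    Integral q d = ∃ λ w → ι w ≡ ι d * ∣ q ∣

    closed : ∀ q d e → Integral q d → Integral q (e ℕ.* d)
    closed q d e (w , eq) = e ℕ.* w , trans (ι-* e w) (trans (cong (ι e *_) eq) (trans (sym (*-assoc (ι e) (ι d) ∣ q ∣)) (cong (_* ∣ q ∣) (sym (ι-* e d)))))

    single : ∀ q → ∃ λ d → 0 ℕ.< d × Integral q d
    single q with ∣ q ∣ | 0≤∣p∣ q
    ... | p@(mkℚ (ℤ.+ a) b _) | _ = suc b , ℕ.s≤s ℕ.z≤n , a ,
      sym (trans (*-comm (ι (suc b)) p) (trans (cong (_* ι (suc b)) (sym (↥p/↧p≡p p))) (/-*-cancel (ℤ.+ a) b)))
    ... | mkℚ ℤ.-[1+ a ] b _ | *≤* ()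

    common = commonMultiple (λ x d → ∀ y → y ℕ.< N → Integral (g x y) d) (λ x d e Q y y<N → closed (g x y) d e (Q y y<N))
      (λ x → commonMultiple (λ y → Integral (g x y)) (λ y → closed (g x y)) (λ y → single (g x y)) N) N

    d = proj₁ common
    0<d = proj₁ (proj₂ common)

    value : ∀ {x y} → Dec (x ℕ.< N) → Dec (y ℕ.< N) → ℕ
    value {x} {y} (yes x<N) (yes y<N) = proj₁ (proj₂ (proj₂ common) x x<N y y<N)
    -- A default outside the grid; `points N` reads only cells inside it.
    value (yes _) (no _) = 0
    value (no _)  _      = 0

    value≡ : ∀ {x y} (x<?N : Dec (x ℕ.< N)) (y<?N : Dec (y ℕ.< N)) → x ℕ.< N → y ℕ.< N → ι (value x<?N y<?N) ≡ ι d * ∣ g x y ∣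
    value≡ {x} {y} (yes x<N) (yes y<N) _   _   = proj₂ (proj₂ (proj₂ common) x x<N y y<N)
    value≡         (yes _)   (no y≮N)  _   y<N = ⊥-elim (y≮N y<N)
    value≡         (no x≮N)  _         x<N _   = ⊥-elim (x≮N x<N)

    W : ℕ → ℕ → ℕ
    W x y = value (x ℕ.<? N) (y ℕ.<? N)

    W≡ : ∀ {x y} → x ℕ.< N → y ℕ.< N → ι (W x y) ≡ ι d * ∣ g x y ∣
    W≡ {x} {y} = value≡ (x ℕ.<? N) (y ℕ.<? N)

  ι-cancel-≤ : ∀ {m n} → ι m ≤ ι n → m ℕ.≤ n
  ι-cancel-≤ {m} {n} le with m ℕ.≤? n
  ... | yes m≤n = m≤n
  ... | no  m≰n = ⊥-elim (<-irrefl refl (<-≤-trans (subst₂ _<_ (+-identityˡ (ι n)) (sym (ι-+ 1 n)) (+-monoˡ-< (ι n) (ι-suc>0 0)))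
    (≤-trans (ι-mono (ℕₚ.≰⇒> m≰n)) le)))

  sumᵥ-lookup : ∀ {k} (v : Vec ℚ k) → sumᵥ v ≡ ∑ (allFin k) (lookup v)
  sumᵥ-lookup []ᵥ      = refl
  sumᵥ-lookup (h ∷ᵥ v) = cong (h +_) (trans (sumᵥ-lookup v) (sym (∑-tabulate suc (lookup (h ∷ᵥ v)))))

  remainder-zero : ∀ {k} (v : Vec ℚ k) → (∀ i → lookup v i ≡ 0ℚ) → remainder v ≡ 0ℚ
  remainder-zero []ᵥ      v≡0 = refl
  remainder-zero (h ∷ᵥ v) v≡0 = trans (cong₂ _+_ (remainder-zero v (λ i → v≡0 (suc i))) (trans (cong (_* (∏[1+ v ] - 1ℚ)) (v≡0 zero)) (*-zeroˡ (∏[1+ v ] - 1ℚ)))) (+-identityʳ 0ℚ)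

  module Perturbation {r : ℕ} (B : Fin r → Fin 4 → Fin 4 → ℚ) (rowSum : ∀ j p → ∑ (allFin 4) (B j p) ≡ 0ℚ) where

    private
      absSum : ℚ
      absSum = ∑ (allFin r) (λ j → ∑ (allFin 4) (λ p → ∑ (allFin 4) (λ q → ∣ B j p q ∣)))

      absSum≥0 : 0ℚ ≤ absSum
      absSum≥0 = ∑-nonNeg (allFin r) (λ j → ∑-nonNeg (allFin 4) (λ p → ∑-nonNeg (allFin 4) (λ q → 0≤∣p∣ (B j p q))))

    -- Bounds `h` for coefficients of size at most 1, with a factor 346 for each of the two dual
    -- functions in a product; it is the same for all grids. The added 1 ensures κ ≥ 1, which is
    -- used to make the radius `s` at most 1.
    κ : ℚ
    κ = absSum * (ι 346 * ι 346) + 1ℚ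

    1≤κ : 1ℚ ≤ κ
    1≤κ = subst (_≤ κ) (+-identityˡ 1ℚ) (+-monoˡ-≤ 1ℚ (*-nonNeg absSum≥0 (*-nonNeg (ι≥0 346) (ι≥0 346))))

    module Grid (N : ℕ) (4≤N : 4 ℕ.≤ N) where

      open DualBasis N 4≤N

      private
        kernel : Fin r → ℕ → ℕ → ℚ
        kernel j x y = ∑ (allFin 4) (λ p → ∑ (allFin 4) (λ q → B j p q * (f p x * f q y)))

      h : (Fin r → ℚ) → ℕ → ℕ → ℚ
      h z x y = ∑ (allFin r) (λ j → z j * kernel j x y)

      h-bound : ∀ {z s} → (∀ j → ∣ z j ∣ ≤ s) → 0ℚ ≤ s → ∀ {x y} → x ℕ.< N → y ℕ.< N → ∣ h z x y ∣ ≤ s * κ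
      h-bound {z} {s} z≤s 0≤s {x} {y} x<N y<N = begin
        ∣ h z x y ∣
          ≤⟨ ∑-∣∣ (allFin r) (λ j → z j * kernel j x y) ⟩
        ∑ (allFin r) (λ j → ∣ z j * kernel j x y ∣)
          ≤⟨ ∑-mono (allFin r) (λ j _ → ∣*∣≤ {z j} {kernel j x y} (z≤s j) (kernel≤ j)) ⟩
        ∑ (allFin r) (λ j → s * (∑ (allFin 4) (λ p → ∑ (allFin 4) (λ q → ∣ B j p q ∣)) * (ι 346 * ι 346)))
          ≡⟨ trans (∑-*ˡ (allFin r) s _) (cong (s *_) (∑-*ʳ (allFin r) (ι 346 * ι 346) (λ j → ∑ (allFin 4) (λ p → ∑ (allFin 4) (λ q → ∣ B j p q ∣))))) ⟩
        s * (absSum * (ι 346 * ι 346))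
          ≤⟨ *-monoˡ 0≤s (subst (_≤ κ) (+-identityʳ (absSum * (ι 346 * ι 346))) (+-monoʳ-≤ (absSum * (ι 346 * ι 346)) (ι≥0 1))) ⟩
        s * κ ∎
        where
        open ≤-Reasoning
        kernel≤ : ∀ j → ∣ kernel j x y ∣ ≤ ∑ (allFin 4) (λ p → ∑ (allFin 4) (λ q → ∣ B j p q ∣)) * (ι 346 * ι 346)
        kernel≤ j = begin
          ∣ kernel j x y ∣
            ≤⟨ ∑-∣∣ (allFin 4) (λ p → ∑ (allFin 4) (λ q → B j p q * (f p x * f q y))) ⟩
          ∑ (allFin 4) (λ p → ∣ ∑ (allFin 4) (λ q → B j p q * (f p x * f q y)) ∣)
            ≤⟨ ∑-mono (allFin 4) (λ p _ → ∑-∣∣ (allFin 4) (λ q → B j p q * (f p x * f q y))) ⟩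
          ∑ (allFin 4) (λ p → ∑ (allFin 4) (λ q → ∣ B j p q * (f p x * f q y) ∣))
            ≤⟨ ∑-mono (allFin 4) (λ p _ → ∑-mono (allFin 4) (λ q _ →
                 ∣*∣≤ {B j p q} {f p x * f q y} ≤-refl (∣*∣≤ {f p x} {f q y} (f-bound p x<N) (f-bound q y<N)))) ⟩
          ∑ (allFin 4) (λ p → ∑ (allFin 4) (λ q → ∣ B j p q ∣ * (ι 346 * ι 346)))
            ≡⟨ trans (∑-cong (allFin 4) (λ p → ∑-*ʳ (allFin 4) (ι 346 * ι 346) (λ q → ∣ B j p q ∣)))
                 (∑-*ʳ (allFin 4) (ι 346 * ι 346) (λ p → ∑ (allFin 4) (λ q → ∣ B j p q ∣))) ⟩
          ∑ (allFin 4) (λ p → ∑ (allFin 4) (λ q → ∣ B j p q ∣)) * (ι 346 * ι 346) ∎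

      h-minus : ∀ y z a b → h y a b - h z a b ≡ h (λ j → y j - z j) a b
      h-minus y z a b = trans (sym (∑-- (allFin r) (λ j → y j * kernel j a b) (λ j → z j * kernel j a b)))
        (∑-cong (allFin r) (λ j → distrib (y j) (z j) (kernel j a b)))
        where
        distrib : ∀ a b c → a * c - b * c ≡ (a - b) * c
        distrib = solve-∀ ℚ-ring

      h-zero : ∀ x y → h (λ _ → 0ℚ) x y ≡ 0ℚ
      h-zero x y = trans (∑-*ˡ (allFin r) 0ℚ (λ j → kernel j x y)) (*-zeroˡ (∑ (allFin r) (λ j → kernel j x y)))

      -- All `f q` have the same sum over the grid, so summing over `y` leaves multiples of row sums
      -- of the matrices `B j`.
      h-sum : ∀ z x → ∑ (downFrom N) (h z x) ≡ 0ℚ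
      h-sum z x = begin
        ∑ (downFrom N) (h z x)
          ≡⟨ ∑-swap (downFrom N) (allFin r) (λ y j → z j * kernel j x y) ⟩
        ∑ (allFin r) (λ j → ∑ (downFrom N) (λ y → z j * kernel j x y))
          ≡⟨ ∑-cong (allFin r) (λ j → trans (∑-*ˡ (downFrom N) (z j) (kernel j x)) (trans (cong (z j *_) (kernel-sum j)) (*-zeroʳ (z j)))) ⟩
        ∑ (allFin r) (λ _ → 0ℚ)
          ≡⟨ trans (∑-const (allFin r) 0ℚ) (*-zeroʳ (ι (length (allFin r)))) ⟩
        0ℚ ∎
        where
        open ≡-Reasoning
        kernel-sum : ∀ j → ∑ (downFrom N) (kernel j x) ≡ 0ℚ
        kernel-sum j = begin
          ∑ (downFrom N) (kernel j x)
            ≡⟨ ∑-swap (downFrom N) (allFin 4) (λ y p → ∑ (allFin 4) (λ q → B j p q * (f p x * f q y))) ⟩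
          ∑ (allFin 4) (λ p → ∑ (downFrom N) (λ y → ∑ (allFin 4) (λ q → B j p q * (f p x * f q y))))
            ≡⟨ ∑-cong (allFin 4) row ⟩
          ∑ (allFin 4) (λ _ → 0ℚ)
            ≡⟨⟩
          0ℚ ∎
          where
          row : ∀ p → ∑ (downFrom N) (λ y → ∑ (allFin 4) (λ q → B j p q * (f p x * f q y))) ≡ 0ℚ
          row p = begin
            ∑ (downFrom N) (λ y → ∑ (allFin 4) (λ q → B j p q * (f p x * f q y)))
              ≡⟨ ∑-swap (downFrom N) (allFin 4) (λ y q → B j p q * (f p x * f q y)) ⟩
            ∑ (allFin 4) (λ q → ∑ (downFrom N) (λ y → B j p q * (f p x * f q y)))
              ≡⟨ ∑-cong (allFin 4) (λ q → trans (∑-cong (downFrom N) (λ y → sym (*-assoc (B j p q) (f p x) (f q y))))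
                   (trans (∑-*ˡ (downFrom N) (B j p q * f p x) (f q)) (cong (B j p q * f p x *_) (f-sum q)))) ⟩
            ∑ (allFin 4) (λ q → B j p q * f p x * ((ℤ.+ 1 / 4) * ι N))
              ≡⟨ trans (∑-cong (allFin 4) (λ q → *-assoc (B j p q) (f p x) ((ℤ.+ 1 / 4) * ι N))) (∑-*ʳ (allFin 4) (f p x * ((ℤ.+ 1 / 4) * ι N)) (B j p)) ⟩
            ∑ (allFin 4) (B j p) * (f p x * ((ℤ.+ 1 / 4) * ι N))
              ≡⟨ trans (cong (_* (f p x * ((ℤ.+ 1 / 4) * ι N))) (rowSum j p)) (*-zeroˡ (f p x * ((ℤ.+ 1 / 4) * ι N))) ⟩
            0ℚ ∎

      private
        Xs = choose 4 (downFrom N)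

      -- `X` and `Y` vary independently, so the sum of `f p` at the i-th entry of `X` times `f q` at
      -- the `σ i`-th entry of `Y` factors, and duality retains only the matrix entry at (i, `σ i`).
      -- Summed over `i`, this is the pairing with the permutation matrix of `σ`.
      h-linear : ∀ z (σ : Permutation′ 4) → ∑ Xs (λ X → ∑ Xs (λ Y → sumᵥ (Vec.zipWith (h z) X (permute σ Y))))
                 ≡ β * β * ∑ (allFin r) (λ j → z j * ∑ (allFin 4) (λ p → B j p (σ ⟨$⟩ʳ p)))
      h-linear z σ = begin
        ∑ Xs (λ X → ∑ Xs (λ Y → sumᵥ (Vec.zipWith (h z) X (permute σ Y))))
          ≡⟨ ∑-cong Xs (λ X → ∑-cong Xs (λ Y → trans (sumᵥ-lookup (Vec.zipWith (h z) X (permute σ Y))) (∑-cong (allFin 4) (λ i →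
               trans (lookup-zipWith (h z) i X (permute σ Y)) (cong (h z (lookup X i)) (lookup∘tabulate (λ i → lookup Y (σ ⟨$⟩ʳ i)) i)))))) ⟩
        ∑ Xs (λ X → ∑ Xs (λ Y → ∑ (allFin 4) (λ i → ∑ (allFin r) (λ j → z j * kernel j (lookup X i) (lookup Y (σ ⟨$⟩ʳ i))))))
          ≡⟨ swap₂ (allFin 4) (λ X Y i → ∑ (allFin r) (λ j → z j * kernel j (lookup X i) (lookup Y (σ ⟨$⟩ʳ i)))) ⟩
        ∑ (allFin 4) (λ i → ∑ Xs (λ X → ∑ Xs (λ Y → ∑ (allFin r) (λ j → z j * kernel j (lookup X i) (lookup Y (σ ⟨$⟩ʳ i))))))
          ≡⟨ ∑-cong (allFin 4) (λ i → trans (swap₂ (allFin r) (λ X Y j → z j * kernel j (lookup X i) (lookup Y (σ ⟨$⟩ʳ i))))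
               (∑-cong (allFin r) (λ j → trans (pull₂ (z j) (λ X Y → kernel j (lookup X i) (lookup Y (σ ⟨$⟩ʳ i)))) (cong (z j *_) (moment j i (σ ⟨$⟩ʳ i)))))) ⟩
        ∑ (allFin 4) (λ i → ∑ (allFin r) (λ j → z j * (B j i (σ ⟨$⟩ʳ i) * (β * β))))
          ≡⟨ ∑-swap (allFin 4) (allFin r) (λ i j → z j * (B j i (σ ⟨$⟩ʳ i) * (β * β))) ⟩
        ∑ (allFin r) (λ j → ∑ (allFin 4) (λ i → z j * (B j i (σ ⟨$⟩ʳ i) * (β * β))))
          ≡⟨ ∑-cong (allFin r) (λ j → trans (∑-*ˡ (allFin 4) (z j) (λ i → B j i (σ ⟨$⟩ʳ i) * (β * β)))
               (trans (cong (z j *_) (∑-*ʳ (allFin 4) (β * β) (λ i → B j i (σ ⟨$⟩ʳ i)))) (regroup (z j) (∑ (allFin 4) (λ i → B j i (σ ⟨$⟩ʳ i))) (β * β)))) ⟩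
        ∑ (allFin r) (λ j → β * β * (z j * ∑ (allFin 4) (λ p → B j p (σ ⟨$⟩ʳ p))))
          ≡⟨ ∑-*ˡ (allFin r) (β * β) (λ j → z j * ∑ (allFin 4) (λ p → B j p (σ ⟨$⟩ʳ p))) ⟩
        β * β * ∑ (allFin r) (λ j → z j * ∑ (allFin 4) (λ p → B j p (σ ⟨$⟩ʳ p))) ∎
        where
        open ≡-Reasoning
        regroup : ∀ a b c → a * (b * c) ≡ c * (a * b)
        regroup = solve-∀ ℚ-ring
        swap₂ : ∀ {I : Set} (is : List I) (g : Vec ℕ 4 → Vec ℕ 4 → I → ℚ) →
                ∑ Xs (λ X → ∑ Xs (λ Y → ∑ is (g X Y))) ≡ ∑ is (λ i → ∑ Xs (λ X → ∑ Xs (λ Y → g X Y i)))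
        swap₂ is g = trans (∑-cong Xs (λ X → ∑-swap Xs is (g X))) (∑-swap Xs is (λ X i → ∑ Xs (λ Y → g X Y i)))
        pull₂ : ∀ c (g : Vec ℕ 4 → Vec ℕ 4 → ℚ) → ∑ Xs (λ X → ∑ Xs (λ Y → c * g X Y)) ≡ c * ∑ Xs (λ X → ∑ Xs (g X))
        pull₂ c g = trans (∑-cong Xs (λ X → ∑-*ˡ Xs c (g X))) (∑-*ˡ Xs c (λ X → ∑ Xs (g X)))
        moment : ∀ j i k → ∑ Xs (λ X → ∑ Xs (λ Y → kernel j (lookup X i) (lookup Y k))) ≡ B j i k * (β * β)
        moment j i k = begin
          ∑ Xs (λ X → ∑ Xs (λ Y → kernel j (lookup X i) (lookup Y k)))
            ≡⟨ swap₂ (allFin 4) (λ X Y p → ∑ (allFin 4) (λ q → B j p q * (f p (lookup X i) * f q (lookup Y k)))) ⟩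
          ∑ (allFin 4) (λ p → ∑ Xs (λ X → ∑ Xs (λ Y → ∑ (allFin 4) (λ q → B j p q * (f p (lookup X i) * f q (lookup Y k))))))
            ≡⟨ ∑-cong (allFin 4) (λ p → trans (swap₂ (allFin 4) (λ X Y q → B j p q * (f p (lookup X i) * f q (lookup Y k))))
                 (∑-cong (allFin 4) (λ q → trans (pull₂ (B j p q) (λ X Y → f p (lookup X i) * f q (lookup Y k)))
                   (cong (B j p q *_) (trans (∑-product Xs Xs (λ X → f p (lookup X i)) (λ Y → f q (lookup Y k))) (cong₂ _*_ (f-dual p i) (f-dual q k))))))) ⟩
          ∑ (allFin 4) (λ p → ∑ (allFin 4) (λ q → B j p q * (δ p i * β * (δ q k * β))))
            ≡⟨ ∑-cong (allFin 4) (λ p → trans (∑-cong (allFin 4) (λ q → regroup₁ (B j p q) (δ p i) (δ q k) β))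
                 (trans (∑-*ʳ (allFin 4) (δ p i * (β * β)) (λ q → B j p q * δ q k)) (cong (_* (δ p i * (β * β))) (∑-δ 4 (B j p) k)))) ⟩
          ∑ (allFin 4) (λ p → B j p k * (δ p i * (β * β)))
            ≡⟨ trans (∑-cong (allFin 4) (λ p → sym (*-assoc (B j p k) (δ p i) (β * β)))) (∑-*ʳ (allFin 4) (β * β) (λ p → B j p k * δ p i)) ⟩
          ∑ (allFin 4) (λ p → B j p k * δ p i) * (β * β)
            ≡⟨ cong (_* (β * β)) (∑-δ 4 (λ p → B j p k) i) ⟩
          B j i k * (β * β) ∎
          where
          regroup₁ : ∀ b s t β → b * (s * β * (t * β)) ≡ b * t * (s * (β * β))
          regroup₁ = solve-∀ ℚ-ring

  -- Prescribing the densities of several patterns at once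

  onlyFirst : ∀ {r} → ℚ → Fin (suc r) → ℚ
  onlyFirst t zero    = t
  onlyFirst t (suc _) = 0ℚ

  -- `dual` makes the linear part of the densities the identity in the coordinates `z`, so that
  -- prescribing them means solving z + R z = target. Index 0 is the pattern whose density is moved;
  -- all others are to keep theirs.
  module LocalSurjectivity {r : ℕ} (σ : Fin (suc r) → Permutation′ 4) (B : Fin (suc r) → Fin 4 → Fin 4 → ℚ)
    (rowSum : ∀ j p → ∑ (allFin 4) (B j p) ≡ 0ℚ)
    (dual : ∀ i j → ∑ (allFin 4) (λ p → B j p (σ i ⟨$⟩ʳ p)) ≡ δ j i) where

    open Perturbation B rowSum

    private
      0<κ : 0ℚ < κ
      0<κ = <-≤-trans (ι-suc>0 0) 1≤κ

      0≤κ = <⇒≤ 0<κ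

      -- s = 1/(56κ²): the remainder has Lipschitz constant 28·(sκ)·κ in `z`, and 56 = 2·28 makes
      -- this one half.
      radius = reciprocal (*-pos (ι-suc>0 55) (*-pos 0<κ 0<κ))

      s : ℚ
      s = proj₁ radius

      0<s : 0ℚ < s
      0<s = proj₂ (proj₂ radius)

      0≤s = <⇒≤ 0<s

      s-def : ι 56 * (κ * κ) * s ≡ 1ℚ
      s-def = proj₁ (proj₂ radius)

      sκ≤1 : s * κ ≤ 1ℚ
      sκ≤1 = subst (s * κ ≤_) s-def (by-slack (slack s κ)
        (*-nonNeg (*-nonNeg 0≤s 0≤κ) (+-nonNeg (*-nonNeg (ι≥0 55) 0≤κ) (p≤q⇒0≤q-p 1≤κ))))
        where
        slack : ∀ s k → ι 56 * (k * k) * s - s * k ≡ s * k * (ι 55 * k + (k - 1ℚ))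
        slack = solve-∀ ℚ-ring

      s≤1 : s ≤ 1ℚ
      s≤1 = ≤-trans (subst (_≤ s * κ) (*-identityʳ s) (*-monoˡ 0≤s 1≤κ)) sκ≤1

    -- The largest first coordinate that the iteration admits. It depends only on the matrices
    -- `B j`, not on the grid or the accuracy, so the deviation survives in the limit.
    t : ℚ
    t = ½ * s

    target : Fin (suc r) → ℚ
    target = onlyFirst t

    t>0 : 0ℚ < t
    t>0 = *-pos (positive⁻¹ ½) 0<s

    private
      ½≥0 : 0ℚ ≤ ½
      ½≥0 = nonNegative⁻¹ ½

      target≤ : ∀ i → ∣ target i ∣ ≤ ½ * s
      target≤ zero    = ≤-reflexive (0≤p⇒∣p∣≡p (<⇒≤ t>0))
      target≤ (suc _) = <⇒≤ t>0

    module _ (N : ℕ) (12≤N : 12 ℕ.≤ N) where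

      private
        4≤N = ℕₚ.≤-trans (ℕₚ.m≤n+m 4 8) 12≤N
        open Grid N 4≤N
        open DualBasis N 4≤N using (β; β>0)

        Xs = choose 4 (downFrom N)

        below : ∀ {X : Vec ℕ 4} → X ∈ Xs → ∀ i → lookup X i ℕ.< N
        below X∈ i = ∈-downFrom (∈-choose 4 (downFrom N) X∈ i)

        entry : ∀ (g : ℕ → ℕ → ℚ) X Y j (i : Fin 4) → lookup (Vec.zipWith g X (permute (σ j) Y)) i ≡ g (lookup X i) (lookup Y (σ j ⟨$⟩ʳ i))
        entry g X Y j i = trans (lookup-zipWith g i X (permute (σ j) Y)) (cong (g (lookup X i)) (lookup∘tabulate (λ i → lookup Y (σ j ⟨$⟩ʳ i)) i))

        inverse = reciprocal (*-pos β>0 β>0)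
        β⁻² = proj₁ inverse

        β-cancel : β * β * β⁻² ≡ 1ℚ
        β-cancel = proj₁ (proj₂ inverse)

        0≤β⁻² = <⇒≤ (proj₂ (proj₂ inverse))

        remainders : (Fin (suc r) → ℚ) → Fin (suc r) → ℚ
        remainders z i = ∑ Xs (λ X → ∑ Xs (λ Y → remainder (Vec.zipWith (h z) X (permute (σ i) Y))))

        -- The mean of the nonlinear part over all pairs of 4-subsets, hence Lipschitz with the same
        -- constant as a single summand.
        R : (Fin (suc r) → ℚ) → Fin (suc r) → ℚ
        R z i = β⁻² * remainders z i

        length-Xs : ι (length Xs) ≡ β
        length-Xs = cong ι (trans (length-choose 4 (downFrom N)) (cong (_C 4) (length-downFrom N)))

        ∑∑-const : ∀ c → ∑ Xs (λ _ → ∑ Xs (λ _ → c)) ≡ β * β * c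
        ∑∑-const c = trans (∑-const Xs (∑ Xs (λ _ → c))) (trans (cong₂ _*_ length-Xs (trans (∑-const Xs c) (cong (_* c) length-Xs))) (sym (*-assoc β β c)))

        R-zero : ∀ i → R (λ _ → 0ℚ) i ≡ 0ℚ
        R-zero i = trans (cong (β⁻² *_) (trans (∑-cong Xs (λ X → ∑-cong Xs (λ Y → remainder-zero (Vec.zipWith (h (λ _ → 0ℚ)) X (permute (σ i) Y))
          (λ k → trans (entry (h (λ _ → 0ℚ)) X Y i k) (h-zero (lookup X k) (lookup Y (σ i ⟨$⟩ʳ k))))))) (trans (∑∑-const 0ℚ) (*-zeroʳ (β * β))))) (*-zeroʳ β⁻²)

        R-lipschitz : ∀ y z d → (∀ i → ∣ y i ∣ ≤ s) → (∀ i → ∣ z i ∣ ≤ s) → (∀ i → ∣ y i - z i ∣ ≤ d) →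
                      ∀ i → ∣ R y i - R z i ∣ ≤ ½ * d
        R-lipschitz y z d y≤ z≤ yz≤ i = begin
          ∣ R y i - R z i ∣
            ≡⟨ cong ∣_∣ (factor β⁻² (remainders y i) (remainders z i)) ⟩
          ∣ β⁻² * (remainders y i - remainders z i) ∣
            ≤⟨ ∣*∣≤ {β⁻²} {remainders y i - remainders z i} (≤-reflexive (0≤p⇒∣p∣≡p 0≤β⁻²)) difference ⟩
          β⁻² * (β * β * (ι 28 * (s * κ * (d * κ))))
            ≡⟨ regroup β⁻² (β * β) s κ d ⟩
          (β * β * β⁻²) * (½ * (ι 56 * (κ * κ) * s)) * d
            ≡⟨ cong₂ (λ a b → a * (½ * b) * d) β-cancel s-def ⟩
          1ℚ * (½ * 1ℚ) * d
            ≡⟨⟩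
          ½ * d ∎
          where
          open ≤-Reasoning
          0≤d : 0ℚ ≤ d
          0≤d = ≤-trans (0≤∣p∣ (y zero - z zero)) (yz≤ zero)
          factor : ∀ a b c → a * b - a * c ≡ a * (b - c)
          factor = solve-∀ ℚ-ring
          regroup : ∀ a b s k d → a * (b * (ι 28 * (s * k * (d * k)))) ≡ (b * a) * (½ * (ι 56 * (k * k) * s)) * d
          regroup = solve-∀ ℚ-ring
          vec : (Fin (suc r) → ℚ) → Vec ℕ 4 → Vec ℕ 4 → Vec ℚ 4
          vec z X Y = Vec.zipWith (h z) X (permute (σ i) Y)
          pointwise : ∀ X → X ∈ Xs → ∀ Y → Y ∈ Xs → ∣ remainder (vec y X Y) - remainder (vec z X Y) ∣ ≤ ι 28 * (s * κ * (d * κ))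
          pointwise X X∈ Y Y∈ = remainder-lipschitz (*-nonNeg 0≤s 0≤κ) sκ≤1 (vec y X Y) (vec z X Y)
            (λ k → subst (λ e → ∣ e ∣ ≤ s * κ) (sym (entry (h y) X Y i k)) (h-bound y≤ 0≤s (below X∈ k) (below Y∈ (σ i ⟨$⟩ʳ k))))
            (λ k → subst (λ e → ∣ e ∣ ≤ s * κ) (sym (entry (h z) X Y i k)) (h-bound z≤ 0≤s (below X∈ k) (below Y∈ (σ i ⟨$⟩ʳ k))))
            (λ k → subst (λ e → ∣ e ∣ ≤ d * κ) (sym (trans (cong₂ _-_ (entry (h y) X Y i k) (entry (h z) X Y i k)) (h-minus y z (lookup X k) (lookup Y (σ i ⟨$⟩ʳ k)))))
              (h-bound yz≤ 0≤d (below X∈ k) (below Y∈ (σ i ⟨$⟩ʳ k))))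
          difference : ∣ remainders y i - remainders z i ∣ ≤ β * β * (ι 28 * (s * κ * (d * κ)))
          difference = begin
            ∣ remainders y i - remainders z i ∣
              ≡⟨ cong ∣_∣ (trans (∑-cong Xs (λ X → ∑-- Xs (λ Y → remainder (vec y X Y)) (λ Y → remainder (vec z X Y))))
                   (∑-- Xs (λ X → ∑ Xs (λ Y → remainder (vec y X Y))) (λ X → ∑ Xs (λ Y → remainder (vec z X Y))))) ⟨
            ∣ ∑ Xs (λ X → ∑ Xs (λ Y → remainder (vec y X Y) - remainder (vec z X Y))) ∣
              ≤⟨ ∑-∣∣ Xs (λ X → ∑ Xs (λ Y → remainder (vec y X Y) - remainder (vec z X Y))) ⟩
            ∑ Xs (λ X → ∣ ∑ Xs (λ Y → remainder (vec y X Y) - remainder (vec z X Y)) ∣)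
              ≤⟨ ∑-mono Xs (λ X X∈ → ≤-trans (∑-∣∣ Xs (λ Y → remainder (vec y X Y) - remainder (vec z X Y))) (∑-mono Xs (pointwise X X∈))) ⟩
            ∑ Xs (λ _ → ∑ Xs (λ _ → ι 28 * (s * κ * (d * κ))))
              ≡⟨ ∑∑-const (ι 28 * (s * κ * (d * κ))) ⟩
            β * β * (ι 28 * (s * κ * (d * κ))) ∎

        main : ∀ z i → ∑ Xs (λ X → ∑ Xs (λ Y → ∏[1+ Vec.zipWith (h z) X (permute (σ i) Y) ])) ≡ β * β * (1ℚ + (z i + R z i))
        main z i = begin
          ∑ Xs (λ X → ∑ Xs (λ Y → ∏[1+ vec X Y ]))
            ≡⟨ ∑-cong Xs (λ X → trans (∑-cong Xs (λ Y → ∏-expand (vec X Y)))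
                 (trans (∑-+ Xs (λ Y → 1ℚ + sumᵥ (vec X Y)) (λ Y → remainder (vec X Y))) (cong (_+ ∑ Xs (λ Y → remainder (vec X Y))) (∑-+ Xs (λ _ → 1ℚ) (λ Y → sumᵥ (vec X Y)))))) ⟩
          ∑ Xs (λ X → ∑ Xs (λ _ → 1ℚ) + ∑ Xs (λ Y → sumᵥ (vec X Y)) + ∑ Xs (λ Y → remainder (vec X Y)))
            ≡⟨ trans (∑-+ Xs (λ X → ∑ Xs (λ _ → 1ℚ) + ∑ Xs (λ Y → sumᵥ (vec X Y))) (λ X → ∑ Xs (λ Y → remainder (vec X Y))))
                 (cong (_+ remainders z i) (∑-+ Xs (λ _ → ∑ Xs (λ _ → 1ℚ)) (λ X → ∑ Xs (λ Y → sumᵥ (vec X Y))))) ⟩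
          ∑ Xs (λ _ → ∑ Xs (λ _ → 1ℚ)) + ∑ Xs (λ X → ∑ Xs (λ Y → sumᵥ (vec X Y))) + remainders z i
            ≡⟨ cong₂ (λ a b → a + b + remainders z i) (∑∑-const 1ℚ) (trans (h-linear z (σ i)) (cong (β * β *_) linear)) ⟩
          β * β * 1ℚ + β * β * z i + remainders z i
            ≡⟨ cong (β * β * 1ℚ + β * β * z i +_) (trans (sym (*-identityˡ (remainders z i))) (cong (_* remainders z i) (sym β-cancel))) ⟩
          β * β * 1ℚ + β * β * z i + β * β * β⁻² * remainders z i
            ≡⟨ collect (β * β) (z i) β⁻² (remainders z i) ⟩
          β * β * (1ℚ + (z i + R z i)) ∎
          where
          open ≡-Reasoning
          vec : Vec ℕ 4 → Vec ℕ 4 → Vec ℚ 4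
          vec X Y = Vec.zipWith (h z) X (permute (σ i) Y)
          linear : ∑ (allFin (suc r)) (λ j → z j * ∑ (allFin 4) (λ p → B j p (σ i ⟨$⟩ʳ p))) ≡ z i
          linear = trans (∑-cong (allFin (suc r)) (λ j → cong (z j *_) (dual i j))) (∑-δ (suc r) z i)
          collect : ∀ b z c m → b * 1ℚ + b * z + b * c * m ≡ b * (1ℚ + (z + c * m))
          collect = solve-∀ ℚ-ring

      module Realisation (ε : ℚ) (ε≤½ : ε ≤ ½) (z : Fin (suc r) → ℚ) (z≤ : ∀ i → ∣ z i ∣ ≤ s)
        (res≤ : ∀ i → ∣ z i + R z i - target i ∣ ≤ ε) (d : ℕ) (0<d : 0 ℕ.< d) (W : ℕ → ℕ → ℕ)
        (W≡ : ∀ {x y} → x ℕ.< N → y ℕ.< N → ι (W x y) ≡ ι d * ∣ 1ℚ + h z x y ∣) where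

        ∣h∣≤1 : ∀ {x y} → x ℕ.< N → y ℕ.< N → ∣ h z x y ∣ ≤ 1ℚ
        ∣h∣≤1 x<N y<N = ≤-trans (h-bound z≤ 0≤s x<N y<N) sκ≤1

        ∣p∣≤1⇒0≤1+p : ∀ {p} → ∣ p ∣ ≤ 1ℚ → 0ℚ ≤ 1ℚ + p
        ∣p∣≤1⇒0≤1+p {p} le = subst (0ℚ ≤_) (minus-neg 1ℚ p) (p≤q⇒0≤q-p (≤-trans (-p≤∣p∣ p) le))
          where
          minus-neg : ∀ a b → a - - b ≡ a + b
          minus-neg = solve-∀ ℚ-ring

        W≡′ : ∀ {x y} → x ℕ.< N → y ℕ.< N → ι (W x y) ≡ ι d * (1ℚ + h z x y)
        W≡′ {x} {y} x<N y<N = trans (W≡ x<N y<N) (cong (ι d *_) (0≤p⇒∣p∣≡p (∣p∣≤1⇒0≤1+p {h z x y} (∣h∣≤1 x<N y<N))))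

        open WeightedGrid N 12≤N W (ι d) (ι>0 0<d) (h z) W≡′ ∣h∣≤1 (h-sum z) public

        N≤length : N ℕ.≤ length P
        N≤length = ι-cancel-≤ (subst (ι N ≤_) (sym (trans ιlength (trans (cong (ι N *_) (sym (ι-* d N))) (sym (ι-* N (d ℕ.* N))))))
          (ι-mono (ℕₚ.≤-trans (ℕₚ.≤-reflexive (sym (ℕₚ.*-identityʳ N))) (ℕₚ.*-monoʳ-≤ N (ℕₚ.*-mono-≤ 0<d (ℕₚ.≤-trans (ℕ.s≤s ℕ.z≤n) 12≤N))))))

        module _ (i : Fin (suc r)) where

          a = 1ℚ + (z i + R z i)
          ρ = z i + R z i - target i

          a≡ : a ≡ 1ℚ + (ρ + target i)
          a≡ = cong (1ℚ +_) (cancel (z i + R z i) (target i))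
            where
            cancel : ∀ x y → x ≡ x - y + y
            cancel = solve-∀ ℚ-ring

          -- One half from the accuracy and one half from the target, as s ≤ 1. This keeps `a`
          -- between 0 and 2, the range in which the density estimate was derived.
          ∣a-1∣≤1 : ∣ ρ + target i ∣ ≤ 1ℚ
          ∣a-1∣≤1 = ∣+∣≤ {ρ} {target i} (≤-trans (res≤ i) ε≤½) (≤-trans (target≤ i) (*-monoˡ ½≥0 s≤1))

          0≤a : 0ℚ ≤ a
          0≤a = subst (0ℚ ≤_) (sym a≡) (∣p∣≤1⇒0≤1+p {ρ + target i} ∣a-1∣≤1)

          a≤2 : a ≤ ι 2
          a≤2 = subst (_≤ ι 2) (sym a≡) (+-monoʳ-≤ 1ℚ (≤-trans (p≤∣p∣ (ρ + target i)) ∣a-1∣≤1))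

          estimate : ∣ ι 24 * density (σ i) π - (1ℚ + target i) ∣ * ι N ≤ ε * ι N + ι 17184
          estimate = begin
            ∣ ι 24 * density (σ i) π - (1ℚ + target i) ∣ * ι N
              ≡⟨ cong (λ e → ∣ e ∣ * ι N) (split (ι 24 * density (σ i) π) (z i + R z i) (target i)) ⟩
            ∣ (ι 24 * density (σ i) π - a) + ρ ∣ * ι N
              ≤⟨ *-monoʳ (ι≥0 N) (∣+∣≤ {ι 24 * density (σ i) π - a} {ρ} ≤-refl (res≤ i)) ⟩
            (∣ ι 24 * density (σ i) π - a ∣ + ε) * ι N
              ≡⟨ distrib ∣ ι 24 * density (σ i) π - a ∣ ε (ι N) ⟩
            ε * ι N + ∣ ι 24 * density (σ i) π - a ∣ * ι N
              ≤⟨ +-monoʳ-≤ (ε * ι N) (density-estimate (σ i) a 0≤a a≤2 (main z i)) ⟩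
            ε * ι N + ι 17184 ∎
            where
            open ≤-Reasoning
            split : ∀ x y t → x - (1ℚ + t) ≡ (x - (1ℚ + y)) + (y - t)
            split = solve-∀ ℚ-ring
            distrib : ∀ x y n → (x + y) * n ≡ y * n + x * n
            distrib = solve-∀ ℚ-ring

      perturbed : ∀ ε → 0ℚ < ε → ε ≤ ½ →
        ∃ λ n → N ℕ.≤ n × ∃ λ (π : Permutation′ n) → ∀ i → ∣ ι 24 * density (σ i) π - (1ℚ + target i) ∣ * ι N ≤ ε * ι N + ι 17184
      perturbed ε 0<ε ε≤½ =
        let z , z≤ , res≤ = approximate-solution R target R-zero target≤ R-lipschitz 0<s ε 0<ε
            d , 0<d , W , W≡ = commonDenominator (λ x y → 1ℚ + h z x y) N
            open Realisation ε ε≤½ z z≤ res≤ d 0<d W W≡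
        in length P , N≤length , π , estimate

    approximate : ∀ ε → 0ℚ < ε → ε ≤ ½ → ∀ M →
      ∃ λ n → M ℕ.≤ n × ∃ λ (π : Permutation′ n) → ∀ i → ∣ ι 24 * density (σ i) π - (1ℚ + target i) ∣ ≤ ε
    approximate ε 0<ε ε≤½ M =
      -- The error is shared: ε/2 for the residual of the iteration and ε/2 for the grid, whose
      -- error 17184/N is small enough once N ≥ K ≥ 17184/(ε/2).
      let e , e-def , 0<e = reciprocal 0<½ε
          K , K≥ = archimedean (e * ι 17184)
      in large-grid e e-def K K≥ (12 ℕ.+ (M ℕ.+ K)) (ℕₚ.m≤m+n 12 (M ℕ.+ K))
           (ℕₚ.≤-trans (ℕₚ.m≤m+n M K) (ℕₚ.m≤n+m (M ℕ.+ K) 12)) (ℕₚ.≤-trans (ℕₚ.m≤n+m K M) (ℕₚ.m≤n+m (M ℕ.+ K) 12))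
      where
      0<½ε : 0ℚ < ½ * ε
      0<½ε = *-pos (positive⁻¹ ½) 0<ε

      ½ε≤½ : ½ * ε ≤ ½
      ½ε≤½ = subst (½ * ε ≤_) (*-identityʳ ½) (*-monoˡ {ε} {1ℚ} ½≥0 (≤-trans ε≤½ (from-yes (½ ≤? 1ℚ))))

      large-grid : ∀ e → ½ * ε * e ≡ 1ℚ → ∀ K → e * ι 17184 ≤ ι K → ∀ N → 12 ℕ.≤ N → M ℕ.≤ N → K ℕ.≤ N →
        ∃ λ n → M ℕ.≤ n × ∃ λ (π : Permutation′ n) → ∀ i → ∣ ι 24 * density (σ i) π - (1ℚ + target i) ∣ ≤ ε
      large-grid e e-def K K≥ N 12≤N M≤N K≤N = let n , N≤n , π , est = perturbed N 12≤N (½ * ε) 0<½ε ½ε≤½ in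
        n , ℕₚ.≤-trans M≤N N≤n , π , λ i → *-cancelʳ-≤ (ι>0 (ℕₚ.≤-trans (ℕ.s≤s ℕ.z≤n) 12≤N))
          (≤-trans (est i) (≤-trans (+-monoʳ-≤ (½ * ε * ι N) 17184≤) (≤-reflexive (double ε (ι N)))))
        where
        17184≤ : ι 17184 ≤ ½ * ε * ι N
        17184≤ = ≤-trans (≤-reflexive (trans (sym (*-identityˡ (ι 17184))) (trans (cong (_* ι 17184) (sym e-def)) (*-assoc (½ * ε) e (ι 17184)))))
          (*-monoˡ (<⇒≤ 0<½ε) (≤-trans K≥ (ι-mono K≤N)))
        double : ∀ e n → ½ * e * n + ½ * e * n ≡ e * n
        double = solve-∀ ℚ-ring

  -- Agreements of permutations of four points

  same : Fin 4 → Fin 4 → ℕ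
  same a b = if toℕ a ℕ.≡ᵇ toℕ b then 1 else 0

  agreements : (Fin 4 → Fin 4) → (Fin 4 → Fin 4) → ℕ
  agreements f g = same (f (# 0)) (g (# 0)) ℕ.+ (same (f (# 1)) (g (# 1)) ℕ.+ (same (f (# 2)) (g (# 2)) ℕ.+ same (f (# 3)) (g (# 3))))

  ∑ᶻ : {I : Set} → List I → (I → ℤ) → ℤ
  ∑ᶻ []       f = ℤ.+ 0
  ∑ᶻ (x ∷ xs) f = f x ℤ.+ ∑ᶻ xs f

  -- The inner product of the projections of two permutation matrices to the matrices
  -- with vanishing row and column sums.
  gram : (Fin 4 → Fin 4) → (Fin 4 → Fin 4) → ℤ
  gram f g = ℤ.+ agreements f g ℤ.- ℤ.+ 1

  table : Fin 24 → Vec (Fin 4) 4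
  table = lookup
    ( (a ∷ᵥ b ∷ᵥ c ∷ᵥ d ∷ᵥ []ᵥ)
    ∷ᵥ (a ∷ᵥ b ∷ᵥ d ∷ᵥ c ∷ᵥ []ᵥ)
    ∷ᵥ (a ∷ᵥ c ∷ᵥ b ∷ᵥ d ∷ᵥ []ᵥ)
    ∷ᵥ (a ∷ᵥ c ∷ᵥ d ∷ᵥ b ∷ᵥ []ᵥ)
    ∷ᵥ (a ∷ᵥ d ∷ᵥ b ∷ᵥ c ∷ᵥ []ᵥ)
    ∷ᵥ (a ∷ᵥ d ∷ᵥ c ∷ᵥ b ∷ᵥ []ᵥ)
    ∷ᵥ (b ∷ᵥ a ∷ᵥ c ∷ᵥ d ∷ᵥ []ᵥ)
    ∷ᵥ (b ∷ᵥ a ∷ᵥ d ∷ᵥ c ∷ᵥ []ᵥ)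
    ∷ᵥ (b ∷ᵥ c ∷ᵥ a ∷ᵥ d ∷ᵥ []ᵥ)
    ∷ᵥ (b ∷ᵥ c ∷ᵥ d ∷ᵥ a ∷ᵥ []ᵥ)
    ∷ᵥ (b ∷ᵥ d ∷ᵥ a ∷ᵥ c ∷ᵥ []ᵥ)
    ∷ᵥ (b ∷ᵥ d ∷ᵥ c ∷ᵥ a ∷ᵥ []ᵥ)
    ∷ᵥ (c ∷ᵥ a ∷ᵥ b ∷ᵥ d ∷ᵥ []ᵥ)
    ∷ᵥ (c ∷ᵥ a ∷ᵥ d ∷ᵥ b ∷ᵥ []ᵥ)
    ∷ᵥ (c ∷ᵥ b ∷ᵥ a ∷ᵥ d ∷ᵥ []ᵥ)
    ∷ᵥ (c ∷ᵥ b ∷ᵥ d ∷ᵥ a ∷ᵥ []ᵥ)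
    ∷ᵥ (c ∷ᵥ d ∷ᵥ a ∷ᵥ b ∷ᵥ []ᵥ)
    ∷ᵥ (c ∷ᵥ d ∷ᵥ b ∷ᵥ a ∷ᵥ []ᵥ)
    ∷ᵥ (d ∷ᵥ a ∷ᵥ b ∷ᵥ c ∷ᵥ []ᵥ)
    ∷ᵥ (d ∷ᵥ a ∷ᵥ c ∷ᵥ b ∷ᵥ []ᵥ)
    ∷ᵥ (d ∷ᵥ b ∷ᵥ a ∷ᵥ c ∷ᵥ []ᵥ)
    ∷ᵥ (d ∷ᵥ b ∷ᵥ c ∷ᵥ a ∷ᵥ []ᵥ)
    ∷ᵥ (d ∷ᵥ c ∷ᵥ a ∷ᵥ b ∷ᵥ []ᵥ)
    ∷ᵥ (d ∷ᵥ c ∷ᵥ b ∷ᵥ a ∷ᵥ []ᵥ)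
    ∷ᵥ []ᵥ )
    where
    a b c d : Fin 4
    a = zero
    b = suc zero
    c = suc (suc zero)
    d = suc (suc (suc zero))

  abstract
    -- Agreement at three points forces agreement at the fourth.
    distinct-agreements : ∀ k l → k ≡ l ⊎ ∃ λ (x : Fin 3) → toℕ x ≡ agreements (lookup (table k)) (lookup (table l))
    distinct-agreements = from-yes (all? λ k → all? λ l → (k Fin.≟ l) ⊎-dec any? (λ (x : Fin 3) → toℕ x ℕ.≟ agreements (lookup (table k)) (lookup (table l))))

    -- Sum over pairs of points p, q the number of permutations that agree with the first at p and
    -- with the second at q. For a agreements between the two, the pairs p = q contribute 6a, and
    -- each of the 12 - (4 - a) pairs p ≠ q with different prescribed values contributes 2.
    agreements-square : ∀ k l → sum (List.map (λ t → agreements (lookup (table k)) (lookup (table t)) ℕ.* agreements (lookup (table l)) (lookup (table t))) (allFin 24))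
                          ≡ 8 ℕ.* agreements (lookup (table k)) (lookup (table l)) ℕ.+ 16
    agreements-square = from-yes (all? λ k → all? λ l → sum (List.map (λ t → agreements (lookup (table k)) (lookup (table t)) ℕ.* agreements (lookup (table l)) (lookup (table t))) (allFin 24))
      ℕ.≟ 8 ℕ.* agreements (lookup (table k)) (lookup (table l)) ℕ.+ 16)

    table-injective : ∀ t i j → lookup (table t) i ≡ lookup (table t) j → i ≡ j
    table-injective = from-yes (all? λ t → all? λ i → all? λ j → (lookup (table t) i Fin.≟ lookup (table t) j) →-dec (i Fin.≟ j))

    clash⊎index : ∀ (a b c d : Fin 4) → Clash a b c d ⊎ ∃ λ k → table k ≡ a ∷ᵥ b ∷ᵥ c ∷ᵥ d ∷ᵥ []ᵥ
    clash⊎index = from-yes (all? λ a → all? λ b → all? λ c → all? λ d →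
      clash? a b c d ⊎-dec any? (λ k → ≡-dec Fin._≟_ (table k) (a ∷ᵥ b ∷ᵥ c ∷ᵥ d ∷ᵥ []ᵥ)))

  index : (σ : Permutation′ 4) → ∃ λ k → ∀ i → σ ⟨$⟩ʳ i ≡ lookup (table k) i
  index σ with clash⊎index (σ ⟨$⟩ʳ # 0) (σ ⟨$⟩ʳ # 1) (σ ⟨$⟩ʳ # 2) (σ ⟨$⟩ʳ # 3)
  ... | inj₁ clash    = ⊥-elim (no-clash σ clash)
  ... | inj₂ (k , eq) = k , λ i → trans (sym (lookup∘tabulate (σ ⟨$⟩ʳ_) i)) (cong (λ v → lookup v i) (sym eq))

  tablePermutation : ∀ t → ∃ λ (τ : Permutation′ 4) → ∀ i → τ ⟨$⟩ʳ i ≡ lookup (table t) i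
  tablePermutation t = injective⇒permutation (lookup (table t)) (λ {i} {j} → table-injective t i j)

  Matrix : Set
  Matrix = Fin 4 → Fin 4 → ℤ

  det₃ : (Fin 3 → Fin 3 → ℤ) → ℤ
  det₃ m = m (# 0) (# 0) ℤ.* (m (# 1) (# 1) ℤ.* m (# 2) (# 2) ℤ.- m (# 1) (# 2) ℤ.* m (# 2) (# 1))
     ℤ.- m (# 0) (# 1) ℤ.* (m (# 1) (# 0) ℤ.* m (# 2) (# 2) ℤ.- m (# 1) (# 2) ℤ.* m (# 2) (# 0))
     ℤ.+ m (# 0) (# 2) ℤ.* (m (# 1) (# 0) ℤ.* m (# 2) (# 1) ℤ.- m (# 1) (# 1) ℤ.* m (# 2) (# 0))

  adjugate : Matrix → Matrix
  adjugate m i j = sign (toℕ i ℕ.+ toℕ j) (det₃ (λ a b → m (punchIn j a) (punchIn i b)))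
    where
    sign : ℕ → ℤ → ℤ
    sign zero          x = x
    sign (suc zero)    x = ℤ.- x
    sign (suc (suc n)) x = sign n x

  determinant : Matrix → ℤ
  determinant m = ∑ᶻ (allFin 4) (λ k → m zero k ℤ.* adjugate m k zero)

  symmetricMatrix : Vec ℤ 6 → Matrix
  symmetricMatrix (a ∷ᵥ b ∷ᵥ c ∷ᵥ d ∷ᵥ e ∷ᵥ f ∷ᵥ []ᵥ) i j = lookup (lookup
    ( (ℤ.+ 3 ∷ᵥ a ∷ᵥ b ∷ᵥ c ∷ᵥ []ᵥ)
    ∷ᵥ (a ∷ᵥ ℤ.+ 3 ∷ᵥ d ∷ᵥ e ∷ᵥ []ᵥ)
    ∷ᵥ (b ∷ᵥ d ∷ᵥ ℤ.+ 3 ∷ᵥ f ∷ᵥ []ᵥ)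
    ∷ᵥ (c ∷ᵥ e ∷ᵥ f ∷ᵥ ℤ.+ 3 ∷ᵥ []ᵥ)
    ∷ᵥ []ᵥ) i) j

  gramMatrix : Vec (Fin 3) 6 → Matrix
  gramMatrix v = symmetricMatrix (Vec.map (λ x → ℤ.+ toℕ x ℤ.- ℤ.+ 1) v)

  -- The agreement counts for which the off-diagonal Gram entries are −sᵢsⱼ for signs s;
  -- the pairs are ordered 01, 02, 03, 12, 13, 23.
  singularPatterns : List (Vec (Fin 3) 6)
  singularPatterns
    = (o ∷ᵥ o ∷ᵥ o ∷ᵥ o ∷ᵥ o ∷ᵥ o ∷ᵥ []ᵥ)
    ∷ (o ∷ᵥ t ∷ᵥ t ∷ᵥ t ∷ᵥ t ∷ᵥ o ∷ᵥ []ᵥ)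
    ∷ (t ∷ᵥ o ∷ᵥ t ∷ᵥ t ∷ᵥ o ∷ᵥ t ∷ᵥ []ᵥ)
    ∷ (t ∷ᵥ t ∷ᵥ o ∷ᵥ o ∷ᵥ t ∷ᵥ t ∷ᵥ []ᵥ)
    ∷ (t ∷ᵥ t ∷ᵥ t ∷ᵥ o ∷ᵥ o ∷ᵥ o ∷ᵥ []ᵥ)
    ∷ (t ∷ᵥ o ∷ᵥ o ∷ᵥ t ∷ᵥ t ∷ᵥ o ∷ᵥ []ᵥ)
    ∷ (o ∷ᵥ t ∷ᵥ o ∷ᵥ t ∷ᵥ o ∷ᵥ t ∷ᵥ []ᵥ)
    ∷ (o ∷ᵥ o ∷ᵥ t ∷ᵥ o ∷ᵥ t ∷ᵥ t ∷ᵥ []ᵥ)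
    ∷ []
    where
    o t : Fin 3
    o = zero
    t = suc (suc zero)

  scalar : ℤ → Matrix
  scalar d i j = if does (i Fin.≟ j) then d else ℤ.+ 0

  -- The adjugate identity is included so that it is verified by evaluation, matrix by matrix, along
  -- with the determinant.
  Invertible : Matrix → Set
  Invertible m = determinant m ≢ ℤ.+ 0 × (∀ i j → ∑ᶻ (allFin 4) (λ k → m i k ℤ.* adjugate m k j) ≡ scalar (determinant m) i j)

  abstract
    -- These matrices are weakly diagonally dominant: 3 against three entries of absolute value at
    -- most 1. The row at the largest coordinate of a kernel vector then has equality throughout, so
    -- all coordinates have the same absolute value and each off-diagonal entry is minus the product
    -- of two signs. The 729 cases confirm it.
    singular⊎invertible : ∀ a b c d e f → let v = a ∷ᵥ b ∷ᵥ c ∷ᵥ d ∷ᵥ e ∷ᵥ f ∷ᵥ []ᵥ in Any (v ≡_) singularPatterns ⊎ Invertible (gramMatrix v)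
    singular⊎invertible = from-yes (all? λ a → all? λ b → all? λ c → all? λ d → all? λ e → all? λ f →
      let v = a ∷ᵥ b ∷ᵥ c ∷ᵥ d ∷ᵥ e ∷ᵥ f ∷ᵥ []ᵥ ; m = gramMatrix v in
      Any.any? (≡-dec Fin._≟_ v) singularPatterns
      ⊎-dec (¬? (determinant m ℤ.≟ ℤ.+ 0) ×-dec all? λ i → all? λ j → ∑ᶻ (allFin 4) (λ k → m i k ℤ.* adjugate m k j) ℤ.≟ scalar (determinant m) i j))

  ind : Fin 4 → Fin 4 → ℤ
  ind v j = if does (v Fin.≟ j) then ℤ.+ 1 else ℤ.+ 0

  abstract
    same-sym : ∀ a b → same a b ≡ same b a
    same-sym = from-yes (all? λ a → all? λ b → same a b ℕ.≟ same b a)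

    row-ones : ∀ a b c d → (same a b ℕ.+ same a c ℕ.+ same a d ℕ.+ same b c ℕ.+ same b d ℕ.+ same c d) ≡ 0 →
               ∀ j → ind a j ℤ.+ ind b j ℤ.+ ind c j ℤ.+ ind d j ≡ ℤ.+ 1
    row-ones = from-yes (all? λ a → all? λ b → all? λ c → all? λ d →
      ((same a b ℕ.+ same a c ℕ.+ same a d ℕ.+ same b c ℕ.+ same b d ℕ.+ same c d) ℕ.≟ 0)
      →-dec all? λ j → (ind a j ℤ.+ ind b j ℤ.+ ind c j ℤ.+ ind d j) ℤ.≟ ℤ.+ 1)

    -- The squared length of e_a + e_b - e_c - e_d is 4 + 2(ab + cd) - 2(ac + ad + bc + bd), where
    -- xy is 1 if the values x and y coincide and 0 otherwise. It is nonnegative, and it is zero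
    -- only if the vector is, which is `row-pairs-≡`.
    row-pairs-≤ : ∀ a b c d → same a c ℕ.+ same a d ℕ.+ same b c ℕ.+ same b d ℕ.≤ 2 ℕ.+ (same a b ℕ.+ same c d)
    row-pairs-≤ = from-yes (all? λ a → all? λ b → all? λ c → all? λ d →
      same a c ℕ.+ same a d ℕ.+ same b c ℕ.+ same b d ℕ.≤? 2 ℕ.+ (same a b ℕ.+ same c d))

    row-pairs-≡ : ∀ a b c d → same a c ℕ.+ same a d ℕ.+ same b c ℕ.+ same b d ≡ 2 ℕ.+ (same a b ℕ.+ same c d) →
                  ∀ j → ind a j ℤ.+ ind b j ℤ.- ind c j ℤ.- ind d j ≡ ℤ.+ 0
    row-pairs-≡ = from-yes (all? λ a → all? λ b → all? λ c → all? λ d →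
      (same a c ℕ.+ same a d ℕ.+ same b c ℕ.+ same b d ℕ.≟ 2 ℕ.+ (same a b ℕ.+ same c d))
      →-dec all? λ j → (ind a j ℤ.+ ind b j ℤ.- ind c j ℤ.- ind d j) ℤ.≟ ℤ.+ 0)

    -- If `a` equals m of the other values, these coincide pairwise, and m ≤ 1 + m(m - 1)/2.
    row-triple : ∀ a b c d → same a b ℕ.+ same a c ℕ.+ same a d ℕ.≤ 1 ℕ.+ (same b c ℕ.+ same b d ℕ.+ same c d)
    row-triple = from-yes (all? λ a → all? λ b → all? λ c → all? λ d →
      same a b ℕ.+ same a c ℕ.+ same a d ℕ.≤? 1 ℕ.+ (same b c ℕ.+ same b d ℕ.+ same c d))

    same-δ : ∀ a b → ι (same a b) ≡ δ b a
    same-δ = from-yes (all? λ a → all? λ b → ι (same a b) ≟ δ b a)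

    agreements-sum : ∀ k → sum (map (λ t → agreements (lookup (table k)) (lookup (table t))) (allFin 24)) ≡ 24
    agreements-sum = from-yes (all? λ k → sum (map (λ t → agreements (lookup (table k)) (lookup (table t))) (allFin 24)) ℕ.≟ 24)

  agreements-sym : ∀ f g → agreements f g ≡ agreements g f
  agreements-sym f g = cong₂ ℕ._+_ (eq (# 0)) (cong₂ ℕ._+_ (eq (# 1)) (cong₂ ℕ._+_ (eq (# 2)) (eq (# 3))))
    where eq = λ i → same-sym (f i) (g i)

  agreements-cong : ∀ {f f′ g g′ : Fin 4 → Fin 4} → (∀ i → f i ≡ f′ i) → (∀ i → g i ≡ g′ i) → agreements f g ≡ agreements f′ g′
  agreements-cong f≡ g≡ = cong₂ ℕ._+_ (eq (# 0)) (cong₂ ℕ._+_ (eq (# 1)) (cong₂ ℕ._+_ (eq (# 2)) (eq (# 3))))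
    where eq = λ i → cong₂ same (f≡ i) (g≡ i)

  private
    total : (Fin 4 → ℕ) → ℕ
    total F = F (# 0) ℕ.+ (F (# 1) ℕ.+ (F (# 2) ℕ.+ F (# 3)))

    total-mono : ∀ {F G : Fin 4 → ℕ} → (∀ i → F i ℕ.≤ G i) → total F ℕ.≤ total G
    total-mono le = ℕₚ.+-mono-≤ (le (# 0)) (ℕₚ.+-mono-≤ (le (# 1)) (ℕₚ.+-mono-≤ (le (# 2)) (le (# 3))))

    term≤total : ∀ (F : Fin 4 → ℕ) i → F i ℕ.≤ total F
    term≤total F zero = ℕₚ.m≤m+n _ _
    term≤total F (suc zero) = ℕₚ.≤-trans (ℕₚ.m≤m+n _ _) (ℕₚ.m≤n+m _ (F (# 0)))
    term≤total F (suc (suc zero)) = ℕₚ.≤-trans (ℕₚ.m≤m+n _ _) (ℕₚ.≤-trans (ℕₚ.m≤n+m _ (F (# 1))) (ℕₚ.m≤n+m _ (F (# 0))))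
    term≤total F (suc (suc (suc zero))) = ℕₚ.≤-trans (ℕₚ.m≤n+m _ (F (# 2))) (ℕₚ.≤-trans (ℕₚ.m≤n+m _ (F (# 1))) (ℕₚ.m≤n+m _ (F (# 0))))

    total-+ : ∀ (F G : Fin 4 → ℕ) → total (λ i → F i ℕ.+ G i) ≡ total F ℕ.+ total G
    total-+ F G = interchange (F (# 0)) (F (# 1)) (F (# 2)) (F (# 3)) (G (# 0)) (G (# 1)) (G (# 2)) (G (# 3))
      where
      interchange : ∀ a b c d a′ b′ c′ d′ → (a ℕ.+ a′) ℕ.+ ((b ℕ.+ b′) ℕ.+ ((c ℕ.+ c′) ℕ.+ (d ℕ.+ d′)))
                    ≡ a ℕ.+ (b ℕ.+ (c ℕ.+ d)) ℕ.+ (a′ ℕ.+ (b′ ℕ.+ (c′ ℕ.+ d′)))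
      interchange = ℕ-solve-∀

    total-zero : ∀ F → total F ≡ 0 → ∀ i → F i ≡ 0
    total-zero F eq i = ℕₚ.n≤0⇒n≡0 (subst (F i ℕ.≤_) eq (term≤total F i))

    total-tight : ∀ (F : Fin 4 → ℕ) → (∀ i → F i ℕ.≤ 2) → total F ≡ 8 → ∀ i → F i ≡ 2
    total-tight F le eq i = ℕₚ.≤-antisym (le i) (ℕₚ.m∸n≡0⇒m≤n (total-zero (λ i → 2 ℕ.∸ F i) slack i))
      where
      slack : total (λ i → 2 ℕ.∸ F i) ≡ 0
      slack = ℕₚ.+-cancelˡ-≡ 8 _ 0 (trans (cong (ℕ._+ total (λ i → 2 ℕ.∸ F i)) (sym eq))
        (trans (sym (total-+ F (λ i → 2 ℕ.∸ F i))) (cong₂ ℕ._+_ (two (# 0)) (cong₂ ℕ._+_ (two (# 1)) (cong₂ ℕ._+_ (two (# 2)) (two (# 3)))))))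
        where
        two : ∀ i → F i ℕ.+ (2 ℕ.∸ F i) ≡ 2
        two i = ℕₚ.m+[n∸m]≡n (le i)

  module _ (f g h k : Fin 4 → Fin 4) where

    disjoint⇒all-one : agreements f g ≡ 0 → agreements f h ≡ 0 → agreements f k ≡ 0 → agreements g h ≡ 0 → agreements g k ≡ 0 → agreements h k ≡ 0 →
      ∀ i j → ind (f i) j ℤ.+ ind (g i) j ℤ.+ ind (h i) j ℤ.+ ind (k i) j ≡ ℤ.+ 1
    disjoint⇒all-one fg fh fk gh gk hk i = row-ones (f i) (g i) (h i) (k i)
      (cong₂ ℕ._+_ (cong₂ ℕ._+_ (cong₂ ℕ._+_ (cong₂ ℕ._+_ (cong₂ ℕ._+_ (at f g fg) (at f h fh)) (at f k fk)) (at g h gh)) (at g k gk)) (at h k hk))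
      where
      at : ∀ (u v : Fin 4 → Fin 4) → agreements u v ≡ 0 → same (u i) (v i) ≡ 0
      at u v eq = total-zero (λ i → same (u i) (v i)) eq i

    -- The cross agreements total 8, while each of the four rows admits at most 2. So every row
    -- attains equality in the squared-length inequality.
    paired⇒zero : agreements f g ≡ 0 → agreements h k ≡ 0 → agreements f h ≡ 2 → agreements f k ≡ 2 → agreements g h ≡ 2 → agreements g k ≡ 2 →
      ∀ i j → ind (f i) j ℤ.+ ind (g i) j ℤ.- ind (h i) j ℤ.- ind (k i) j ≡ ℤ.+ 0
    paired⇒zero fg hk fh fk gh gk i = row-pairs-≡ (f i) (g i) (h i) (k i) (trans (total-tight cross cross≤ cross-total i) (sym (bound i)))
      where
      cross : Fin 4 → ℕ
      cross i = same (f i) (h i) ℕ.+ same (f i) (k i) ℕ.+ same (g i) (h i) ℕ.+ same (g i) (k i)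
      bound : ∀ i → 2 ℕ.+ (same (f i) (g i) ℕ.+ same (h i) (k i)) ≡ 2
      bound i = cong (2 ℕ.+_) (cong₂ ℕ._+_ (total-zero (λ i → same (f i) (g i)) fg i) (total-zero (λ i → same (h i) (k i)) hk i))
      cross≤ : ∀ i → cross i ℕ.≤ 2
      cross≤ i = subst (cross i ℕ.≤_) (bound i) (row-pairs-≤ (f i) (g i) (h i) (k i))
      cross-total : total cross ≡ 8
      cross-total = begin
        total cross
          ≡⟨ total-+ (λ i → s f h i ℕ.+ s f k i ℕ.+ s g h i) (s g k) ⟩
        total (λ i → s f h i ℕ.+ s f k i ℕ.+ s g h i) ℕ.+ total (s g k)
          ≡⟨ cong (ℕ._+ total (s g k)) (trans (total-+ (λ i → s f h i ℕ.+ s f k i) (s g h)) (cong (ℕ._+ total (s g h)) (total-+ (s f h) (s f k)))) ⟩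
        total (s f h) ℕ.+ total (s f k) ℕ.+ total (s g h) ℕ.+ total (s g k)
          ≡⟨ cong₂ ℕ._+_ (cong₂ ℕ._+_ (cong₂ ℕ._+_ fh fk) gh) gk ⟩
        8 ∎
        where
        open ≡-Reasoning
        s : (Fin 4 → Fin 4) → (Fin 4 → Fin 4) → Fin 4 → ℕ
        s u v i = same (u i) (v i)

    -- As `g`, `h`, `k` never agree with each other, `f` agrees with at most one of them in each
    -- row: at most 4 agreements in all, against the required 6.
    no-triple : agreements f g ≡ 2 → agreements f h ≡ 2 → agreements f k ≡ 2 → agreements g h ≡ 0 → agreements g k ≡ 0 → agreements h k ≡ 0 → ⊥
    no-triple fg fh fk gh gk hk with subst (ℕ._≤ 4) star-total (total-mono {star} {λ _ → 1} star≤)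
      where
      star : Fin 4 → ℕ
      star i = same (f i) (g i) ℕ.+ same (f i) (h i) ℕ.+ same (f i) (k i)
      at : ∀ (u v : Fin 4 → Fin 4) → agreements u v ≡ 0 → ∀ i → same (u i) (v i) ≡ 0
      at u v eq = total-zero (λ i → same (u i) (v i)) eq
      star≤ : ∀ i → star i ℕ.≤ 1
      star≤ i = subst (star i ℕ.≤_) (cong suc (cong₂ ℕ._+_ (cong₂ ℕ._+_ (at g h gh i) (at g k gk i)) (at h k hk i))) (row-triple (f i) (g i) (h i) (k i))
      star-total : total star ≡ 6
      star-total = trans (total-+ (λ i → s f g i ℕ.+ s f h i) (s f k)) (cong₂ ℕ._+_ (trans (total-+ (s f g) (s f h)) (cong₂ ℕ._+_ fg fh)) fk)
        where
        s : (Fin 4 → Fin 4) → (Fin 4 → Fin 4) → Fin 4 → ℕ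
        s u v i = same (u i) (v i)
    ... | ℕ.s≤s (ℕ.s≤s (ℕ.s≤s (ℕ.s≤s ())))

  -- Gram matrices over the rationals and a dual system for five permutations

  ζ : ℤ → ℚ
  ζ i = i / 1

  private
    toℚᵘ-ζ : ∀ i → toℚᵘ (ζ i) ℚᵘ.≃ mkℚᵘ i 0
    toℚᵘ-ζ i = toℚᵘ-fromℚᵘ (mkℚᵘ i 0)

  ζ-+ : ∀ i j → ζ (i ℤ.+ j) ≡ ζ i + ζ j
  ζ-+ i j = toℚᵘ-injective (begin
    toℚᵘ (ζ (i ℤ.+ j))                 ≈⟨ toℚᵘ-ζ (i ℤ.+ j) ⟩
    mkℚᵘ (i ℤ.+ j) 0                   ≈⟨ *≡* (cong (ℤ._* ℤ.+ 1) (sym (cong₂ ℤ._+_ (ℤₚ.*-identityʳ i) (ℤₚ.*-identityʳ j)))) ⟩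
    mkℚᵘ i 0 ℚᵘ.+ mkℚᵘ j 0             ≈⟨ ℚᵘₚ.+-cong (toℚᵘ-ζ i) (toℚᵘ-ζ j) ⟨
    toℚᵘ (ζ i) ℚᵘ.+ toℚᵘ (ζ j)         ≈⟨ toℚᵘ-homo-+ (ζ i) (ζ j) ⟨
    toℚᵘ (ζ i + ζ j)                   ∎)
    where open ℚᵘₚ.≃-Reasoning

  ζ-* : ∀ i j → ζ (i ℤ.* j) ≡ ζ i * ζ j
  ζ-* i j = toℚᵘ-injective (begin
    toℚᵘ (ζ (i ℤ.* j))                 ≈⟨ toℚᵘ-ζ (i ℤ.* j) ⟩
    mkℚᵘ (i ℤ.* j) 0                   ≈⟨ *≡* refl ⟩
    mkℚᵘ i 0 ℚᵘ.* mkℚᵘ j 0             ≈⟨ ℚᵘₚ.*-cong (toℚᵘ-ζ i) (toℚᵘ-ζ j) ⟨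
    toℚᵘ (ζ i) ℚᵘ.* toℚᵘ (ζ j)         ≈⟨ toℚᵘ-homo-* (ζ i) (ζ j) ⟨
    toℚᵘ (ζ i * ζ j)                   ∎)
    where open ℚᵘₚ.≃-Reasoning

  ζ-∑ : ∀ {I : Set} (xs : List I) f → ζ (∑ᶻ xs f) ≡ ∑ xs (λ x → ζ (f x))
  ζ-∑ []       f = refl
  ζ-∑ (x ∷ xs) f = trans (ζ-+ (f x) (∑ᶻ xs f)) (cong (λ t → ζ (f x) + t) (ζ-∑ xs f))

  ζ-nonZero : ∀ {i} → i ≢ ℤ.+ 0 → ζ i ≢ 0ℚ
  ζ-nonZero {i} i≢0 eq with ℚᵘₚ.≃-trans (ℚᵘₚ.≃-sym (toℚᵘ-ζ i)) (toℚᵘ-cong eq)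
  ... | *≡* e = i≢0 (trans (sym (ℤₚ.*-identityʳ i)) e)

  inverseOf : ∀ p → p ≢ 0ℚ → ∃ λ q → p * q ≡ 1ℚ
  inverseOf p p≢0 = 1/_ p {{≢-nonZero p≢0}} , *-inverseʳ p {{≢-nonZero p≢0}}

  -- Inverting a symmetric matrix bordered by one row: if adj is D times the inverse of G, then
  -- the bordered matrix with corner 3 is invertible as soon as its Schur complement q / D is nonzero.
  module Bordered (G adj : Fin 4 → Fin 4 → ℚ) (D D⁻¹ : ℚ) (DD⁻¹ : D * D⁻¹ ≡ 1ℚ)
    (G-adj : ∀ i j → ∑ (allFin 4) (λ k → G i k * adj k j) ≡ D * δ i j) (g : Fin 4 → ℚ) where

    u : Fin 4 → ℚ
    u j = ∑ (allFin 4) (λ k → adj j k * g k)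

    q : ℚ
    q = ι 3 * D - ∑ (allFin 4) (λ j → u j * g j)

    module _ (q⁻¹ : ℚ) (qq⁻¹ : q * q⁻¹ ≡ 1ℚ) where

      private
        -- `u` pairs `g` with the rows of `adj`, `u′` with its columns. Keeping them apart lets the
        -- block inverse be verified from `G-adj` alone.
        u′ : Fin 4 → ℚ
        u′ j = ∑ (allFin 4) (λ k → adj k j * g k)

        G-u : ∀ i → ∑ (allFin 4) (λ k → u k * G i k) ≡ D * g i
        G-u i = begin
          ∑ (allFin 4) (λ k → u k * G i k)
            ≡⟨ ∑-cong (allFin 4) (λ k → sym (∑-*ʳ (allFin 4) (G i k) (λ j → adj k j * g j))) ⟩
          ∑ (allFin 4) (λ k → ∑ (allFin 4) (λ j → adj k j * g j * G i k))
            ≡⟨ ∑-swap (allFin 4) (allFin 4) (λ k j → adj k j * g j * G i k) ⟩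
          ∑ (allFin 4) (λ j → ∑ (allFin 4) (λ k → adj k j * g j * G i k))
            ≡⟨ ∑-cong (allFin 4) (λ j → trans (∑-cong (allFin 4) (λ k → regroup (adj k j) (g j) (G i k)))
                 (trans (∑-*ʳ (allFin 4) (g j) (λ k → G i k * adj k j)) (cong (_* g j) (G-adj i j)))) ⟩
          ∑ (allFin 4) (λ j → D * δ i j * g j)
            ≡⟨ ∑-cong (allFin 4) (λ j → trans (cong (λ t → D * t * g j) (δ-sym i j)) (regroup′ D (δ j i) (g j))) ⟩
          ∑ (allFin 4) (λ j → D * g j * δ j i)
            ≡⟨ ∑-δ 4 (λ j → D * g j) i ⟩
          D * g i ∎
          where
          open ≡-Reasoning
          regroup : ∀ a b c → a * b * c ≡ c * a * b
          regroup = solve-∀ ℚ-ring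
          regroup′ : ∀ a b c → a * b * c ≡ a * c * b
          regroup′ = solve-∀ ℚ-ring
          δ-sym : ∀ (i j : Fin 4) → δ i j ≡ δ j i
          δ-sym = from-yes (all? λ (i : Fin 4) → all? λ (j : Fin 4) → δ i j ≟ δ j i)

      bordered : Fin 5 → Fin 5 → ℚ
      bordered zero    zero    = ι 3
      bordered zero    (suc k) = g k
      bordered (suc i) zero    = g i
      bordered (suc i) (suc k) = G i k

      -- Block inversion through the Schur complement q / D, transposed: `inverse j` is meant as the
      -- coefficient row of the j-th dual matrix.
      inverse : Fin 5 → Fin 5 → ℚ
      inverse zero    zero    = D * q⁻¹
      inverse zero    (suc k) = - (u k * q⁻¹)
      inverse (suc j) zero    = - (u′ j * q⁻¹)
      inverse (suc j) (suc k) = adj k j * D⁻¹ + u′ j * D⁻¹ * q⁻¹ * u k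

      inverse-bordered : ∀ i j → ∑ (allFin 5) (λ k → inverse j k * bordered i k) ≡ δ j i
      inverse-bordered i j = trans (cong (λ t → inverse j zero * bordered i zero + t) (∑-suc (λ k → inverse j k * bordered i k))) (go i j)
        where
        open ≡-Reasoning
        ∑-suc : ∀ (F : Fin 5 → ℚ) → ∑ (List.tabulate suc) F ≡ ∑ (allFin 4) (λ k → F (suc k))
        ∑-suc F = refl
        S = ∑ (allFin 4) (λ j → u j * g j)
        minus : ∀ (F : Fin 4 → ℚ) → ∑ (allFin 4) (λ k → - (u k * q⁻¹) * F k) ≡ - (q⁻¹ * ∑ (allFin 4) (λ k → u k * F k))
        minus F = trans (∑-cong (allFin 4) (λ k → regroup (u k) q⁻¹ (F k))) (trans (∑-*ˡ (allFin 4) (- q⁻¹) (λ k → u k * F k)) (sym (neg-distribˡ-* q⁻¹ (∑ (allFin 4) (λ k → u k * F k)))))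
          where
          regroup : ∀ a b c → - (a * b) * c ≡ - b * (a * c)
          regroup = solve-∀ ℚ-ring
        mixed : ∀ j (F : Fin 4 → ℚ) → ∑ (allFin 4) (λ k → (adj k j * D⁻¹ + u′ j * D⁻¹ * q⁻¹ * u k) * F k)
                ≡ D⁻¹ * ∑ (allFin 4) (λ k → adj k j * F k) + u′ j * D⁻¹ * q⁻¹ * ∑ (allFin 4) (λ k → u k * F k)
        mixed j F = trans (∑-cong (allFin 4) (λ k → regroup (adj k j) D⁻¹ (u′ j * D⁻¹ * q⁻¹) (u k) (F k)))
          (trans (∑-+ (allFin 4) (λ k → D⁻¹ * (adj k j * F k)) (λ k → u′ j * D⁻¹ * q⁻¹ * (u k * F k)))
            (cong₂ _+_ (∑-*ˡ (allFin 4) D⁻¹ (λ k → adj k j * F k)) (∑-*ˡ (allFin 4) (u′ j * D⁻¹ * q⁻¹) (λ k → u k * F k))))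
          where
          regroup : ∀ a d c u f → (a * d + c * u) * f ≡ d * (a * f) + c * (u * f)
          regroup = solve-∀ ℚ-ring
        go : ∀ i j → inverse j zero * bordered i zero + ∑ (allFin 4) (λ k → inverse j (suc k) * bordered i (suc k)) ≡ δ j i
        go zero zero = begin
          D * q⁻¹ * ι 3 + ∑ (allFin 4) (λ k → - (u k * q⁻¹) * g k)   ≡⟨ cong (λ t → D * q⁻¹ * ι 3 + t) (minus g) ⟩
          D * q⁻¹ * ι 3 + - (q⁻¹ * S)                                ≡⟨ regroup D q⁻¹ S ⟩
          q * q⁻¹                                                    ≡⟨ qq⁻¹ ⟩
          1ℚ                                                         ∎
          where
          regroup : ∀ D c S → D * c * ι 3 + - (c * S) ≡ (ι 3 * D - S) * c
          regroup = solve-∀ ℚ-ring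
        go (suc i) zero = begin
          D * q⁻¹ * g i + ∑ (allFin 4) (λ k → - (u k * q⁻¹) * G i k)                    ≡⟨ cong (λ t → D * q⁻¹ * g i + t) (trans (minus (G i)) (cong (λ t → - (q⁻¹ * t)) (G-u i))) ⟩
          D * q⁻¹ * g i + - (q⁻¹ * (D * g i))                                           ≡⟨ cancel D q⁻¹ (g i) ⟩
          0ℚ                                                                            ∎
          where
          cancel : ∀ D c g → D * c * g + - (c * (D * g)) ≡ 0ℚ
          cancel = solve-∀ ℚ-ring
        go zero (suc j) = begin
          - (u′ j * q⁻¹) * ι 3 + ∑ (allFin 4) (λ k → (adj k j * D⁻¹ + u′ j * D⁻¹ * q⁻¹ * u k) * g k)
            ≡⟨ cong (λ t → - (u′ j * q⁻¹) * ι 3 + t) (mixed j g) ⟩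
          - (u′ j * q⁻¹) * ι 3 + (D⁻¹ * u′ j + u′ j * D⁻¹ * q⁻¹ * S)
            ≡⟨ regroup (u′ j) q⁻¹ D⁻¹ S D ⟩
          u′ j * (D⁻¹ * (1ℚ - q * q⁻¹) + ι 3 * q⁻¹ * (D * D⁻¹ - 1ℚ))
            ≡⟨ cong₂ (λ a b → u′ j * (D⁻¹ * (1ℚ - a) + ι 3 * q⁻¹ * (b - 1ℚ))) qq⁻¹ DD⁻¹ ⟩
          u′ j * (D⁻¹ * (1ℚ - 1ℚ) + ι 3 * q⁻¹ * (1ℚ - 1ℚ))
            ≡⟨ vanish (u′ j) D⁻¹ q⁻¹ ⟩
          0ℚ ∎
          where
          regroup : ∀ u c d S D → - (u * c) * ι 3 + (d * u + u * d * c * S) ≡ u * (d * (1ℚ - (ι 3 * D - S) * c) + ι 3 * c * (D * d - 1ℚ))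
          regroup = solve-∀ ℚ-ring
          vanish : ∀ u d c → u * (d * (1ℚ - 1ℚ) + ι 3 * c * (1ℚ - 1ℚ)) ≡ 0ℚ
          vanish = solve-∀ ℚ-ring
        go (suc i) (suc j) = begin
          - (u′ j * q⁻¹) * g i + ∑ (allFin 4) (λ k → (adj k j * D⁻¹ + u′ j * D⁻¹ * q⁻¹ * u k) * G i k)
            ≡⟨ cong (λ t → - (u′ j * q⁻¹) * g i + t) (trans (mixed j (G i)) (cong₂ (λ a b → D⁻¹ * a + u′ j * D⁻¹ * q⁻¹ * b)
                 (trans (∑-cong (allFin 4) (λ k → *-comm (adj k j) (G i k))) (G-adj i j)) (G-u i))) ⟩
          - (u′ j * q⁻¹) * g i + (D⁻¹ * (D * δ i j) + u′ j * D⁻¹ * q⁻¹ * (D * g i))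
            ≡⟨ regroup (u′ j) q⁻¹ (g i) D⁻¹ D (δ i j) ⟩
          D * D⁻¹ * δ i j + u′ j * q⁻¹ * g i * (D * D⁻¹ - 1ℚ)
            ≡⟨ cong (λ t → t * δ i j + u′ j * q⁻¹ * g i * (t - 1ℚ)) DD⁻¹ ⟩
          1ℚ * δ i j + u′ j * q⁻¹ * g i * (1ℚ - 1ℚ)
            ≡⟨ vanish (δ i j) (u′ j * q⁻¹ * g i) ⟩
          δ i j
            ≡⟨ δ-sym i j ⟩
          δ (suc j) (suc i) ∎
          where
          regroup : ∀ u c g d D e → - (u * c) * g + (d * (D * e) + u * d * c * (D * g)) ≡ D * d * e + u * c * g * (D * d - 1ℚ)
          regroup = solve-∀ ℚ-ring
          vanish : ∀ e x → 1ℚ * e + x * (1ℚ - 1ℚ) ≡ e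
          vanish = solve-∀ ℚ-ring
          δ-sym : ∀ (i j : Fin 4) → δ i j ≡ δ (Fin.suc j) (suc i)
          δ-sym = from-yes (all? λ (i : Fin 4) → all? λ (j : Fin 4) → δ i j ≟ δ (Fin.suc j) (suc i))

  ι-sum : ∀ {I : Set} (F : I → ℕ) xs → ι (sum (map F xs)) ≡ ∑ xs (λ x → ι (F x))
  ι-sum F []       = refl
  ι-sum F (x ∷ xs) = trans (ι-+ (F x) (sum (map F xs))) (cong (λ t → ι (F x) + t) (ι-sum F xs))

  gramℚ : (Fin 4 → Fin 4) → (Fin 4 → Fin 4) → ℚ
  gramℚ f g = ι (agreements f g) - 1ℚ

  ζ-gram : ∀ f g → ζ (gram f g) ≡ gramℚ f g
  ζ-gram f g = ζ-+ (ℤ.+ agreements f g) (ℤ.- ℤ.+ 1)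

  agreements-refl : ∀ f → agreements f f ≡ 4
  agreements-refl f = cong₂ ℕ._+_ (eq (f (# 0))) (cong₂ ℕ._+_ (eq (f (# 1))) (cong₂ ℕ._+_ (eq (f (# 2))) (eq (f (# 3)))))
    where
    eq : ∀ a → same a a ≡ 1
    eq = from-yes (all? λ a → same a a ℕ.≟ 1)

  -- The tight frame identity for the projected permutation matrices. The frame constant is 8, since
  -- 24 vectors of squared length 3 in dimension 9 give 72 = 8·9.
  ∑-gram-square : ∀ k l → ∑ (allFin 24) (λ t → gramℚ (lookup (table k)) (lookup (table t)) * gramℚ (lookup (table l)) (lookup (table t)))
                  ≡ ι 8 * gramℚ (lookup (table k)) (lookup (table l))
  ∑-gram-square k l = begin
    ∑ Ts (λ t → (a k t - 1ℚ) * (a l t - 1ℚ))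
      ≡⟨ ∑-cong Ts (λ t → expand (a k t) (a l t)) ⟩
    ∑ Ts (λ t → a k t * a l t + 1ℚ - (a k t + a l t))
      ≡⟨ trans (∑-- Ts (λ t → a k t * a l t + 1ℚ) (λ t → a k t + a l t)) (cong₂ _-_ (∑-+ Ts (λ t → a k t * a l t) (λ _ → 1ℚ)) (∑-+ Ts (a k) (a l))) ⟩
    ∑ Ts (λ t → a k t * a l t) + ι 24 - (∑ Ts (a k) + ∑ Ts (a l))
      ≡⟨ cong₂ (λ x y → x + ι 24 - y) square (cong₂ _+_ (first k) (first l)) ⟩
    ι 8 * a k l + ι 16 + ι 24 - (ι 24 + ι 24)
      ≡⟨ collect (a k l) ⟩
    ι 8 * (a k l - 1ℚ) ∎
    where
    open ≡-Reasoning
    Ts = allFin 24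
    a : Fin 24 → Fin 24 → ℚ
    a k t = ι (agreements (lookup (table k)) (lookup (table t)))
    expand : ∀ x y → (x - 1ℚ) * (y - 1ℚ) ≡ x * y + 1ℚ - (x + y)
    expand = solve-∀ ℚ-ring
    collect : ∀ x → ι 8 * x + ι 16 + ι 24 - (ι 24 + ι 24) ≡ ι 8 * (x - 1ℚ)
    collect = solve-∀ ℚ-ring
    first : ∀ k → ∑ Ts (a k) ≡ ι 24
    first k = trans (sym (ι-sum (λ t → agreements (lookup (table k)) (lookup (table t))) Ts)) (cong ι (agreements-sum k))
    square : ∑ Ts (λ t → a k t * a l t) ≡ ι 8 * a k l + ι 16
    square = begin
      ∑ Ts (λ t → a k t * a l t)
        ≡⟨ ∑-cong Ts (λ t → ι-* (agreements (lookup (table k)) (lookup (table t))) (agreements (lookup (table l)) (lookup (table t)))) ⟨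
      ∑ Ts (λ t → ι (agreements (lookup (table k)) (lookup (table t)) ℕ.* agreements (lookup (table l)) (lookup (table t))))
        ≡⟨ ι-sum (λ t → agreements (lookup (table k)) (lookup (table t)) ℕ.* agreements (lookup (table l)) (lookup (table t))) Ts ⟨
      ι (sum (map (λ t → agreements (lookup (table k)) (lookup (table t)) ℕ.* agreements (lookup (table l)) (lookup (table t))) Ts))
        ≡⟨ cong ι (agreements-square k l) ⟩
      ι (8 ℕ.* agreements (lookup (table k)) (lookup (table l)) ℕ.+ 16)
        ≡⟨ trans (ι-+ (8 ℕ.* agreements (lookup (table k)) (lookup (table l))) 16) (cong (λ x → x + ι 16) (ι-* 8 (agreements (lookup (table k)) (lookup (table l))))) ⟩
      ι 8 * a k l + ι 16 ∎

  nonzero-term : ∀ {n} (F : Fin n → ℚ) → ∑ (allFin n) F ≢ 0ℚ → ∃ λ t → F t ≢ 0ℚ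
  nonzero-term {n} F ∑≢0 with any? (λ t → ¬? (F t ≟ 0ℚ))
  ... | yes found = found
  ... | no  none  = ⊥-elim (∑≢0 (trans (∑-cong (allFin n) (λ t → decidable-stable (F t ≟ 0ℚ) (λ F≢0 → none (t , F≢0))))
    (trans (∑-const (allFin n) 0ℚ) (*-zeroʳ (ι (length (allFin n)))))))

  module DualMatrices (π : Fin 4 → Permutation′ 4) (G adj : Fin 4 → Fin 4 → ℚ) (D : ℚ) (D≢0 : D ≢ 0ℚ)
    (G≡ : ∀ i j → G i j ≡ gramℚ (π i ⟨$⟩ʳ_) (π j ⟨$⟩ʳ_))
    (G-adj : ∀ i j → ∑ (allFin 4) (λ k → G i k * adj k j) ≡ D * δ i j) where

    private
      f : Fin 4 → Fin 4 → Fin 4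
      f i = π i ⟨$⟩ʳ_

      g : Fin 24 → Fin 4 → ℚ
      g t k = gramℚ (f k) (lookup (table t))

      ∑-g : ∀ j k → ∑ (allFin 24) (λ t → g t j * g t k) ≡ ι 8 * G j k
      ∑-g j k = begin
        ∑ (allFin 24) (λ t → g t j * g t k)
          ≡⟨ ∑-cong (allFin 24) (λ t → cong₂ _*_ (swap j t) (swap k t)) ⟩
        ∑ (allFin 24) (λ t → gramℚ (lookup (table (c j))) (lookup (table t)) * gramℚ (lookup (table (c k))) (lookup (table t)))
          ≡⟨ ∑-gram-square (c j) (c k) ⟩
        ι 8 * gramℚ (lookup (table (c j))) (lookup (table (c k)))
          ≡⟨ cong (λ x → ι 8 * (ι x - 1ℚ)) (agreements-cong (proj₂ (index (π j))) (proj₂ (index (π k)))) ⟨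
        ι 8 * gramℚ (f j) (f k)
          ≡⟨ cong (λ x → ι 8 * x) (G≡ j k) ⟨
        ι 8 * G j k ∎
        where
        open ≡-Reasoning
        c : Fin 4 → Fin 24
        c i = proj₁ (index (π i))
        swap : ∀ i t → g t i ≡ gramℚ (lookup (table (c i))) (lookup (table t))
        swap i t = cong (λ x → ι x - 1ℚ) (agreements-cong {g = lookup (table t)} (proj₂ (index (π i))) (λ _ → refl))

      D⁻¹ = proj₁ (inverseOf D D≢0)

      module Border (t : Fin 24) = Bordered G adj D D⁻¹ (proj₂ (inverseOf D D≢0)) G-adj (g t)

      -- The Schur complements average to a trace: the projection away from the span of the
      -- four permutation matrices has rank 9 − 4 = 5, and 24 · (1/3) · 5 = 40.
      ∑-q : ∑ (allFin 24) Border.q ≡ ι 40 * D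
      ∑-q = begin
        ∑ Ts (λ t → ι 3 * D - ∑ F (λ j → ∑ F (λ k → adj j k * g t k) * g t j))
          ≡⟨ ∑-- Ts (λ _ → ι 3 * D) (λ t → ∑ F (λ j → ∑ F (λ k → adj j k * g t k) * g t j)) ⟩
        ∑ Ts (λ _ → ι 3 * D) - ∑ Ts (λ t → ∑ F (λ j → ∑ F (λ k → adj j k * g t k) * g t j))
          ≡⟨ cong₂ _-_ (∑-const Ts (ι 3 * D)) quadratic ⟩
        ι 24 * (ι 3 * D) - ι 8 * (ι 4 * D)
          ≡⟨ collect D ⟩
        ι 40 * D ∎
        where
        open ≡-Reasoning
        Ts = allFin 24
        F = allFin 4
        collect : ∀ d → ι 24 * (ι 3 * d) - ι 8 * (ι 4 * d) ≡ ι 40 * d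
        collect = solve-∀ ℚ-ring
        quadratic : ∑ Ts (λ t → ∑ F (λ j → ∑ F (λ k → adj j k * g t k) * g t j)) ≡ ι 8 * (ι 4 * D)
        quadratic = begin
          ∑ Ts (λ t → ∑ F (λ j → ∑ F (λ k → adj j k * g t k) * g t j))
            ≡⟨ ∑-swap Ts F (λ t j → ∑ F (λ k → adj j k * g t k) * g t j) ⟩
          ∑ F (λ j → ∑ Ts (λ t → ∑ F (λ k → adj j k * g t k) * g t j))
            ≡⟨ ∑-cong F (λ j → trans (∑-cong Ts (λ t → sym (∑-*ʳ F (g t j) (λ k → adj j k * g t k)))) (∑-swap Ts F (λ t k → adj j k * g t k * g t j))) ⟩
          ∑ F (λ j → ∑ F (λ k → ∑ Ts (λ t → adj j k * g t k * g t j)))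
            ≡⟨ ∑-cong F (λ j → ∑-cong F (λ k → trans (∑-cong Ts (λ t → *-assoc (adj j k) (g t k) (g t j)))
                 (trans (∑-*ˡ Ts (adj j k) (λ t → g t k * g t j)) (trans (cong (λ x → adj j k * x) (∑-g k j)) (regroup (adj j k) (G k j)))))) ⟩
          ∑ F (λ j → ∑ F (λ k → ι 8 * (G k j * adj j k)))
            ≡⟨ trans (∑-cong F (λ j → ∑-*ˡ F (ι 8) (λ k → G k j * adj j k))) (∑-*ˡ F (ι 8) (λ j → ∑ F (λ k → G k j * adj j k))) ⟩
          ι 8 * ∑ F (λ j → ∑ F (λ k → G k j * adj j k))
            ≡⟨ cong (λ x → ι 8 * x) (trans (∑-swap F F (λ j k → G k j * adj j k)) (trans (∑-cong F (λ k → G-adj k k)) trace)) ⟩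
          ι 8 * (ι 4 * D) ∎
          where
          regroup : ∀ a b → a * (ι 8 * b) ≡ ι 8 * (b * a)
          regroup = solve-∀ ℚ-ring
          trace : ∑ F (λ k → D * δ k k) ≡ ι 4 * D
          trace = sums D
            where
            sums : ∀ d → d * 1ℚ + (d * 1ℚ + (d * 1ℚ + (d * 1ℚ + 0ℚ))) ≡ ι 4 * d
            sums = solve-∀ ℚ-ring

      -- The total 40·D is nonzero, so some summand is. A nonzero Schur complement places the
      -- projection of that permutation outside the span of the other four.
      independent : ∃ λ t → Border.q t ≢ 0ℚ
      independent = nonzero-term Border.q (λ sum≡0 → D≢0 (trans (scale D) (cong (λ x → (ℤ.+ 1 / 40) * x) (trans (sym ∑-q) sum≡0))))
        where
        scale : ∀ d → d ≡ (ℤ.+ 1 / 40) * (ι 40 * d)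
        scale = solve-∀ ℚ-ring

      t = proj₁ independent

      open Bordered G adj D D⁻¹ (proj₂ (inverseOf D D≢0)) G-adj (g t) using (bordered; inverse; inverse-bordered)

      q⁻¹ = proj₁ (inverseOf (Border.q t) (proj₂ independent))
      qq⁻¹ = proj₂ (inverseOf (Border.q t) (proj₂ independent))

    τ : Permutation′ 4
    τ = proj₁ (tablePermutation t)

    σ : Fin 5 → Permutation′ 4
    σ zero    = τ
    σ (suc s) = π s

    private
      τ≡ = proj₂ (tablePermutation t)

      bordered≡ : ∀ i k → bordered q⁻¹ qq⁻¹ i k ≡ gramℚ (σ i ⟨$⟩ʳ_) (σ k ⟨$⟩ʳ_)
      bordered≡ zero    zero    = sym (cong (λ x → ι x - 1ℚ) (agreements-refl (τ ⟨$⟩ʳ_)))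
      bordered≡ zero    (suc k) = cong (λ x → ι x - 1ℚ) (trans (agreements-sym (f k) (lookup (table t))) (sym (agreements-cong {g = f k} τ≡ (λ _ → refl))))
      bordered≡ (suc i) zero    = cong (λ x → ι x - 1ℚ) (sym (agreements-cong {f = f i} (λ _ → refl) τ≡))
      bordered≡ (suc i) (suc k) = G≡ i k

      -- The permutation matrix minus a quarter of the all-one matrix. Its pairing with an
      -- unprojected permutation matrix is already the Gram entry.
      projected : Permutation′ 4 → Fin 4 → Fin 4 → ℚ
      projected ρ p q = δ (ρ ⟨$⟩ʳ p) q - (ℤ.+ 1 / 4)

      projected-row : ∀ ρ p → ∑ (allFin 4) (projected ρ p) ≡ 0ℚ
      projected-row ρ p = row (ρ ⟨$⟩ʳ p)
        where
        row : ∀ a → ∑ (allFin 4) (λ q → δ a q - (ℤ.+ 1 / 4)) ≡ 0ℚ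
        row = from-yes (all? λ a → ∑ (allFin 4) (λ q → δ a q - (ℤ.+ 1 / 4)) ≟ 0ℚ)

      projected-gram : ∀ ρ ρ′ → ∑ (allFin 4) (λ p → projected ρ p (ρ′ ⟨$⟩ʳ p)) ≡ gramℚ (ρ′ ⟨$⟩ʳ_) (ρ ⟨$⟩ʳ_)
      projected-gram ρ ρ′ = begin
        ∑ (allFin 4) (λ p → δ (ρ ⟨$⟩ʳ p) (ρ′ ⟨$⟩ʳ p) - (ℤ.+ 1 / 4))
          ≡⟨ trans (∑-- (allFin 4) (λ p → δ (ρ ⟨$⟩ʳ p) (ρ′ ⟨$⟩ʳ p)) (λ _ → ℤ.+ 1 / 4))
               (cong (λ x → x - 1ℚ) (∑-cong (allFin 4) (λ p → sym (same-δ (ρ′ ⟨$⟩ʳ p) (ρ ⟨$⟩ʳ p))))) ⟩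
        ∑ (allFin 4) (λ p → ι (same (ρ′ ⟨$⟩ʳ p) (ρ ⟨$⟩ʳ p))) - 1ℚ
          ≡⟨ cong (λ x → x - 1ℚ) (sym (collect (s (# 0)) (s (# 1)) (s (# 2)) (s (# 3)))) ⟩
        gramℚ (ρ′ ⟨$⟩ʳ_) (ρ ⟨$⟩ʳ_) ∎
        where
        open ≡-Reasoning
        s : Fin 4 → ℕ
        s p = same (ρ′ ⟨$⟩ʳ p) (ρ ⟨$⟩ʳ p)
        collect : ∀ a b c d → ι (a ℕ.+ (b ℕ.+ (c ℕ.+ d))) ≡ ι a + (ι b + (ι c + (ι d + 0ℚ)))
        collect a b c d = trans (ι-+ a (b ℕ.+ (c ℕ.+ d))) (cong (λ x → ι a + x) (trans (ι-+ b (c ℕ.+ d)) (cong (λ x → ι b + x)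
          (trans (ι-+ c d) (cong (λ x → ι c + x) (sym (+-identityʳ (ι d))))))))

      c : Fin 5 → Fin 5 → ℚ
      c = inverse q⁻¹ qq⁻¹

    -- The dual basis is taken inside the span of the projected matrices, so it inherits their
    -- vanishing row sums.
    B : Fin 5 → Fin 4 → Fin 4 → ℚ
    B j p q = ∑ (allFin 5) (λ k → c j k * projected (σ k) p q)

    private
      -- Both row sums and pairings with permutation matrices are sums of entries.
      ∑-B : ∀ {I : Set} (xs : List I) (r s : I → Fin 4) j →
            ∑ xs (λ x → B j (r x) (s x)) ≡ ∑ (allFin 5) (λ k → c j k * ∑ xs (λ x → projected (σ k) (r x) (s x)))
      ∑-B xs r s j = trans (∑-swap xs (allFin 5) (λ x k → c j k * projected (σ k) (r x) (s x)))
        (∑-cong (allFin 5) (λ k → ∑-*ˡ xs (c j k) (λ x → projected (σ k) (r x) (s x))))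

    rowSum : ∀ j p → ∑ (allFin 4) (B j p) ≡ 0ℚ
    rowSum j p = trans (∑-B (allFin 4) (λ _ → p) (λ q → q) j)
      (trans (∑-cong (allFin 5) (λ k → trans (cong (λ x → c j k * x) (projected-row (σ k) p)) (*-zeroʳ (c j k)))) (∑-const (allFin 5) 0ℚ))

    dual : ∀ i j → ∑ (allFin 4) (λ p → B j p (σ i ⟨$⟩ʳ p)) ≡ δ j i
    dual i j = trans (∑-B (allFin 4) (λ p → p) (σ i ⟨$⟩ʳ_) j)
      (trans (∑-cong (allFin 5) (λ k → cong (λ x → c j k * x) (trans (projected-gram (σ k) (σ i)) (sym (bordered≡ i k))))) (inverse-bordered q⁻¹ qq⁻¹ i j))

  -- A sequence of permutations that refutes forcing

  abstract
    -- The shift by 2 makes it at most ½ from m = 0 on, as `approximate` requires.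
    tolerance : ℕ → ℚ
    tolerance m = ℤ.+ 1 / suc (suc m)

    tolerance-def : ∀ m → tolerance m * ι (suc (suc m)) ≡ 1ℚ
    tolerance-def m = /-*-cancel (ℤ.+ 1) (suc m)

    tolerance>0 : ∀ m → 0ℚ < tolerance m
    tolerance>0 m = positive⁻¹ (tolerance m) {{normalize-pos 1 (suc (suc m))}}

  module NotForcing {r : ℕ} (σ : Fin (suc r) → Permutation′ 4) (t : ℚ) (t>0 : 0ℚ < t)
    (approximate : ∀ ε → 0ℚ < ε → ε ≤ ½ → ∀ M →
      ∃ λ n → M ℕ.≤ n × ∃ λ (π : Permutation′ n) → ∀ i → ∣ ι 24 * density (σ i) π - (1ℚ + onlyFirst t i) ∣ ≤ ε) where

    private
      tolerance≤½ : ∀ m → tolerance m ≤ ½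
      tolerance≤½ m = *-cancelʳ-≤ (ι-suc>0 (suc m)) (subst (λ x → x ≤ ½ * ι (suc (suc m))) (sym (tolerance-def m))
        (*-monoˡ {ι 2} {ι (suc (suc m))} (nonNegative⁻¹ ½) (ι-mono {2} {suc (suc m)} (ℕ.s≤s (ℕ.s≤s ℕ.z≤n)))))

      tolerance→0 : ∀ ε → 0ℚ < ε → ∃ λ N → ∀ m → N ℕ.≤ m → tolerance m < ε
      tolerance→0 ε 0<ε =
        let 1/ε , def , _ = reciprocal 0<ε
            N , 1/ε≤N = archimedean 1/ε
        in N , λ m N≤m → *-cancelʳ-<-nonNeg (ι (suc (suc m))) {{nonNegative (ι≥0 (suc (suc m)))}}
        (subst (λ x → x < ε * ι (suc (suc m))) (sym (tolerance-def m)) (≤-<-trans (≤-trans (≤-reflexive (sym def)) (*-monoˡ (<⇒≤ 0<ε) (≤-trans 1/ε≤N (ι-mono N≤m))))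
          (*-monoʳ-<-pos ε {{positive 0<ε}} (step m))))
        where
        step : ∀ m → ι m < ι (suc (suc m))
        step m = subst₂ _<_ (+-identityˡ (ι m)) (sym (ι-+ 2 m)) (+-monoˡ-< (ι m) (ι-suc>0 1))

      -- Size and accuracy are both driven by `m`. In this diagonal sequence the approximate
      -- solutions have the exact target densities as limits, although no single permutation need
      -- attain them.
      realise : ∀ m → ∃ λ n → m ℕ.≤ n × ∃ λ (π : Permutation′ n) → ∀ i → ∣ ι 24 * density (σ i) π - (1ℚ + onlyFirst t i) ∣ ≤ tolerance m
      realise m = approximate (tolerance m) (tolerance>0 m) (tolerance≤½ m) m

      size : ℕ → ℕ
      size m = proj₁ (realise m)

      π : (m : ℕ) → Permutation′ (size m)
      π m = proj₁ (proj₂ (proj₂ (realise m)))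

      close : ∀ m i → ∣ ι 24 * density (σ i) (π m) - (1ℚ + onlyFirst t i) ∣ ≤ tolerance m
      close m = proj₂ (proj₂ (proj₂ (realise m)))

      size→∞ : TendsToInfinity size
      size→∞ M = M , λ m M≤m → ℕₚ.≤-trans M≤m (proj₁ (proj₂ (realise m)))

      24×distance : ∀ x → ∣ ι 24 * x - 1ℚ ∣ ≡ ι 24 * ∣ x - (ℤ.+ 1 / 24) ∣
      24×distance x = trans (cong ∣_∣ (factor x)) (∣p*q∣≡∣p∣*∣q∣ (ι 24) (x - (ℤ.+ 1 / 24)))
        where
        factor : ∀ x → ι 24 * x - 1ℚ ≡ ι 24 * (x - (ℤ.+ 1 / 24))
        factor = solve-∀ ℚ-ring

      converges : ∀ s → QRFor size π (4 , σ (suc s))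
      converges s ε 0<ε = let N , e< = tolerance→0 ε 0<ε in N , λ m N≤m → ≤-<-trans (≤-trans (distance≤ (density (σ (suc s)) (π m)))
        (subst (λ x → ∣ ι 24 * density (σ (suc s)) (π m) - x ∣ ≤ tolerance m) (+-identityʳ 1ℚ) (close m (suc s)))) (e< m N≤m)
        where
        distance≤ : ∀ x → ∣ x - (ℤ.+ 1 / 24) ∣ ≤ ∣ ι 24 * x - 1ℚ ∣
        distance≤ x = subst (λ y → ∣ x - (ℤ.+ 1 / 24) ∣ ≤ y) (sym (24×distance x))
          (by-slack (slack ∣ x - (ℤ.+ 1 / 24) ∣) (*-nonNeg (ι≥0 23) (0≤∣p∣ (x - (ℤ.+ 1 / 24)))))
          where
          slack : ∀ y → ι 24 * y - y ≡ ι 23 * y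
          slack = solve-∀ ℚ-ring

      diverges : ¬ QRFor size π (4 , σ zero)
      diverges conv = contradict (N₁ ℕ.+ N₂) (near (N₁ ℕ.+ N₂) (ℕₚ.m≤m+n N₁ N₂)) (e< (N₁ ℕ.+ N₂) (ℕₚ.m≤n+m N₂ N₁))
        where
        -- A density within t/48 of 1/24 has 24 times its value within t/2 of 1, while that value is
        -- eventually within t/2 of 1 + t. The strict inequalities are incompatible.
        ε = t * (ℤ.+ 1 / 48)
        N₁ = proj₁ (conv ε (*-pos t>0 (positive⁻¹ (ℤ.+ 1 / 48))))
        near = proj₂ (conv ε (*-pos t>0 (positive⁻¹ (ℤ.+ 1 / 48))))
        N₂ = proj₁ (tolerance→0 (½ * t) (*-pos (positive⁻¹ ½) t>0))
        e< = proj₂ (tolerance→0 (½ * t) (*-pos (positive⁻¹ ½) t>0))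
        contradict : ∀ m → ∣ density (σ zero) (π m) - (ℤ.+ 1 / 24) ∣ < t * (ℤ.+ 1 / 48) → tolerance m < ½ * t → ⊥
        contradict m near e< = <-irrefl refl (≤-<-trans t≤ (subst (λ x → ∣ ι 24 * d - 1ℚ ∣ + ∣ ι 24 * d - (1ℚ + t) ∣ < x) (halves t) (+-mono-< near′ far)))
          where
          d = density (σ zero) (π m)
          halves : ∀ t → ½ * t + ½ * t ≡ t
          halves = solve-∀ ℚ-ring
          near′ : ∣ ι 24 * d - 1ℚ ∣ < ½ * t
          near′ = subst₂ _<_ (sym (24×distance d)) (scale t) (*-monoʳ-<-pos (ι 24) {{positive (ι-suc>0 23)}} near)
            where
            scale : ∀ t → ι 24 * (t * (ℤ.+ 1 / 48)) ≡ ½ * t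
            scale = solve-∀ ℚ-ring
          far : ∣ ι 24 * d - (1ℚ + t) ∣ < ½ * t
          far = ≤-<-trans (close m zero) e<
          t≤ : t ≤ ∣ ι 24 * d - 1ℚ ∣ + ∣ ι 24 * d - (1ℚ + t) ∣
          t≤ = subst (λ x → x ≤ ∣ ι 24 * d - 1ℚ ∣ + ∣ ι 24 * d - (1ℚ + t) ∣) (telescope (ι 24 * d) t)
            (≤-trans (p≤∣p∣ ((ι 24 * d - 1ℚ) - (ι 24 * d - (1ℚ + t)))) (∣p-q∣≤∣p∣+∣q∣ (ι 24 * d - 1ℚ) (ι 24 * d - (1ℚ + t))))
            where
            telescope : ∀ x t → (x - 1ℚ) - (x - (1ℚ + t)) ≡ t
            telescope = solve-∀ ℚ-ring

    not-forcing : ∀ S → All (λ p → ∃ λ s → p ≡ (4 , σ (suc s))) S → ¬ QuasirandomForcing S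
    not-forcing S S⊆ forcing = diverges (forcing size π size→∞ (All.map (λ { (s , refl) → converges s }) S⊆) (4 , σ zero))

  module _ (π : Fin 4 → Permutation′ 4) where

    private
      f : Fin 4 → Fin 4 → Fin 4
      f i = π i ⟨$⟩ʳ_

      QR : Set
      QR = QuasirandomForcing (map (λ t → 4 , π t) (allFin 4))

    invertible⇒¬forcing : (m : Matrix) → (∀ i j → m i j ≡ gram (f i) (f j)) → Invertible m → ¬ QR
    invertible⇒¬forcing m m≡ (det≢0 , m-adj) = not-forcing (map (λ t → 4 , π t) (allFin 4)) (member (# 0) ∷ member (# 1) ∷ member (# 2) ∷ member (# 3) ∷ [])
      where
      G-adj : ∀ i j → ∑ (allFin 4) (λ k → ζ (m i k) * ζ (adjugate m k j)) ≡ ζ (determinant m) * δ i j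
      G-adj i j = begin
        ∑ (allFin 4) (λ k → ζ (m i k) * ζ (adjugate m k j))         ≡⟨ ∑-cong (allFin 4) (λ k → ζ-* (m i k) (adjugate m k j)) ⟨
        ∑ (allFin 4) (λ k → ζ (m i k ℤ.* adjugate m k j))           ≡⟨ ζ-∑ (allFin 4) (λ k → m i k ℤ.* adjugate m k j) ⟨
        ζ (∑ᶻ (allFin 4) (λ k → m i k ℤ.* adjugate m k j))          ≡⟨ cong ζ (m-adj i j) ⟩
        ζ (scalar (determinant m) i j)                              ≡⟨ ζ-scalar (determinant m) i j ⟩
        ζ (determinant m) * δ i j                                   ∎
        where
        open ≡-Reasoning
        ζ-scalar : ∀ d i j → ζ (scalar d i j) ≡ ζ d * δ i j
        ζ-scalar d i j with does (i Fin.≟ j)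
        ... | true  = sym (*-identityʳ (ζ d))
        ... | false = sym (*-zeroʳ (ζ d))

      open DualMatrices π (λ i j → ζ (m i j)) (λ i j → ζ (adjugate m i j)) (ζ (determinant m)) (ζ-nonZero det≢0)
        (λ i j → trans (cong ζ (m≡ i j)) (ζ-gram (f i) (f j))) G-adj
      open LocalSurjectivity σ B rowSum dual using (t; t>0; approximate)
      open NotForcing σ t t>0 approximate

      member : ∀ s → ∃ λ s′ → _≡_ {A = Perm} (4 , π s) (4 , σ (suc s′))
      member s = s , refl

open import Data.Integer using (ℤ; _+_; _-_; +_)

-- The singular agreement patterns, case by case

A≡ind : ∀ (π : Permutation′ 4) i j → A π i j ≡ ind (π ⟨$⟩ʳ i) j
A≡ind π i j with π ⟨$⟩ʳ i Fin.≟ j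
... | yes _ = refl
... | no  _ = refl

theorem9 : (π : Fin 4 → Permutation′ 4) →
    ((s t : Fin 4) → π s ≈ π t → s ≡ t) →
    QuasirandomForcing (map (λ t → 4 , π t) (allFin 4)) →
    ((i j : Fin 4) → A (π zero) i j + A (π (suc zero)) i j + A (π (suc (suc zero))) i j + A (π (suc (suc (suc zero)))) i j ≡ + 1)
    ⊎ ∃ λ (ρ : Permutation′ 4) → (i j : Fin 4) →
    A (π (ρ ⟨$⟩ʳ zero)) i j + A (π (ρ ⟨$⟩ʳ suc zero)) i j - A (π (ρ ⟨$⟩ʳ suc (suc zero))) i j - A (π (ρ ⟨$⟩ʳ suc (suc (suc zero)))) i j ≡ + 0
theorem9 π π-injective forcing = conclude (singular⊎invertible (x (# 0) (# 1) λ ()) (x (# 0) (# 2) λ ()) (x (# 0) (# 3) λ ()) (x (# 1) (# 2) λ ()) (x (# 1) (# 3) λ ()) (x (# 2) (# 3) λ ()))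
  where
  f : Fin 4 → Fin 4 → Fin 4
  f s = π s ⟨$⟩ʳ_

  agr : Fin 4 → Fin 4 → ℕ
  agr s t = agreements (f s) (f t)

  fewAgreements : ∀ s t → s ≢ t → ∃ λ (x : Fin 3) → toℕ x ≡ agr s t
  fewAgreements s t s≢t with distinct-agreements (proj₁ (index (π s))) (proj₁ (index (π t)))
  ... | inj₁ eq = ⊥-elim (s≢t (π-injective s t (λ i → trans (proj₂ (index (π s)) i) (trans (cong (λ k → lookup (table k) i) eq) (sym (proj₂ (index (π t)) i))))))
  ... | inj₂ (x , eq) = x , trans eq (sym (agreements-cong (proj₂ (index (π s))) (proj₂ (index (π t)))))

  x : ∀ s t → s ≢ t → Fin 3
  x s t s≢t = proj₁ (fewAgreements s t s≢t)

  counts : Vec (Fin 3) 6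
  counts = x (# 0) (# 1) (λ ()) ∷ᵥ x (# 0) (# 2) (λ ()) ∷ᵥ x (# 0) (# 3) (λ ()) ∷ᵥ x (# 1) (# 2) (λ ()) ∷ᵥ x (# 1) (# 3) (λ ()) ∷ᵥ x (# 2) (# 3) (λ ()) ∷ᵥ []ᵥ

  above : ∀ s t s≢t → + toℕ (x s t s≢t) - + 1 ≡ gram (f s) (f t)
  above s t s≢t = cong (λ n → + n - + 1) (proj₂ (fewAgreements s t s≢t))

  below : ∀ s t s≢t → + toℕ (x s t s≢t) - + 1 ≡ gram (f t) (f s)
  below s t s≢t = trans (above s t s≢t) (cong (λ n → + n - + 1) (agreements-sym (f s) (f t)))

  diagonal : ∀ s → + 3 ≡ gram (f s) (f s)
  diagonal s = cong (λ n → + n - + 1) (sym (agreements-refl (f s)))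

  gramMatrix≡ : ∀ s t → gramMatrix counts s t ≡ gram (f s) (f t)
  gramMatrix≡ zero zero = diagonal (# 0)
  gramMatrix≡ zero (suc zero) = above (# 0) (# 1) (λ ())
  gramMatrix≡ zero (suc (suc zero)) = above (# 0) (# 2) (λ ())
  gramMatrix≡ zero (suc (suc (suc zero))) = above (# 0) (# 3) (λ ())
  gramMatrix≡ (suc zero) zero = below (# 0) (# 1) (λ ())
  gramMatrix≡ (suc zero) (suc zero) = diagonal (# 1)
  gramMatrix≡ (suc zero) (suc (suc zero)) = above (# 1) (# 2) (λ ())
  gramMatrix≡ (suc zero) (suc (suc (suc zero))) = above (# 1) (# 3) (λ ())
  gramMatrix≡ (suc (suc zero)) zero = below (# 0) (# 2) (λ ())
  gramMatrix≡ (suc (suc zero)) (suc zero) = below (# 1) (# 2) (λ ())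
  gramMatrix≡ (suc (suc zero)) (suc (suc zero)) = diagonal (# 2)
  gramMatrix≡ (suc (suc zero)) (suc (suc (suc zero))) = above (# 2) (# 3) (λ ())
  gramMatrix≡ (suc (suc (suc zero))) zero = below (# 0) (# 3) (λ ())
  gramMatrix≡ (suc (suc (suc zero))) (suc zero) = below (# 1) (# 3) (λ ())
  gramMatrix≡ (suc (suc (suc zero))) (suc (suc zero)) = below (# 2) (# 3) (λ ())
  gramMatrix≡ (suc (suc (suc zero))) (suc (suc (suc zero))) = diagonal (# 3)

  module _ {w : Vec (Fin 3) 6} (eq : counts ≡ w) where

    a₀₁ : agr (# 0) (# 1) ≡ toℕ (lookup w (# 0))
    a₀₁ = trans (sym (proj₂ (fewAgreements (# 0) (# 1) λ ()))) (cong (λ v → toℕ (lookup v (# 0))) eq)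
    a₀₂ : agr (# 0) (# 2) ≡ toℕ (lookup w (# 1))
    a₀₂ = trans (sym (proj₂ (fewAgreements (# 0) (# 2) λ ()))) (cong (λ v → toℕ (lookup v (# 1))) eq)
    a₀₃ : agr (# 0) (# 3) ≡ toℕ (lookup w (# 2))
    a₀₃ = trans (sym (proj₂ (fewAgreements (# 0) (# 3) λ ()))) (cong (λ v → toℕ (lookup v (# 2))) eq)
    a₁₂ : agr (# 1) (# 2) ≡ toℕ (lookup w (# 3))
    a₁₂ = trans (sym (proj₂ (fewAgreements (# 1) (# 2) λ ()))) (cong (λ v → toℕ (lookup v (# 3))) eq)
    a₁₃ : agr (# 1) (# 3) ≡ toℕ (lookup w (# 4))
    a₁₃ = trans (sym (proj₂ (fewAgreements (# 1) (# 3) λ ()))) (cong (λ v → toℕ (lookup v (# 4))) eq)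
    a₂₃ : agr (# 2) (# 3) ≡ toℕ (lookup w (# 5))
    a₂₃ = trans (sym (proj₂ (fewAgreements (# 2) (# 3) λ ()))) (cong (λ v → toℕ (lookup v (# 5))) eq)

  flip : ∀ {n} s t → agr s t ≡ n → agr t s ≡ n
  flip s t = trans (agreements-sym (f t) (f s))

  ones : (∀ i j → ind (f (# 0) i) j + ind (f (# 1) i) j + ind (f (# 2) i) j + ind (f (# 3) i) j ≡ + 1) →
    ∀ i j → A (π (# 0)) i j + A (π (# 1)) i j + A (π (# 2)) i j + A (π (# 3)) i j ≡ + 1
  ones eq i j = trans (cong₂ _+_ (cong₂ _+_ (cong₂ _+_ (A≡ind (π (# 0)) i j) (A≡ind (π (# 1)) i j)) (A≡ind (π (# 2)) i j)) (A≡ind (π (# 3)) i j)) (eq i j)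

  zeros : ∀ a b c d → (∀ i j → ind (f a i) j + ind (f b i) j - ind (f c i) j - ind (f d i) j ≡ + 0) →
    ∀ i j → A (π a) i j + A (π b) i j - A (π c) i j - A (π d) i j ≡ + 0
  zeros a b c d eq i j = trans (cong₂ _-_ (cong₂ _-_ (cong₂ _+_ (A≡ind (π a) i j) (A≡ind (π b) i j)) (A≡ind (π c) i j)) (A≡ind (π d) i j)) (eq i j)

  conclude : Any (counts ≡_) singularPatterns ⊎ Invertible (gramMatrix counts) → _
  conclude (inj₂ invertible) = ⊥-elim (invertible⇒¬forcing π (gramMatrix counts) gramMatrix≡ invertible forcing)
  conclude (inj₁ (here e)) = inj₁ (ones (disjoint⇒all-one (f (# 0)) (f (# 1)) (f (# 2)) (f (# 3)) (a₀₁ e) (a₀₂ e) (a₀₃ e) (a₁₂ e) (a₁₃ e) (a₂₃ e)))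
  -- In this pattern and the next two, the pairs without agreement are 01 and 23, then 02 and 13,
  -- then 03 and 12. The permutation supplied lists one of these pairs before the other.
  conclude (inj₁ (there (here e))) = inj₂ (Perm.id , zeros (# 0) (# 1) (# 2) (# 3)
    (paired⇒zero (f (# 0)) (f (# 1)) (f (# 2)) (f (# 3)) (a₀₁ e) (a₂₃ e) (a₀₂ e) (a₀₃ e) (a₁₂ e) (a₁₃ e)))
  conclude (inj₁ (there (there (here e)))) = inj₂ (transpose (# 1) (# 2) , zeros (# 0) (# 2) (# 1) (# 3)
    (paired⇒zero (f (# 0)) (f (# 2)) (f (# 1)) (f (# 3)) (a₀₂ e) (a₁₃ e) (a₀₁ e) (a₀₃ e) (flip (# 1) (# 2) (a₁₂ e)) (a₂₃ e)))
  conclude (inj₁ (there (there (there (here e))))) = inj₂ (transpose (# 1) (# 3) , zeros (# 0) (# 3) (# 2) (# 1)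
    (paired⇒zero (f (# 0)) (f (# 3)) (f (# 2)) (f (# 1)) (a₀₃ e) (flip (# 1) (# 2) (a₁₂ e)) (a₀₂ e) (a₀₁ e) (flip (# 2) (# 3) (a₂₃ e)) (flip (# 1) (# 3) (a₁₃ e))))
  -- In the last four patterns one permutation, in turn number 0, 1, 2 and 3, agrees twice with each
  -- of the others, and these are pairwise without agreement.
  conclude (inj₁ (there (there (there (there (here e)))))) =
    ⊥-elim (no-triple (f (# 0)) (f (# 1)) (f (# 2)) (f (# 3)) (a₀₁ e) (a₀₂ e) (a₀₃ e) (a₁₂ e) (a₁₃ e) (a₂₃ e))
  conclude (inj₁ (there (there (there (there (there (here e))))))) =
    ⊥-elim (no-triple (f (# 1)) (f (# 0)) (f (# 2)) (f (# 3)) (flip (# 0) (# 1) (a₀₁ e)) (a₁₂ e) (a₁₃ e) (a₀₂ e) (a₀₃ e) (a₂₃ e))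
  conclude (inj₁ (there (there (there (there (there (there (here e)))))))) =
    ⊥-elim (no-triple (f (# 2)) (f (# 0)) (f (# 1)) (f (# 3)) (flip (# 0) (# 2) (a₀₂ e)) (flip (# 1) (# 2) (a₁₂ e)) (a₂₃ e) (a₀₁ e) (a₀₃ e) (a₁₃ e))
  conclude (inj₁ (there (there (there (there (there (there (there (here e))))))))) =
    ⊥-elim (no-triple (f (# 3)) (f (# 0)) (f (# 1)) (f (# 2)) (flip (# 0) (# 3) (a₀₃ e)) (flip (# 1) (# 3) (a₁₃ e)) (flip (# 2) (# 3) (a₂₃ e)) (a₀₁ e) (a₀₂ e) (a₁₂ e))
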